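{- Let $t \geq 2$ be an integer and set $n = 9t^2-3t+1$ and $r = 3t^2-2t+1$. Then the Cayley complement $\overline{C}(\mathbb{Z}_n,\{1,3t-1,3t\})$ is $r$-primitive.
   Context: For a finite group $\Gamma$ and a set $S\subseteq\Gamma$, the Cayley graph $C(\Gamma,S)$ has vertex set $\Gamma$, with distinct $x,y$ adjacent iff $x=yz$ or $x=yz^{ -1}$ for some $z\in S$. For $\Gamma=\mathbb{Z}_n$ (written additively) this means distinct $x,y\in\mathbb{Z}_n$ are adjacent iff $x-y\equiv \pm s \pmod n$ for some $s\in S$. The Cayley complement $\overline{C}(\Gamma,S)$ is the (simple) graph complement of $C(\Gamma,S)$. A graph $G$ (with at least $r$ vertices) is uniquely $K_r$-saturated if $G$ contains no clique on $r$ vertices and, for every pair of nonadjacent vertices $u,v$, the graph $G+uv$ contains exactly one clique on $r$ vertices. A graph is $r$-primitive if it is uniquely $K_r$-saturated and has no dominating vertex (a vertex adjacent to all other vertices). -}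

module Defs where

open import Data.Nat using (ℕ; suc; _+_; _*_; _∸_; _%_; NonZero)
open import Data.Fin using (Fin; toℕ)
open import Data.Fin.Subset using (Subset; _∈_; ∣_∣)
open import Data.List using (List)
open import Data.List.Membership.Propositional renaming (_∈_ to _∈ₗ_)
open import Data.Product using (Σ; ∃; _×_; _,_)
open import Data.Sum using (_⊎_)
open import Relation.Nullary using (¬_)
open import Relation.Binary.PropositionalEquality using (_≡_; _≢_)

-- A (simple) graph on vertex set Fin n, given by its adjacency relation.
-- Loops are excluded by the predicates below (distinctness is required).
Graph : ℕ → Set₁
Graph n = Fin n → Fin n → Set

Cayley : (n : ℕ) → .{{NonZero n}} → List ℕ → Graph n
Cayley n S x y =
  (x ≢ y) × ∃ λ s → (s ∈ₗ S) ×
    (((toℕ y + s) % n ≡ toℕ x) ⊎ ((toℕ x + s) % n ≡ toℕ y))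

Complement : {n : ℕ} → Graph n → Graph n
Complement G x y = (x ≢ y) × ¬ G x y

AddEdge : {n : ℕ} → Graph n → Fin n → Fin n → Graph n
AddEdge G u v x y = G x y ⊎ ((x ≡ u × y ≡ v) ⊎ (x ≡ v × y ≡ u))

IsClique : {n : ℕ} → Graph n → ℕ → Subset n → Set
IsClique G r K = (∣ K ∣ ≡ r) × (∀ x y → x ∈ K → y ∈ K → x ≢ y → G x y)

UniquelySaturated : {n : ℕ} → Graph n → ℕ → Set
UniquelySaturated {n} G r =
  (r Data.Nat.≤ n) ×
  ((∀ K → ¬ IsClique G r K) ×
   (∀ u v → u ≢ v → ¬ G u v →
      Σ (Subset n) λ K → IsClique (AddEdge G u v) r K ×
        (∀ K′ → IsClique (AddEdge G u v) r K′ → K′ ≡ K)))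

Dominating : {n : ℕ} → Graph n → Fin n → Set
Dominating G x = ∀ y → x ≢ y → G x y

Primitive : {n : ℕ} → Graph n → ℕ → Set
Primitive G r = UniquelySaturated G r × (∀ x → ¬ Dominating G x)

{-# OPTIONS --safe #-}
module Submission where

-- Write m = 3 t, so n = m² − m + 1 and m² ≡ m − 1 (mod n).  Multiplication by m permutes
-- ± 1, ± (m − 1), ± m cyclically, so the Cayley graph C is a quotient of the triangular lattice, and
-- every edge can be moved to {0, m} by a map x ↦ c + g x.  A clique of the complement is an
-- independent set X of C.
--
-- Put x at position 2 x and x + m at position 2 x + 1.  Three consecutive positions form a
-- triangle, so hits (positions of elements of X) are at distance 3 + g with g ≥ 0; the sum of the
-- g is the excess.  The element at an odd position q is also at the even position q + M, where
-- M = 2 m − 1 ≡ 2 (mod 3), so each such window has excess at least 2.  Chaining windows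
-- by steps of 3 bounds the total excess from below, hence |X| from above.  An independent set with r
-- elements would leave no slack: then x ∈ X implies x + m + 1 ∈ X, which leads around
-- to x − m ∈ X, a contradiction.
--
-- If {0, m} is the only edge inside X, the strip is cut between positions 0 and 1, where these two
-- elements are adjacent, and the bound forces the first window to have excess exactly 2.  If this
-- excess is made up of two gaps of 4, such gaps recur with period M along the whole strip, and the
-- pattern fails to close up.  So it is a single gap of 5; by symmetry under x ↦ m − x the same
-- holds at the other end, and then all windows begin with a gap of 5 followed by gaps of 3.
-- This determines X: it consists of 0 and of the x in [0, n) for which x mod (m + 1) is a
-- nonzero multiple of 3.

-- The parameters leave no room: 2 n = (m - 2)(M + 3) + 6, and 2 r hits in the strip of length 2 n
-- have total excess 2 n - 6 r = 2 (m - 2), which is 2 for each of m - 2 windows followed by a step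
-- of 3. The obstacle is that windows need not follow each other so closely: after a window the walk
-- may linger on even positions or take a longer step, and fewer windows then fit. So the bound is
-- proved with a variable shortfall of length, one unit of excess being worth 4 units of length. A
-- gap of 4 between two even hits (length 4, excess 1) costs exactly this rate. Counting alone can
-- therefore never exclude such gaps, and this is why the case of one edge needs the comparison of
-- the strip with its translate by M. In that case the cut strip has surplus excess 2. A gap of 5 at
-- each end settles where the surplus goes: the last 8 positions absorb it, and everything before
-- them is as tight as in the independent case. In the code u = t - 1, so m = 3 + 3 u and m - 2 = 1
-- + 3 u, while M + 3 = 8 + 6 u is the cost in length of one window; `N` = n - 1 serves as -1 modulo
-- n.

open import Defs
open import Data.Bool using (Bool; true; false)
import Data.Bool.Properties as Bool
open import Data.Empty using (⊥; ⊥-elim)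
open import Data.Fin using (Fin; toℕ)
open import Data.Fin.Permutation using (Permutation′; permutation)
open import Data.Fin.Properties using (toℕ-fromℕ<; toℕ-injective; toℕ<n)
open import Data.Fin.Subset using (Subset; _∈_; ∣_∣)
open import Data.List using (List; []; _∷_; _++_; length; replicate)
open import Data.List.Membership.Propositional using (find; lose) renaming (_∈_ to _∈ₗ_)
open import Data.List.Properties using (length-++; ++-identityʳ)
open import Data.List.Relation.Unary.All as All using (All)
open import Data.List.Relation.Unary.All.Properties using (++⁺; ++⁻ʳ; ++⁻ˡ)
open import Data.List.Relation.Unary.Any using (here; there; any?)
open import Data.Nat using (ℕ; zero; suc; _+_; _*_; _∸_; _≤_; _<_; z≤n; s≤s; _≤?_; _≟_; _%_; _/_)
open import Data.Nat.DivMod using (_mod_; m≡m%n+[m/n]*n; [m+kn]%n≡m%n; [m+n]%n≡m%n; m<n⇒m%n≡m; m%n<n)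
open import Data.Nat.ListAction using (sum)
open import Data.Nat.ListAction.Properties using (sum-++)
open import Data.Nat.Properties
open import Algebra.Properties.CommutativeMonoid.Sum +-0-commutativeMonoid using (sum-permute; sum-cong-≗) renaming (sum to ∑)
open import Data.Nat.Tactic.RingSolver using (solve)
open import Data.Product using (Σ; ∃; _×_; _,_; proj₁; proj₂)
open import Data.Sum using (_⊎_; inj₁; inj₂)
open import Data.Vec as Vec using (lookup; tabulate)
open import Data.Vec.Properties using ([]=⇒lookup; lookup⇒[]=; lookup∘tabulate; tabulate∘lookup; tabulate-cong)
open import Function using (_∘_)
open import Relation.Binary.PropositionalEquality using (_≡_; _≢_; refl; sym; trans; cong; cong₂; subst; module ≡-Reasoning)
open import Relation.Nullary using (¬_; Dec; yes; no)
open import Relation.Nullary.Decidable using (_×-dec_; _⊎-dec_; map′)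

-- Linear arithmetic

-- A certificate for linear arithmetic: `a ≤ b` is a combination of hypotheses and `k` is the slack,
-- so only a polynomial identity is left to the ring solver. Equalities are obtained from two
-- certificates, one for each direction.
from : ∀ {a b x y} k → a ≤ b → x + b + k ≡ y + a → x ≤ y
from {a} {b} {x} {y} k a≤b eq = +-cancelʳ-≤ b x y (begin
  x + b      ≤⟨ m≤m+n (x + b) k ⟩
  x + b + k  ≡⟨ eq ⟩
  y + a      ≤⟨ +-monoʳ-≤ y a≤b ⟩
  y + b      ∎)
  where open ≤-Reasoning

infixl 6 _⊕_
infixr 7 _⊛_

_⊕_ : ∀ {a b c d} → a ≤ b → c ≤ d → a + c ≤ b + d
_⊕_ = +-mono-≤

_⊛_ : ∀ k {a b} → a ≤ b → k * a ≤ k * b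
k ⊛ p = *-monoʳ-≤ k p

mod-unique : ∀ w a b {i j} → i < w → j < w → a * w + i ≡ b * w + j → a ≡ b × i ≡ j
mod-unique w zero    zero    _   _   eq = refl , eq
mod-unique w zero    (suc b) {j = j} i<w _ eq =
    ⊥-elim (<⇒≱ i<w (subst (w ≤_) (sym eq) (≤-trans (m≤m+n w (b * w)) (m≤m+n _ j))))
mod-unique w (suc a) zero    {i} _ j<w eq =
    ⊥-elim (<⇒≱ j<w (subst (w ≤_) eq (≤-trans (m≤m+n w (a * w)) (m≤m+n _ i))))
mod-unique w (suc a) (suc b) {i} {j} i<w j<w eq with mod-unique w a b i<w j<w
  (+-cancelˡ-≡ w _ _ (trans (sym (+-assoc w (a * w) i)) (trans eq (+-assoc w (b * w) j))))
... | a≡b , i≡j = cong suc a≡b , i≡j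

+-swap : ∀ a b c → a + (b + c) ≡ b + (a + c)
+-swap a b c = solve (a ∷ b ∷ c ∷ [])

-- Parity

-- Inductive parities let a pattern match strip concrete constants such as the 3 in `3 + z`, which
-- is how gaps of the wrong parity are ruled out.
data Even : ℕ → Set
data Odd  : ℕ → Set

data Even where
  zero : Even zero
  suc  : ∀ {z} → Odd z → Even (suc z)

data Odd where
  suc : ∀ {z} → Even z → Odd (suc z)

parity : ∀ z → Even z ⊎ Odd z
parity zero = inj₁ zero
parity (suc z) with parity z
... | inj₁ e = inj₂ (suc e)
... | inj₂ o = inj₁ (suc o)

even-odd-⊥ : ∀ {z} → Even z → Odd z → ⊥
even-odd-⊥ (suc o) (suc e) = even-odd-⊥ e o

even+even : ∀ {a b} → Even a → Even b → Even (a + b)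
odd+even  : ∀ {a b} → Odd a → Even b → Odd (a + b)
even+even zero    f = f
even+even (suc o) f = suc (odd+even o f)
odd+even  (suc e) f = suc (even+even e f)

even+odd : ∀ {a b} → Even a → Odd b → Odd (a + b)
odd+odd  : ∀ {a b} → Odd a → Odd b → Even (a + b)
even+odd zero    f = f
even+odd (suc o) f = suc (odd+odd o f)
odd+odd  (suc e) f = suc (even+odd e f)

even-+-even⁻¹ : ∀ {a b} → Even b → Even (a + b) → Even a
even-+-even⁻¹ {a} f s with parity a
... | inj₁ e = e
... | inj₂ o = ⊥-elim (even-odd-⊥ s (odd+even o f))

even-6* : ∀ u → Even (6 * u)
even-6* u = subst Even (*-comm u 6) (go u)
  where
  go : ∀ u → Even (u * 6)
  go zero    = zero
  go (suc u) = suc (suc (suc (suc (suc (suc (go u))))))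

-- Runs of hits

-- Run H a gs b: walking from a to b through the consecutive elements of H,
-- the successive distances are 3 + g for g in gs.
data Run (H : ℕ → Set) : ℕ → List ℕ → ℕ → Set where
  stop : ∀ {z} → Run H z [] z
  step : ∀ {z g gs e} → (∀ i → i < 2 + g → ¬ H (suc i + z)) → H (3 + g + z) →
         Run H (3 + g + z) gs e → Run H z (g ∷ gs) e

span : List ℕ → ℕ
span gs = 3 * length gs + sum gs

span-++ : ∀ gs hs → span (gs ++ hs) ≡ span gs + span hs
span-++ gs hs = begin
  3 * length (gs ++ hs) + sum (gs ++ hs)
    ≡⟨ cong₂ (λ l s → 3 * l + s) (length-++ gs) (sum-++ gs hs) ⟩
  3 * (length gs + length hs) + (sum gs + sum hs)
    ≡⟨ regroup (length gs) (length hs) (sum gs) (sum hs) ⟩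
  span gs + span hs ∎
  where
  open ≡-Reasoning
  regroup : ∀ k l s t → 3 * (k + l) + (s + t) ≡ 3 * k + s + (3 * l + t)
  regroup k l s t = solve (k ∷ l ∷ s ∷ t ∷ [])

span-∷ : ∀ g gs → span (g ∷ gs) ≡ 3 + g + span gs
span-∷ g gs = regroup (length gs) g (sum gs)
  where
  regroup : ∀ l g s → 3 * (1 + l) + (g + s) ≡ 3 + g + (3 * l + s)
  regroup l g s = solve (l ∷ g ∷ s ∷ [])

past-gap : ∀ g a {i j} → 2 + g + j ≡ i → suc i + a ≡ j + (3 + g + a)
past-gap g a {j = j} refl = trans (cong (_+ a) (+-comm (3 + g) j)) (+-assoc j (3 + g) a)

module _ {H : ℕ → Set} where

  run-end : ∀ {a gs b} → Run H a gs b → b ≡ span gs + a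
  run-end stop = refl
  run-end {a} {g ∷ gs} {b} (step _ _ r) = begin
    b                       ≡⟨ run-end r ⟩
    span gs + (3 + g + a)   ≡⟨ sym (+-assoc (span gs) (3 + g) a) ⟩
    span gs + (3 + g) + a   ≡⟨ cong (_+ a) (trans (+-comm (span gs) (3 + g)) (sym (span-∷ g gs))) ⟩
    span (g ∷ gs) + a       ∎
    where open ≡-Reasoning

  run-≤ : ∀ {a gs b} → Run H a gs b → a ≤ b
  run-≤ {a} {gs} r = subst (a ≤_) (sym (run-end r)) (m≤n+m a (span gs))

  run-++ : ∀ {a gs b hs c} → Run H a gs b → Run H b hs c → Run H a (gs ++ hs) c
  run-++ stop         s = s
  run-++ (step n h r) s = step n h (run-++ r s)

  run-target : ∀ {a gs b} → H a → Run H a gs b → H b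
  run-target h stop         = h
  run-target _ (step _ h r) = run-target h r

  next-≤ : ∀ {a g gs b i} → Run H a (g ∷ gs) b → H (suc i + a) → 2 + g ≤ i
  next-≤ {g = g} {i = i} (step n _ _) h with 2 + g ≤? i
  ... | yes p = p
  ... | no ¬p = ⊥-elim (n i (≰⇒> ¬p) h)

  record Split (a : ℕ) (gs : List ℕ) (y b : ℕ) : Set where
    constructor split
    field
      {before after} : List ℕ
      appended       : gs ≡ before ++ after
      left           : Run H a before y
      right          : Run H y after b

  -- The gaps of a run contain no hits, so the run must stop at every hit between its ends.
  run-split : ∀ {a gs b} i → Run H a gs b → H (i + a) → i + a ≤ b → Split a gs (i + a) b
  run-split zero r _ _ = split refl stop r
  run-split {a} (suc i) stop _ le = ⊥-elim (m+n≮n i a le)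
  run-split {a} {g ∷ gs} {b} (suc i) r@(step n h r′) hy le with m≤n⇒∃[o]m+o≡n (next-≤ r hy)
  ... | j , eq with suc i + a | past-gap g a eq
  ...   | _ | refl with run-split j r′ hy le
  ...     | split app l r″ = split (cong (g ∷_) app) (step n h l) r″

  run-split-at : ∀ {a gs b y} → Run H a gs b → H y → a ≤ y → y ≤ b → Split a gs y b
  run-split-at {a} {gs} {b} r h a≤y y≤b with m≤n⇒∃[o]m+o≡n a≤y
  ... | i , refl = subst (λ y → Split a gs y b) (+-comm i a)
    (run-split i r (subst H (+-comm a i) h) (subst (_≤ b) (+-comm a i) y≤b))

  next-hit-≤ : ∀ {a g gs b y} → Run H a (g ∷ gs) b → H y → a < y → 3 + g + a ≤ y
  next-hit-≤ {a} {g} r h a<y with m≤n⇒∃[o]m+o≡n a<y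
  ... | i , refl = s≤s (subst (2 + g + a ≤_) (+-comm i a)
    (+-monoˡ-≤ a (next-≤ r (subst H (cong suc (+-comm a i)) h))))

-- A run accounts for all hits between its ends, so two runs with the same gaps have their hits at
-- the same relative positions.
run-transport : ∀ {H H′ : ℕ → Set} {a gs b a′ b′} → Run H a gs b → Run H′ a′ gs b′ → H′ a′ →
                ∀ i → i + a ≤ b → H (i + a) → H′ (i + a′)
run-transport r r′ h′ zero _ _ = h′
run-transport {a = a} stop stop h′ (suc i) le _ =
  ⊥-elim (m+n≮n i a le)
run-transport {H} {H′} {a} {g ∷ gs} {b} {a′} r@(step _ _ s) (step _ h′ s′) _ (suc i) le hi
  with m≤n⇒∃[o]m+o≡n (next-≤ r hi)
... | j , eq = subst H′ (sym (past-gap g a′ eq))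
  (run-transport s s′ h′ j (subst (_≤ b) (past-gap g a eq) le) (subst H (past-gap g a eq) hi))

module _ {H : ℕ → Set} (hit? : ∀ z → Dec (H z))
         (sep₁ : ∀ {z} → H z → H (1 + z) → ⊥) (sep₂ : ∀ {z} → H z → H (2 + z) → ⊥) where

  private
    first : ∀ z d → H (suc d + z) → ∃ λ i → i ≤ d × H (suc i + z) × (∀ j → j < i → ¬ H (suc j + z))
    first z d hd with go d
      where
      go : ∀ d → (∃ λ i → i < d × H (suc i + z) × (∀ j → j < i → ¬ H (suc j + z))) ⊎ (∀ j → j < d →
          ¬ H (suc j + z))
      go zero = inj₂ λ _ ()
      go (suc d) with go d
      ... | inj₁ (i , i<d , h , n) = inj₁ (i , m<n⇒m<1+n i<d , h , n)
      ... | inj₂ n with hit? (suc d + z)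
      ...   | yes h = inj₁ (d , n<1+n d , h , n)
      ...   | no ¬h = inj₂ λ j j<1+d → case j (m≤n⇒m<n∨m≡n (≤-pred j<1+d))
        where
        case : ∀ j → j < d ⊎ j ≡ d → ¬ H (suc j + z)
        case j (inj₁ j<d)  = n j j<d
        case j (inj₂ refl) = ¬h
    ... | inj₁ (i , i<d , h , n) = i , <⇒≤ i<d , h , n
    ... | inj₂ n = d , ≤-refl , hd , n

    -- The fuel `f` bounds the distance `d`: each gap found shortens it by an amount that is only
    -- known after the search.
    build : ∀ f z d → d ≤ f → H z → H (d + z) → ∃ λ gs → Run H z gs (d + z)
    build f z zero _ _ _ = [] , stop
    build (suc f) z (suc d) (s≤s d≤f) hz he with first z d he
    ... | zero , _ , h , _ = ⊥-elim (sep₁ hz h)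
    ... | suc zero , _ , h , _ = ⊥-elim (sep₂ hz h)
    ... | suc (suc g) , i≤d , h , n with m≤n⇒∃[o]m+o≡n i≤d
    ...   | o , eq with suc d + z | past-gap g z eq
    ...     | _ | refl with build f (3 + g + z) o (≤-trans (subst (o ≤_) eq (m≤n+m o (2 + g))) d≤f) h he
    ...       | gs , r = g ∷ gs , step n h r

  run-between : ∀ z d → H z → H (d + z) → ∃ λ gs → Run H z gs (d + z)
  run-between z d = build d z d ≤-refl

≢-mod-3 : ∀ {i j} l k → i < 3 → j < 3 → ¬ i ≡ j → 3 * l + i ≡ 3 * k + j → ⊥
≢-mod-3 {i} {j} l k i<3 j<3 i≢j eq = i≢j (proj₂ (mod-unique 3 l k i<3 j<3
  (trans (cong (_+ i) (*-comm l 3)) (trans eq (cong (_+ j) (*-comm 3 k))))))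

1<3 : 1 < 3
1<3 = s≤s (s≤s z≤n)

0<3 : 0 < 3
0<3 = s≤s z≤n

2<3 : 2 < 3
2<3 = s≤s (s≤s (s≤s z≤n))

-- The window length 5 + 6 u is 2 modulo 3, and so is the excess.
2≤window-sum : ∀ u l s → 3 * l + s ≡ 5 + 6 * u → 2 ≤ s
2≤window-sum u l zero eq = ⊥-elim (≢-mod-3 l (1 + 2 * u) 0<3 2<3 (λ ()) (shape eq))
  where
  shape : 3 * l + 0 ≡ 5 + 6 * u → 3 * l + 0 ≡ 3 * (1 + 2 * u) + 2
  shape p₁ = ≤-antisym (from 0 (≤-reflexive p₁) (solve (l ∷ u ∷ [])))
    (from 0 (≤-reflexive (sym p₁)) (solve (l ∷ u ∷ [])))
2≤window-sum u l (suc zero) eq = ⊥-elim (≢-mod-3 l (1 + 2 * u) 1<3 2<3 (λ ()) (shape eq))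
  where
  shape : 3 * l + 1 ≡ 5 + 6 * u → 3 * l + 1 ≡ 3 * (1 + 2 * u) + 2
  shape p₁ = ≤-antisym (from 0 (≤-reflexive p₁) (solve (l ∷ u ∷ [])))
    (from 0 (≤-reflexive (sym p₁)) (solve (l ∷ u ∷ [])))
2≤window-sum u l (suc (suc s)) eq = s≤s (s≤s z≤n)

-- In the residue class of 2 modulo 3 the next possible excess is 5.
window-sum≤4 : ∀ u l s → 3 * l + s ≡ 5 + 6 * u → s ≤ 4 → s ≡ 2 × l ≡ 1 + 2 * u
window-sum≤4 u l zero eq _ with 2≤window-sum u l 0 eq
... | ()
window-sum≤4 u l (suc zero) eq _ with 2≤window-sum u l 1 eq
... | s≤s ()
window-sum≤4 u l (suc (suc zero)) eq _ = refl , proj₁ (mod-unique 3 l (1 + 2 * u) 2<3 2<3 (shape eq))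
  where
  shape : 3 * l + 2 ≡ 5 + 6 * u → l * 3 + 2 ≡ (1 + 2 * u) * 3 + 2
  shape p₁ = ≤-antisym (from 0 (≤-reflexive p₁) (solve (l ∷ u ∷ [])))
    (from 0 (≤-reflexive (sym p₁)) (solve (l ∷ u ∷ [])))
window-sum≤4 u l 3 eq _ = ⊥-elim (≢-mod-3 (1 + l) (1 + 2 * u) 0<3 2<3 (λ ()) (shape eq))
  where
  shape : 3 * l + 3 ≡ 5 + 6 * u → 3 * (1 + l) + 0 ≡ 3 * (1 + 2 * u) + 2
  shape p₁ = ≤-antisym (from 0 (≤-reflexive p₁) (solve (l ∷ u ∷ [])))
    (from 0 (≤-reflexive (sym p₁)) (solve (l ∷ u ∷ [])))
window-sum≤4 u l 4 eq _ = ⊥-elim (≢-mod-3 (1 + l) (1 + 2 * u) 1<3 2<3 (λ ()) (shape eq))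
  where
  shape : 3 * l + 4 ≡ 5 + 6 * u → 3 * (1 + l) + 1 ≡ 3 * (1 + 2 * u) + 2
  shape p₁ = ≤-antisym (from 0 (≤-reflexive p₁) (solve (l ∷ u ∷ [])))
    (from 0 (≤-reflexive (sym p₁)) (solve (l ∷ u ∷ [])))
window-sum≤4 u l (suc (suc (suc (suc (suc _))))) _ (s≤s (s≤s (s≤s (s≤s ()))))

small-sum : ∀ {xs} → sum xs ≤ 1 → All (_≤ 1) xs
small-sum {[]}     _  = All.[]
small-sum {x ∷ xs} le = ≤-trans (m≤m+n x (sum xs)) le All.∷ small-sum (≤-trans (m≤n+m (sum xs) x) le)

all-zero : ∀ xs → sum xs ≡ 0 → xs ≡ replicate (length xs) 0
all-zero []          _ = refl
all-zero (zero ∷ xs) p = cong (0 ∷_) (all-zero xs p)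

-- The gaps of one window of the extremal set: a 5 followed by 3s, of span 5 + 6 u. In `blocks` such
-- windows are joined by single steps of 3.
block : ℕ → List ℕ
block u = 2 ∷ replicate (2 * u) 0

blocks : ℕ → ℕ → List ℕ
blocks u zero    = block u
blocks u (suc k) = block u ++ 0 ∷ blocks u k

-- Excess bounds and rigidity on a strip of hits

module Strip (u : ℕ) (H : ℕ → Set) (top : ℕ)
  (sep₁ : ∀ {z} → H z → H (1 + z) → ⊥)
  (sep₂ : ∀ {z} → H z → H (2 + z) → ⊥)
  -- An odd position and its translate by 5 + 6 u hold the same group element; only the upward
  -- direction can leave the strip.
  (up   : ∀ {q} → Odd q → H q → 5 + 6 * u + q ≤ top → H (5 + 6 * u + q))
  (down : ∀ {q} → Odd q → H (5 + 6 * u + q) → H q)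
  where

  M : ℕ
  M = 5 + 6 * u

  odd-M : Odd M
  odd-M = suc (suc (suc (suc (suc (even-6* u)))))

  -- `blocked` concerns an odd hit whose translate would lie 2 beyond the end `e`, too close to it.
  -- For `e` equal to `top` that translate is outside the strip, so `up` cannot supply this.
  module Bound {e : ℕ} (even-e : Even e) (e≤top : e ≤ top)
    (blocked : ∀ {q} → Odd q → M + q ≡ 2 + e → ¬ H q) where

    private
      base-rate : ∀ K y → K * (8 + 6 * u) ≤ y → 8 * K ≤ y
      base-rate K y p₁ = from (6 * K * u) p₁ (solve (K ∷ u ∷ y ∷ []))
      room-odd : ∀ K y C g D → K * (8 + 6 * u) ≤ C + y → C ≡ 3 + g + D → K * (8 + 6 * u) ≤ 3 + D + (g + y)
      room-odd K y C g D p₁ p₂ = from 0 (p₁ ⊕ (≤-reflexive p₂)) (solve (K ∷ u ∷ C ∷ y ∷ g ∷ D ∷ []))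
      pay-odd : ∀ K y s g → 8 * K ≤ 4 * s + (g + y) → 8 * K ≤ 4 * (g + s) + y
      pay-odd K y s g p₁ = from (3 * g) p₁ (solve (K ∷ s ∷ g ∷ y ∷ []))
      room-even : ∀ K y C g D → K * (8 + 6 * u) ≤ C + y → C ≡ 3 + g + D → K * (8 + 6 * u) ≤ D + (3 + g + y)
      room-even K y C g D p₁ p₂ = from 0 (p₁ ⊕ (≤-reflexive p₂)) (solve (K ∷ u ∷ C ∷ y ∷ g ∷ D ∷ []))
      pay-even : ∀ K y s g → 8 * K ≤ 4 * s + (3 + g + y) → 1 ≤ g → 8 * K ≤ 4 * (g + s) + y
      pay-even K y s g p₁ p₂ = from 0 (p₁ ⊕ 3 ⊛ p₂) (solve (K ∷ s ∷ g ∷ y ∷ []))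
      room-window : ∀ K y C B D → (1 + K) * (8 + 6 * u) ≤ 3 + C + y → C ≡ B + D → B ≡ 5 + 6 * u →
          K * (8 + 6 * u) ≤ D + y
      room-window K y C B D p₁ p₂ p₃ =
          from 0 (p₁ ⊕ (≤-reflexive p₂) ⊕ (≤-reflexive p₃)) (solve (K ∷ u ∷ C ∷ y ∷ B ∷ D ∷ []))
      pay-window : ∀ K y s1 s2 s → 8 * K ≤ 4 * s2 + y → 2 ≤ s1 → s ≡ s1 + s2 → 8 * (1 + K) ≤ 4 * s + y
      pay-window K y s1 s2 s p₁ p₂ p₃ =
          from 0 (p₁ ⊕ 4 ⊛ p₂ ⊕ 4 ⊛ (≤-reflexive (sym p₃))) (solve (K ∷ s2 ∷ y ∷ s1 ∷ s ∷ []))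
      pay-tail : ∀ K y D w s → (1 + K) * (8 + 6 * u) ≤ 3 + D + y → D + w ≡ 5 + 6 * u → 8 ≤ 4 * s + w →
          8 * (1 + K) ≤ 4 * s + y
      pay-tail K y D w s p₁ p₂ p₃ =
          from (6 * K * u) (p₁ ⊕ (≤-reflexive p₂) ⊕ p₃) (solve (K ∷ u ∷ D ∷ y ∷ w ∷ s ∷ []))

      -- The last window is cut off `w` before its end. Parity makes `w` even and `blocked` excludes
      -- 2; for 4 and 6 the span is not a multiple of 3, so there is some excess; from 8 on the
      -- shortfall pays alone.
      tail : ∀ {q} l s w → Odd q → H q → e ≡ 3 * l + s + q → 3 * l + s + w ≡ M → 1 ≤ w → 8 ≤ 4 * s + w
      tail {q} l s w oq hq e≡ D+w≡M 1≤w =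
          cases l s w D+w≡M 1≤w even-w (λ { refl → blocked oq (M+q≡ 2 refl) hq })
        where
        M+q≡ : ∀ v → w ≡ v → M + q ≡ v + e
        M+q≡ v refl = trans (shape M (3 * l + s) (sym D+w≡M)) (cong (v +_) (sym e≡))
          where
          shape : ∀ M D → M ≡ D + v → M + q ≡ v + (D + q)
          shape M D p₁ = ≤-antisym (from 0 (≤-reflexive p₁) (solve (M ∷ D ∷ v ∷ q ∷ [])))
            (from 0 (≤-reflexive (sym p₁)) (solve (M ∷ D ∷ v ∷ q ∷ [])))
        even-w : Even w
        even-w = even-+-even⁻¹ even-e (subst Even (M+q≡ w refl) (odd+odd odd-M oq))
        cases : ∀ l s w → 3 * l + s + w ≡ M → 1 ≤ w → Even w → (w ≡ 2 → ⊥) → 8 ≤ 4 * s + w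
        cases l s zero _ () _ _
        cases l s (suc (suc zero)) _ _ _ w≢2 = ⊥-elim (w≢2 refl)
        cases l (suc s) (suc (suc (suc (suc w)))) _ _ _ _ = ge
          where
          ge : 8 ≤ 4 * (1 + s) + (4 + w)
          ge = from (4 * s + w) (z≤n {0}) (solve (s ∷ w ∷ []))
        cases l zero (suc (suc (suc (suc zero)))) eq _ _ _ =
            ⊥-elim (≢-mod-3 (1 + l) (1 + 2 * u) 1<3 2<3 (λ ()) (shape eq))
          where
          shape : 3 * l + 0 + 4 ≡ 5 + 6 * u → 3 * (1 + l) + 1 ≡ 3 * (1 + 2 * u) + 2
          shape p₁ = ≤-antisym (from 0 (≤-reflexive p₁) (solve (l ∷ u ∷ [])))
            (from 0 (≤-reflexive (sym p₁)) (solve (l ∷ u ∷ [])))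
        cases l zero (suc (suc (suc (suc (suc (suc zero)))))) eq _ _ _ =
            ⊥-elim (≢-mod-3 (2 + l) (1 + 2 * u) 0<3 2<3 (λ ()) (shape eq))
          where
          shape : 3 * l + 0 + 6 ≡ 5 + 6 * u → 3 * (2 + l) + 0 ≡ 3 * (1 + 2 * u) + 2
          shape p₁ = ≤-antisym (from 0 (≤-reflexive p₁) (solve (l ∷ u ∷ [])))
            (from 0 (≤-reflexive (sym p₁)) (solve (l ∷ u ∷ [])))
        cases l zero (suc (suc (suc (suc (suc (suc (suc (suc w)))))))) _ _ _ _ = m≤m+n 8 w
        cases l s 1 _ _ (suc ()) _
        cases l s 3 _ _ (suc (suc (suc ()))) _
        cases l zero 5 _ _ (suc (suc (suc (suc (suc ()))))) _
        cases l zero 7 _ _ (suc (suc (suc (suc (suc (suc (suc ()))))))) _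

    -- Each window of length M starting at an odd hit ends at an even hit and has excess at
    -- least 2; it costs a further 3 to reach the next odd hit.  A shortfall y of the length is
    -- paid for at the rate of the cheapest waste, an even gap of 4 = 3 + 1.
    bound-even : ∀ f {z gs} → length gs ≤ f → Even z → H z → Run H z gs e →
                 ∀ K y → K * (8 + 6 * u) ≤ span gs + y → 8 * K ≤ 4 * sum gs + y
    bound-odd  : ∀ f {z gs} → length gs ≤ f → Odd z → H z → Run H z gs e →
                 ∀ K y → K * (8 + 6 * u) ≤ 3 + span gs + y → 8 * K ≤ 4 * sum gs + y

    bound-even f _ ez hz stop K y p = base-rate K y p
    bound-even (suc f) {z} {g ∷ gs} (s≤s len) ez hz (step _ h r) K y p with parity (3 + g + z)
    ... | inj₂ o = pay-odd K y (sum gs) g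
        (bound-odd f len o h r K (g + y) (room-odd K y (span (g ∷ gs)) g (span gs) p (span-∷ g gs)))
    bound-even (suc f) {z} {zero ∷ gs} (s≤s len) ez hz (step _ h r) K y p | inj₁ (suc (suc (suc o))) =
        ⊥-elim (even-odd-⊥ ez o)
    -- Between even hits the whole step 3 + g is lost length; 4 g covers it because g is at least 1,
    -- with equality for a gap of 4.
    bound-even (suc f) {z} {g@(suc _) ∷ gs} (s≤s len) ez hz (step _ h r) K y p | inj₁ e =
      pay-even K y (sum gs) g (bound-even f len e h r K (3 + g + y)
          (room-even K y (span (g ∷ gs)) g (span gs) p (span-∷ g gs))) (s≤s z≤n)

    bound-odd f len oz hz r zero y p = z≤n
    bound-odd f {z} {gs} len oz hz r (suc K) y p with M ≤? span gs
    ... | no M≰ with m≤n⇒∃[o]m+o≡n (<⇒≤ (≰⇒> M≰))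
    ...   | w , eq = pay-tail K y (span gs) w (sum gs) p eq (tail (length gs) (sum gs) w oz hz
        (run-end r) eq (pos w eq))
      where
      pos : ∀ w → span gs + w ≡ M → 1 ≤ w
      pos zero    eq = ⊥-elim (M≰ (≤-reflexive (trans (sym eq) (+-identityʳ _))))
      pos (suc _) _  = s≤s z≤n
    bound-odd f {z} {gs} len oz hz r (suc K) y p | yes M≤ with run-split M r
        (up oz hz (≤-trans M+z≤e e≤top)) M+z≤e
      where
      M+z≤e : M + z ≤ e
      M+z≤e = subst (M + z ≤_) (sym (run-end r)) (+-monoˡ-≤ z M≤)
    ... | split {bs} {as} refl l r′ =
        pay-window K y (sum bs) (sum as) (sum (bs ++ as)) (rec f len)
        (2≤window-sum u (length bs) (sum bs) B≡M) (sum-++ bs as)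
      where
      B≡M : span bs ≡ M
      B≡M = +-cancelʳ-≡ z _ _ (sym (run-end l))
      nonempty : ∀ {bs} → span bs ≡ M → 1 ≤ length bs
      nonempty {[]} ()
      nonempty {_ ∷ _} _ = s≤s z≤n
      rec : ∀ f → length (bs ++ as) ≤ f → 8 * K ≤ 4 * sum as + y
      rec zero len = ⊥-elim (<⇒≱ (nonempty {bs} B≡M)
          (≤-trans (m≤m+n _ _) (subst (_≤ 0) (length-++ bs) len)))
      rec (suc f) len = bound-even f (lenas (length as) (length bs) (nonempty {bs} B≡M)
          (subst (_≤ suc f) (length-++ bs) len))
        (odd+odd odd-M oz) (run-target hz l) r′ K y
        (room-window K y (span (bs ++ as)) (span bs) (span as) p (span-++ bs as) B≡M)
        where
        lenas : ∀ a b → 1 ≤ b → b + a ≤ 1 + f → a ≤ f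
        lenas a b p₁ p₂ = from 0 (p₁ ⊕ p₂) (solve (b ∷ a ∷ f ∷ []))


    private
      odd-room : ∀ K g C D → K * (8 + 6 * u) ≤ C → C ≡ 3 + g + D → K * (8 + 6 * u) ≤ 3 + D + g
      odd-room K g C D p₁ p₂ = from 0 (p₁ ⊕ (≤-reflexive p₂)) (solve (K ∷ u ∷ C ∷ g ∷ D ∷ []))
      even-room : ∀ K g C D → K * (8 + 6 * u) + 3 ≤ C → C ≡ 3 + g + D → K * (8 + 6 * u) ≤ D + g
      even-room K g C D p₁ p₂ = from 0 (p₁ ⊕ (≤-reflexive p₂)) (solve (K ∷ u ∷ C ∷ g ∷ D ∷ []))
      no-excess : ∀ K g s → g + s ≡ 2 * K → 8 * K ≤ 4 * s + g → g * 3 ≤ 0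
      no-excess K g s p₁ p₂ = from 0 (4 ⊛ (≤-reflexive p₁) ⊕ p₂) (solve (g ∷ s ∷ K ∷ []))

      no-gap : ∀ K g s → g + s ≡ 2 * K → 8 * K ≤ 4 * s + g → g ≡ 0
      no-gap K g s p q = m*n≡0⇒m≡0 g 3 (n≤0⇒n≡0 (no-excess K g s p q))

    -- An excess `g` in the first gap shortens what follows by `g`, which lowers the excess required
    -- there by at most g / 4. With no slack in the sum this forces `g` to vanish.
    tight-next-odd : ∀ {z g gs} K → Odd (3 + g + z) → Run H z (g ∷ gs) e →
                     g + sum gs ≡ 2 * K → K * (8 + 6 * u) ≤ span (g ∷ gs) → g ≡ 0
    tight-next-odd {z} {g} {gs} K o (step _ h r) s≡ le = no-gap K g (sum gs) s≡
      (bound-odd _ ≤-refl o h r K g (odd-room K g (span (g ∷ gs)) (span gs) le (span-∷ g gs)))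

    -- The additional length 3 makes up for the case of an even next hit, from which a step to an
    -- odd position is still to be paid.
    tight-next : ∀ {z g gs} K → Run H z (g ∷ gs) e →
                 g + sum gs ≡ 2 * K → K * (8 + 6 * u) + 3 ≤ span (g ∷ gs) → g ≡ 0
    tight-next {z} {g} {gs} K r@(step _ h r′) s≡ le with parity (3 + g + z)
    ... | inj₂ o = tight-next-odd K o r s≡ (≤-trans (m≤m+n _ 3) le)
    ... | inj₁ ev = no-gap K g (sum gs) s≡
      (bound-even _ ≤-refl ev h r′ K g (even-room K g (span (g ∷ gs)) (span gs) le (span-∷ g gs)))

  private
    m≡d+m⇒d≡0 : ∀ d x → x ≡ d + x → d ≡ 0
    m≡d+m⇒d≡0 d x p₁ = ≤-antisym (from 0 (≤-reflexive (sym p₁)) (solve (x ∷ d ∷ [])))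
      (from (d) (z≤n {0}) (solve (x ∷ d ∷ [])))
    shift-3 : ∀ d g m a → 3 + g + (d + (m + a)) ≡ d + g + (m + (3 + 0 + a))
    shift-3 d g m a = solve (g ∷ d ∷ m ∷ a ∷ [])
    shift-4 : ∀ d g m a → 4 + g + (d + (m + a)) ≡ d + g + (m + (4 + a))
    shift-4 d g m a = solve (g ∷ d ∷ m ∷ a ∷ [])

  row-sum : ∀ {p rs} → Run H p rs (M + p) → sum rs ≤ 4 → sum rs ≡ 2 × length rs ≡ 1 + 2 * u
  row-sum {p} {rs} r = window-sum≤4 u (length rs) (sum rs) (+-cancelʳ-≡ p _ _ (sym (run-end r)))

  zeros : ∀ {a gs b} → H a → Run H a gs b → sum gs ≡ 0 → ∀ i → i ≤ length gs → H (i * 3 + a)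
  zeros h r _ zero _ = h
  zeros {a} {zero ∷ gs} h (step _ h′ r) s≡ (suc i) (s≤s i≤) =
    subst H (+-swap (i * 3) 3 a) (zeros h′ r s≡ i i≤)

  -- Where all gaps are 3 or 4, the strip shifted by M cannot run ahead of the original, since
  -- odd hits are mapped onto even hits and conversely.
  shift : ∀ d {a gs b hs} → All (_≤ 1) gs → length gs ≡ length hs → H a → H (d + (M + a)) →
          Run H a gs b → Run H (d + (M + a)) hs (M + b) → M + b ≤ top → d ≡ 0 × gs ≡ hs
  shift d {a} {[]} {hs = []} _ _ _ _ stop r′ _ = m≡d+m⇒d≡0 d (M + a) (run-end r′) , refl
  shift d {a} {zero ∷ gs} {b} {g′ ∷ hs} (_ All.∷ all) len ha hd (step _ h r) (step _ h′ r′) le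
    with shift (d + g′) all (suc-injective len) h (subst H eq h′) r (subst (λ x → Run H x hs (M + b)) eq r′)
        le
    where
    eq : 3 + g′ + (d + (M + a)) ≡ d + g′ + (M + (3 + 0 + a))
    eq = shift-3 d g′ M a
  ... | d+g≡0 , refl with m+n≡0⇒m≡0 d d+g≡0 | m+n≡0⇒n≡0 d d+g≡0
  ...   | refl | refl = refl , refl
  shift zero {a} {1 ∷ gs} {b} {zero ∷ hs} (_ All.∷ all) len ha hd (step n h r) (step _ h′ r′) le with parity
      a
  ... | inj₂ o = ⊥-elim (sep₁ h′ (subst H (+-swap M 4 a)
    (up (suc (suc (suc (suc o)))) h (≤-trans (+-monoʳ-≤ M (run-≤ r)) le))))
  ... | inj₁ ev = ⊥-elim (n 2 ≤-refl (down (suc (suc (suc ev))) (subst H (sym (+-swap M 3 a)) h′)))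
  shift zero {a} {1 ∷ gs} {b} {suc g′ ∷ hs} (_ All.∷ all) len ha hd (step n h r) (step _ h′ r′) le
    with shift g′ all (suc-injective len) h (subst H eq h′) r (subst (λ x → Run H x hs (M + b)) eq r′) le
    where
    eq : 4 + g′ + (M + a) ≡ g′ + (M + (4 + a))
    eq = shift-4 0 g′ M a
  ... | refl , refl = refl , refl
  -- `d` is the lead of the translated run, and it must end at 0. A gap of 4 could only lower a lead
  -- of 1 to 0, and a lead of 1 makes two adjacent hits: translate a upwards if it is odd, 1 + a
  -- downwards otherwise.
  shift (suc d) {a} {1 ∷ gs} {b} {g′ ∷ hs} (_ All.∷ all) len ha hd (step n h r) (step _ h′ r′) le
    with shift (d + g′) all (suc-injective len) h (subst H eq h′) r (subst (λ x → Run H x hs (M + b)) eq r′)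
        le
    where
    eq : 3 + g′ + (suc d + (M + a)) ≡ d + g′ + (M + (4 + a))
    eq = trans (cong (λ x → 3 + x) (+-suc g′ (d + (M + a)))) (shift-4 d g′ M a)
  ... | d+g≡0 , refl with m+n≡0⇒m≡0 d d+g≡0 | parity a
  ...   | refl | inj₂ o = ⊥-elim (sep₁ (up o ha (≤-trans (+-monoʳ-≤ M (≤-trans (m≤n+m a 4) (run-≤ r))) le))
      hd)
  ...   | refl | inj₁ ev = ⊥-elim (sep₁ ha (down (suc ev) (subst H (sym (+-swap M 1 a)) hd)))
  shift d {gs = suc (suc _) ∷ _} (s≤s () All.∷ _)

  -- Only the descent by `M` is recorded: it carries hits far up the strip back into the first row.
  Periodic : ℕ → ℕ → Set
  Periodic a b = ∀ z → a ≤ z → z ≤ b → H (M + z) → H z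

  same-gaps-periodic : ∀ {a gs b} → H a → Run H a gs b → Run H (M + a) gs (M + b) → Periodic a b
  same-gaps-periodic {a} {b = b} ha r r′ z a≤z z≤b h with m≤n⇒∃[o]m+o≡n a≤z
  ... | i , refl = subst H (+-comm i a) (run-transport r′ r ha i
    (subst (_≤ M + b) eq (+-monoʳ-≤ M z≤b)) (subst H eq h))
    where
    eq : M + (a + i) ≡ i + (M + a)
    eq = trans (cong (M +_) (+-comm a i)) (+-swap M i a)

  shift-periodic : ∀ {a gs b hs} → All (_≤ 1) gs → length gs ≡ length hs → H a → H (M + a) →
                   Run H a gs b → Run H (M + a) hs (M + b) → M + b ≤ top → gs ≡ hs × Periodic a b
  shift-periodic all len ha hM r r′ le with shift 0 all len ha hM r r′ le
  ... | _ , refl = refl , same-gaps-periodic ha r r′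

  -- `low` and `top` are the two positions of one element, so the part of the strip above `low` is
  -- one last window.
  module Edge (1≤u : 1 ≤ u) (even-top : Even top)
    (blocked : ∀ {q} → Odd q → M + q ≡ 2 + top → ¬ H q)
    {low : ℕ} (odd-low : Odd low) (hit-low : H low) (low-top : M + low ≡ top) where

    open Bound even-top ≤-refl blocked

    low≤top : low ≤ top
    low≤top = subst (low ≤_) low-top (m≤n+m low M)

    private
      low-image : ∀ k p → k ≤ 10 → 5 + 6 * u + (5 + (5 + 6 * u + p)) ≤ top → 5 + 6 * u + (k + p) ≤ top
      low-image k p p₁ p₂ = from (6 * u) (p₁ ⊕ p₂) (solve (k ∷ u ∷ p ∷ top ∷ []))
      no-window : ∀ D → D ≡ 0 * (8 + 6 * u) + 3 → 5 + 6 * u ≤ D → ⊥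
      no-window D p₁ p₂ = n≮0 {0} (from (1 + 6 * u) ((≤-reflexive p₁) ⊕ p₂) (solve (D ∷ u ∷ [])))
      after-5 : ∀ K B D C → C ≡ B + D → B ≡ 5 + 6 * u → C ≡ (1 + K) * (8 + 6 * u) + 3 →
          D ≡ K * (8 + 6 * u) + 6
      after-5 K B D C p₁ p₂ p₃ =
          ≤-antisym (from 0 ((≤-reflexive (sym p₁)) ⊕ (≤-reflexive (sym p₂)) ⊕ (≤-reflexive p₃))
          (solve (C ∷ B ∷ D ∷ u ∷ K ∷ [])))
        (from 0 ((≤-reflexive p₁) ⊕ (≤-reflexive p₂) ⊕ (≤-reflexive (sym p₃)))
            (solve (C ∷ B ∷ D ∷ u ∷ K ∷ [])))
      K≤D : ∀ K D → D ≡ K * (8 + 6 * u) + 6 → K * (8 + 6 * u) ≤ D + 0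
      K≤D K D p₁ = from 6 (≤-reflexive (sym p₁)) (solve (D ∷ K ∷ u ∷ []))
      K+3≤D : ∀ K D → D ≡ K * (8 + 6 * u) + 6 → K * (8 + 6 * u) + 3 ≤ D
      K+3≤D K D p₁ = from 3 (≤-reflexive (sym p₁)) (solve (D ∷ K ∷ u ∷ []))
      window≤4 : ∀ K s s1 s2 → s ≡ s1 + s2 → s ≡ 2 * (1 + K) → 8 * K ≤ 4 * s2 + 0 → 4 * s1 ≤ 4 * 4
      window≤4 K s s1 s2 p₁ p₂ p₃ =
          from 8 (4 ⊛ (≤-reflexive (sym p₁)) ⊕ 4 ⊛ (≤-reflexive p₂) ⊕ p₃) (solve (s ∷ s1 ∷ s2 ∷ K ∷ []))
      rest-sum : ∀ K s s1 s2 → s ≡ s1 + s2 → s ≡ 2 * (1 + K) → s1 ≡ 2 → s2 ≡ 2 * K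
      rest-sum K s s1 s2 p₁ p₂ p₃ =
          ≤-antisym (from 0 ((≤-reflexive (sym p₁)) ⊕ (≤-reflexive p₂) ⊕ (≤-reflexive (sym p₃)))
          (solve (s ∷ s1 ∷ s2 ∷ K ∷ [])))
        (from 0 ((≤-reflexive p₁) ⊕ (≤-reflexive (sym p₂)) ⊕ (≤-reflexive p₃))
            (solve (s ∷ s1 ∷ s2 ∷ K ∷ [])))
      half-rest : ∀ l v → 1 + l ≡ 1 + 2 * u → 1 + v ≡ u → 2 * v ≤ l
      half-rest l v p₁ p₂ = from 2 ((≤-reflexive (sym p₁)) ⊕ 2 ⊛ (≤-reflexive p₂)) (solve (l ∷ u ∷ v ∷ []))
      last-odd : ∀ v p → 1 + v ≡ u → (2 * v) * 3 + (5 + (5 + (5 + 6 * u + p))) ≡ 5 + 6 * u +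
          (10 + 6 * v + p)
      last-odd v p p₁ = ≤-antisym (from 0 (z≤n {0}) (solve (v ∷ u ∷ p ∷ [])))
        (from 0 (z≤n {0}) (solve (v ∷ u ∷ p ∷ [])))
      last-odd+1 : ∀ v p → 1 + v ≡ u → 1 + (10 + 6 * v + p) ≡ 5 + 6 * u + p
      last-odd+1 v p p₁ = ≤-antisym (from 0 (6 ⊛ (≤-reflexive p₁)) (solve (v ∷ u ∷ p ∷ [])))
        (from 0 (6 ⊛ (≤-reflexive (sym p₁))) (solve (v ∷ u ∷ p ∷ [])))

    -- After a gap of 5 the next window would again be tight, with every later step of length 3;
    -- this is incompatible with the gaps of the row preceding it.
    no-5-link : ∀ {p rs gs} K → Odd p → H p → Run H p rs (M + p) → All (_≤ 1) rs → sum rs ≡ 2 →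
                (∀ i → i < 4 → ¬ H (suc i + (M + p))) → H (5 + (M + p)) → Run H (5 + (M + p)) gs top →
                sum gs ≡ 2 * K → span gs ≡ K * (8 + 6 * u) + 3 → M + (5 + (M + p)) ≤ top → ⊥
    no-5-link {p} {rs} {gs} K op hp row all s≡2 none h₅ r s≡ D≡ le
      with run-split M r (up odd-p′ h₅ le) le
      where
      odd-p′ : Odd (5 + (M + p))
      odd-p′ = suc (suc (suc (suc (suc (odd+odd odd-M op)))))
    ... | split {bs} {as} refl rb ra = main K D≡ s≡
      where
      p′ : ℕ
      p′ = 5 + (M + p)
      odd-p′ : Odd p′
      odd-p′ = suc (suc (suc (suc (suc (odd+odd odd-M op)))))
      B≡M : span bs ≡ M
      B≡M = +-cancelʳ-≡ p′ _ _ (sym (run-end rb))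
      hM : H (M + p)
      hM = run-target hp row
      at : ∀ k → k ≤ 10 → Odd (k + p) → H (k + p) → H (k + (M + p))
      at k k≤ o h = subst H (+-swap M k p) (up o h (low-image k p k≤ le))
      at⁻¹ : ∀ k → Odd (k + p) → H (k + (M + p)) → H (k + p)
      at⁻¹ k o h = down o (subst H (+-swap k M p) h)
      odd-8 : Odd (8 + p)
      odd-8 = suc (suc (suc (suc (suc (suc (suc (suc op)))))))
      odd-10 : Odd (10 + p)
      odd-10 = suc (suc odd-8)

      after-10 : H (7 + p) → H (10 + p) → ∀ {bs b} → Run H p′ bs b → sum bs ≡ 2 → length bs ≡ 1 + 2 * u → ⊥
      after-10 h₇ h₁₀ (step {g = zero} _ h _) _ _ = sep₁ h₇ (at⁻¹ 8 odd-8 h)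
      after-10 h₇ h₁₀ (step {g = 1} _ h _) _ _ = sep₁ h (at 10 ≤-refl odd-10 h₁₀)
      after-10 h₇ h₁₀ (step {g = 2} _ h r) s≡ l≡ with m≤n⇒∃[o]m+o≡n 1≤u
      -- After its gap of 5 the second row has only gaps of 3. With v = u - 1, 2 v of them reach the
      -- translate of the odd position just below `M + p`, which is itself a hit.
      ... | v , 1+v≡u = sep₁ at-last (subst H (sym (last-odd+1 v p 1+v≡u)) hM)
        where
        at-last : H (10 + 6 * v + p)
        at-last = down (even+odd (suc (suc (suc (suc (suc (suc (suc (suc (suc (suc (even-6* v))))))))))) op)
          (subst H (last-odd v p 1+v≡u)
            (zeros h r (suc-injective (suc-injective s≡)) (2 * v) (half-rest _ v l≡ 1+v≡u)))
      after-10 h₇ h₁₀ (step {g = suc (suc (suc _))} _ _ _) () _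
      after-10 _ _ stop ()

      after-11 : H (7 + p) → H (11 + p) → H (3 + (M + p′)) → 4 + (M + p′) ≤ top →
                 ∀ {bs b} → Run H p′ bs b → sum bs ≡ 2 → length bs ≡ 1 + 2 * u → ⊥
      after-11 h₇ h₁₁ h₃ le₄ (step {g = zero} _ h _) _ _ = sep₁ h₇ (at⁻¹ 8 odd-8 h)
      after-11 h₇ h₁₁ h₃ le₄ (step {g = 1} _ h _) _ _ =
        sep₁ h₃ (subst H (+-swap M 4 p′) (up (suc (suc (suc (suc odd-p′)))) h
            (subst (_≤ top) (+-swap 4 M p′) le₄)))
      after-11 h₇ h₁₁ h₃ le₄ (step {g = 2} _ h _) _ _ = sep₁ (at⁻¹ 10 odd-10 h) h₁₁
      after-11 h₇ h₁₁ h₃ le₄ (step {g = suc (suc (suc _))} _ _ _) () _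
      after-11 _ _ _ _ stop ()

      -- The translate of a first gap of 4 would hit inside the gap of 5, and that of two initial
      -- gaps of 3 would hit right after it. So the row begins with 3 and 4, and its third gap
      -- decides between 10 + p and 11 + p; either one clashes with every possible first gap of the
      -- second row.
      row-cases : H (3 + (M + p′)) → 4 + (M + p′) ≤ top → sum bs ≡ 2 → length bs ≡ 1 + 2 * u →
                  ∀ {rs b} → Run H p rs b → All (_≤ 1) rs → sum rs ≡ 2 → ⊥
      row-cases h₃ le₄ sb lb (step {g = 1} _ h _) _ _ =
          none 3 ≤-refl (at 4 (s≤s (s≤s (s≤s (s≤s z≤n)))) (suc (suc (suc (suc op)))) h)
      row-cases h₃ le₄ sb lb (step {g = zero} _ _ (step {g = zero} _ h _)) _ _ =
        sep₁ h₅ (at 6 (s≤s (s≤s (s≤s (s≤s (s≤s (s≤s z≤n)))))) (suc (suc (suc (suc (suc (suc op)))))) h)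
      row-cases h₃ le₄ sb lb (step {g = zero} _ _ (step {g = 1} _ h₇ (step {g = zero} _ h₁₀ _))) _ _ =
          after-10 h₇ h₁₀ rb sb lb
      row-cases h₃ le₄ sb lb (step {g = zero} _ _ (step {g = 1} _ h₇ (step {g = 1} _ h₁₁ _))) _ _ =
          after-11 h₇ h₁₁ h₃ le₄ rb sb lb
      row-cases h₃ le₄ sb lb {suc (suc _) ∷ _} _ (s≤s () All.∷ _) _
      row-cases h₃ le₄ sb lb {zero ∷ suc (suc _) ∷ _} _ (_ All.∷ s≤s () All.∷ _) _
      row-cases h₃ le₄ sb lb {zero ∷ 1 ∷ suc (suc _) ∷ _} _ (_ All.∷ _ All.∷ s≤s () All.∷ _) _
      row-cases h₃ le₄ sb lb {zero ∷ 1 ∷ []} _ _ ()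
      row-cases h₃ le₄ sb lb {zero ∷ []} _ _ ()
      row-cases h₃ le₄ sb lb {[]} _ _ ()

      main : ∀ K → span (bs ++ as) ≡ K * (8 + 6 * u) + 3 → sum (bs ++ as) ≡ 2 * K → ⊥
      main zero D≡ _ = no-window (span (bs ++ as)) D≡ (subst (M ≤_) (sym (span-++ bs as))
          (subst (λ x → M ≤ x + span as) (sym B≡M) (m≤m+n M _)))
      main (suc K) D≡ s≡ = next ra refl refl
        where
        A≡ : span as ≡ K * (8 + 6 * u) + 6
        A≡ = after-5 K (span bs) (span as) (span (bs ++ as)) (span-++ bs as) B≡M D≡
        rows : sum bs ≡ 2 × length bs ≡ 1 + 2 * u
        rows = row-sum rb (*-cancelˡ-≤ 4 (window≤4 K (sum (bs ++ as)) (sum bs) (sum as) (sum-++ bs as) s≡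
          (bound-even _ ≤-refl (odd+odd odd-M odd-p′) (run-target h₅ rb) ra K 0 (K≤D K (span as) A≡))))
        next : ∀ {as′ e} → Run H (M + p′) as′ e → as′ ≡ as → e ≡ top → ⊥
        next stop refl _ = m+1+n≢0 (K * (8 + 6 * u)) (sym A≡)
        next r@(step {g = g} _ h r′) refl refl = row-cases (subst (λ g → H (3 + g + (M + p′))) g≡0 h)
          (≤∧≢⇒< (subst (λ g → 3 + g + (M + p′) ≤ top) g≡0 (run-≤ r′)) 3-odd) (proj₁ rows)
              (proj₂ rows) row all s≡2
          where
          g≡0 : g ≡ 0
          g≡0 = tight-next K r (rest-sum K (sum (bs ++ as)) (sum bs) (sum as) (sum-++ bs as) s≡
              (proj₁ rows))
            (K+3≤D K (span as) A≡)
          3-odd : 3 + (M + p′) ≡ top → ⊥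
          3-odd eq = even-odd-⊥ even-top (subst Odd eq (suc (suc (suc (odd+odd odd-M odd-p′)))))

    private
      no-room : ∀ D C a → 3 + D + 4 * a ≡ 0 * (8 + 6 * u) + 8 → D ≡ 5 + 6 * u + C → 1 ≤ u → ⊥
      no-room D C a p₁ p₂ p₃ = n≮0 {0}
          (from (C + 4 * a + 5 * u) ((≤-reflexive p₁) ⊕ (≤-reflexive (sym p₂)) ⊕ p₃)
          (solve (D ∷ a ∷ u ∷ C ∷ [])))
      room : ∀ K a D C → 3 + D + 4 * a ≡ (1 + K) * (8 + 6 * u) + 8 → D ≡ 5 + 6 * u + C →
          K * (8 + 6 * u) ≤ C + 4 * a
      room K a D C p₁ p₂ = from 8 ((≤-reflexive (sym p₁)) ⊕ (≤-reflexive p₂))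
          (solve (D ∷ a ∷ K ∷ u ∷ C ∷ []))
      row-span : ∀ K a D C → 3 + D + 4 * a ≡ (1 + K) * (8 + 6 * u) + 8 → D ≡ 5 + 6 * u + C →
          C + 4 * a ≡ K * (8 + 6 * u) + 8
      row-span K a D C p₁ p₂ = ≤-antisym (from 0 ((≤-reflexive p₁) ⊕ (≤-reflexive (sym p₂)))
          (solve (D ∷ a ∷ K ∷ u ∷ C ∷ [])))
        (from 0 ((≤-reflexive (sym p₁)) ⊕ (≤-reflexive p₂)) (solve (D ∷ a ∷ K ∷ u ∷ C ∷ [])))
      row≤4 : ∀ K a s s1 s2 → s + a ≡ 2 * (1 + K) + 2 → s ≡ s1 + s2 → 8 * K ≤ 4 * s2 + 4 * a →
          4 * s1 ≤ 4 * 4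
      row≤4 K a s s1 s2 p₁ p₂ p₃ =
          from 0 (4 ⊛ (≤-reflexive p₁) ⊕ 4 ⊛ (≤-reflexive (sym p₂)) ⊕ p₃) (solve (s ∷ a ∷ K ∷ s1 ∷ s2 ∷ []))
      row-rest : ∀ K a s s1 s2 → s + a ≡ 2 * (1 + K) + 2 → s ≡ s1 + s2 → s1 ≡ 2 → s2 + a ≡ 2 * K + 2
      row-rest K a s s1 s2 p₁ p₂ p₃ =
          ≤-antisym (from 0 ((≤-reflexive p₁) ⊕ (≤-reflexive (sym p₂)) ⊕ (≤-reflexive (sym p₃)))
          (solve (s ∷ a ∷ K ∷ s1 ∷ s2 ∷ [])))
        (from 0 ((≤-reflexive (sym p₁)) ⊕ (≤-reflexive p₂) ⊕ (≤-reflexive p₃))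
            (solve (s ∷ a ∷ K ∷ s1 ∷ s2 ∷ [])))

    -- Invariant: a counts the gaps of 4 passed between rows, and K bounds the number of rows left.
    record Row (p a : ℕ) (gs : List ℕ) : Set where
      field
        K          : ℕ
        row rest   : List ℕ
        appended   : gs ≡ row ++ rest
        row-run    : Run H p row (M + p)
        rest-run   : Run H (M + p) rest top
        row-sum-2  : sum row ≡ 2
        row-length : length row ≡ 1 + 2 * u
        rest-sum≡  : sum rest + a ≡ 2 * K + 2
        rest-span≡ : span rest + 4 * a ≡ K * (8 + 6 * u) + 8

    -- Over `K` tight windows the surplus is 2 in excess and 8 in length, less what the gaps of 4
    -- have used. A window with excess above 2 has at least 5, and the rest would fall below its
    -- bound.
    new-row : ∀ {p gs} K a → Odd p → H p → Run H p gs top → M + p ≤ top →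
              sum gs + a ≡ 2 * K + 2 → 3 + span gs + 4 * a ≡ K * (8 + 6 * u) + 8 → Row p a gs
    new-row {p} {gs} K a op hp r le s≡ D≡ = build K s≡ D≡ (run-split M r (up op hp le) le)
      where
      build : ∀ K → sum gs + a ≡ 2 * K + 2 → 3 + span gs + 4 * a ≡ K * (8 + 6 * u) + 8 →
          Split p gs (M + p) top → Row p a gs
      build K s≡ D≡ (split {bs} {as} app rb ra) = rows K s≡ D≡
        where
        D≡M+ : span gs ≡ M + span as
        D≡M+ = trans (cong span app)
            (trans (span-++ bs as) (cong (_+ span as) (+-cancelʳ-≡ p _ _ (sym (run-end rb)))))
        S≡ : sum gs ≡ sum bs + sum as
        S≡ = trans (cong sum app) (sum-++ bs as)
        rows : ∀ K → sum gs + a ≡ 2 * K + 2 → 3 + span gs + 4 * a ≡ K * (8 + 6 * u) + 8 → Row p a gs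
        rows zero _ D≡ = ⊥-elim (no-room (span gs) (span as) a D≡ D≡M+ 1≤u)
        rows (suc K) s≡ D≡ = record
          { K = K ; row = bs ; rest = as ; appended = app ; row-run = rb ; rest-run = ra
          ; row-sum-2 = proj₁ sums ; row-length = proj₂ sums
          ; rest-sum≡ = row-rest K a (sum gs) (sum bs) (sum as) s≡ S≡ (proj₁ sums)
          ; rest-span≡ = row-span K a (span gs) (span as) D≡ D≡M+
          }
          where
          sums : sum bs ≡ 2 × length bs ≡ 1 + 2 * u
          sums = row-sum rb (*-cancelˡ-≤ 4 (row≤4 K a (sum gs) (sum bs) (sum as) s≡ S≡
            (bound-even _ ≤-refl (odd+odd odd-M op) (run-target hp rb) ra K (4 * a)
                (room K a (span gs) (span as) D≡ D≡M+))))

    private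
      few : ∀ K a D s → D + 4 * a ≡ (1 + K) * (8 + 6 * u) + 8 → D ≤ 5 + 6 * u → s + a ≡ 2 * (1 + K) + 2 →
          3 ≤ s → ⊥
      few K a D s p₁ p₂ p₃ p₄ =
          n≮0 {0} (from (2 * s + 6 * K * u) ((≤-reflexive (sym p₁)) ⊕ p₂ ⊕ 4 ⊛ (≤-reflexive p₃) ⊕ 2 ⊛ p₄)
          (solve (D ∷ a ∷ K ∷ u ∷ s ∷ [])))
      few-0 : ∀ a s → s + a ≡ 2 * 0 + 2 → s ≤ 2
      few-0 a s p₁ = from (a) (≤-reflexive p₁) (solve (s ∷ a ∷ []))
      to-mod : ∀ l s k t → 3 * l + s ≡ 3 * k + t → l * 3 + s ≡ k * 3 + t
      to-mod l s k t p₁ = ≤-antisym (from 0 (≤-reflexive p₁) (solve (l ∷ s ∷ k ∷ t ∷ [])))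
        (from 0 (≤-reflexive (sym p₁)) (solve (l ∷ s ∷ k ∷ t ∷ [])))

      few-left : ∀ K a D s → D + 4 * a ≡ K * (8 + 6 * u) + 8 → D ≤ M → s + a ≡ 2 * K + 2 → s ≤ 2
      few-left zero a D s _ _ s≡ = few-0 a s s≡
      few-left (suc K) a D s D≡ D≤ s≡ with s ≤? 2
      ... | yes p = p
      ... | no ¬p = ⊥-elim (few K a D s D≡ D≤ s≡ (≰⇒> ¬p))

      same-span : ∀ l s k t → 3 * l + s ≡ 3 * k + t → s ≤ 2 → t ≤ 2 → l ≡ k
      same-span l s k t eq s≤2 t≤2 = proj₁ (mod-unique 3 l k (s≤s s≤2) (s≤s t≤2) (to-mod l s k t eq))

    -- Here only the part of the row up to `low` has a translate inside the strip. This part and the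
    -- remaining run have equal span and excess at most 2, so residues modulo 3 give them equally
    -- many gaps, as the comparison by translation requires.
    last-stretch : ∀ {p rs gs} K a → H p → p ≤ low → low ≤ M + p → Run H p rs (M + p) → All (_≤ 1) rs →
                   sum rs ≡ 2 → Run H (M + p) gs top → sum gs + a ≡ 2 * K + 2 →
                   span gs + 4 * a ≡ K * (8 + 6 * u) + 8 → Periodic p low
    last-stretch {p} {rs} {gs} K a hp p≤low low≤ row all s≡2 r s≡ D≡ =
        go (run-split-at row hit-low p≤low low≤)
      where
      go : Split p rs low (M + p) → Periodic p low
      go (split {bs} {as} app rb _) = proj₂ (shift-periodic (++⁻ˡ bs (subst (All (_≤ 1)) app all)) same hp
        (run-target hp row) rb (subst (Run H (M + p) gs) (sym low-top) r) (≤-reflexive low-top))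
        where
        spans : span bs ≡ span gs
        spans = +-cancelʳ-≡ (M + p) _ _ (trans (+-swap (span bs) M p)
          (trans (cong (M +_) (sym (run-end rb))) (trans low-top (run-end r))))
        B≤M : span gs ≤ M
        B≤M = subst (_≤ M) spans (+-cancelʳ-≤ p _ _ (subst (_≤ M + p) (run-end rb) low≤))
        same : length bs ≡ length gs
        same = same-span (length bs) (sum bs) (length gs) (sum gs) spans
          (≤-trans (m≤m+n _ (sum as))
              (≤-reflexive (trans (sym (sum-++ bs as)) (trans (cong sum (sym app)) s≡2))))
          (few-left K a (span gs) (sum gs) D≡ B≤M s≡)

    private
      odd-gap-room : ∀ K a g C D → C + 4 * a ≡ K * (8 + 6 * u) + 8 → C ≡ 3 + g + D →
          K * (8 + 6 * u) ≤ 3 + D + (4 * a + g)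
      odd-gap-room K a g C D p₁ p₂ =
          from 8 ((≤-reflexive (sym p₁)) ⊕ (≤-reflexive p₂)) (solve (C ∷ a ∷ K ∷ u ∷ g ∷ D ∷ []))
      even-gap-room : ∀ K a g C D → C + 4 * a ≡ K * (8 + 6 * u) + 8 → C ≡ 3 + g + D →
          K * (8 + 6 * u) ≤ D + (4 * a + g)
      even-gap-room K a g C D p₁ p₂ =
          from 5 ((≤-reflexive (sym p₁)) ⊕ (≤-reflexive p₂)) (solve (C ∷ a ∷ K ∷ u ∷ g ∷ D ∷ []))
      gap≤2 : ∀ K a g s → g + s + a ≡ 2 * K + 2 → 8 * K ≤ 4 * s + (4 * a + g) → 3 ≤ g → ⊥
      gap≤2 K a g s p₁ p₂ p₃ = n≮0 {0} (from 0 (4 ⊛ (≤-reflexive p₁) ⊕ p₂ ⊕ 3 ⊛ p₃)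
          (solve (g ∷ s ∷ a ∷ K ∷ [])))
      room-2 : ∀ K a C D → C + 4 * (1 + a) ≡ K * (8 + 6 * u) + 8 → C ≡ 3 + 2 + D →
          K * (8 + 6 * u) ≤ 3 + D + 4 * a
      room-2 K a C D p₁ p₂ = from 2 ((≤-reflexive (sym p₁)) ⊕ (≤-reflexive p₂))
          (solve (C ∷ a ∷ K ∷ u ∷ D ∷ []))
      gap-2 : ∀ K a s → 2 + s + (1 + a) ≡ 2 * K + 2 → 8 * K ≤ 4 * s + 4 * a → ⊥
      gap-2 K a s p₁ p₂ = n≮0 {0} (from 3 (4 ⊛ (≤-reflexive p₁) ⊕ p₂) (solve (s ∷ a ∷ K ∷ [])))
      next-4-sum : ∀ K a s → 1 + s + a ≡ 2 * K + 2 → s + (1 + a) ≡ 2 * K + 2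
      next-4-sum K a s p₁ = ≤-antisym (from 0 (≤-reflexive p₁) (solve (s ∷ a ∷ K ∷ [])))
        (from 0 (≤-reflexive (sym p₁)) (solve (s ∷ a ∷ K ∷ [])))
      next-4-span : ∀ K a C D → C + 4 * a ≡ K * (8 + 6 * u) + 8 → C ≡ 3 + 1 + D →
          D + 4 * (1 + a) ≡ K * (8 + 6 * u) + 8
      next-4-span K a C D p₁ p₂ =
          ≤-antisym (from 0 ((≤-reflexive p₁) ⊕ (≤-reflexive (sym p₂))) (solve (C ∷ a ∷ K ∷ u ∷ D ∷ [])))
        (from 0 ((≤-reflexive (sym p₁)) ⊕ (≤-reflexive p₂)) (solve (C ∷ a ∷ K ∷ u ∷ D ∷ [])))
      next-3-span : ∀ K a C D → C + 4 * a ≡ K * (8 + 6 * u) + 8 → C ≡ 3 + 0 + D →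
          3 + D + 4 * a ≡ K * (8 + 6 * u) + 8
      next-3-span K a C D p₁ p₂ =
          ≤-antisym (from 0 ((≤-reflexive p₁) ⊕ (≤-reflexive (sym p₂))) (solve (C ∷ a ∷ K ∷ u ∷ D ∷ [])))
        (from 0 ((≤-reflexive (sym p₁)) ⊕ (≤-reflexive p₂)) (solve (C ∷ a ∷ K ∷ u ∷ D ∷ [])))
      next-5-sum : ∀ K s → 2 + s + 0 ≡ 2 * K + 2 → s ≡ 2 * K
      next-5-sum K s p₁ = ≤-antisym (from 0 (≤-reflexive p₁) (solve (s ∷ K ∷ [])))
        (from 0 (≤-reflexive (sym p₁)) (solve (s ∷ K ∷ [])))
      next-5-span : ∀ K C D → C + 4 * 0 ≡ K * (8 + 6 * u) + 8 → C ≡ 3 + 2 + D → D ≡ K * (8 + 6 * u) + 3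
      next-5-span K C D p₁ p₂ =
          ≤-antisym (from 0 ((≤-reflexive p₁) ⊕ (≤-reflexive (sym p₂))) (solve (C ∷ K ∷ u ∷ D ∷ [])))
        (from 0 ((≤-reflexive (sym p₁)) ⊕ (≤-reflexive p₂)) (solve (C ∷ K ∷ u ∷ D ∷ [])))

    periodic-trans : ∀ {a b c} → Periodic a b → Periodic b c → Periodic a c
    periodic-trans {b = b} ab bc z a≤z z≤c h with ≤-total z b
    ... | inj₁ z≤b = ab z a≤z z≤b h
    ... | inj₂ b≤z = bc z b≤z z≤c h

    M+≤top : ∀ {z} → z ≤ low → M + z ≤ top
    M+≤top {z} z≤low = subst (M + z ≤_) low-top (+-monoʳ-≤ M z≤low)

    -- Induction over rows, with fuel `f` for the remaining gaps. A row and the link after it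
    -- translate to that link followed by the next row; equality of these gap lists gives the
    -- periodicity and also bounds the gaps of the next row by 4.
    rows-periodic : ∀ f {p rs gs} K a → length gs ≤ f → Odd p → H p → p ≤ low → Run H p rs (M + p) →
        All (_≤ 1) rs →
                    sum rs ≡ 2 → length rs ≡ 1 + 2 * u → Run H (M + p) gs top → sum gs + a ≡ 2 * K + 2 →
                    span gs + 4 * a ≡ K * (8 + 6 * u) + 8 → Periodic p low
    -- A link is the walk over even hits by gaps of 4 from the end of a row to the next odd hit. If
    -- no gap of 4 has occurred so far the link is empty, so a gap of 5 met then starts right at the
    -- end of the row.
    link-periodic : ∀ f {p rs ls e gs} K a → length gs ≤ f → Odd p → H p → Run H p rs (M + p) →
        All (_≤ 1) rs →
                    sum rs ≡ 2 → length rs ≡ 1 + 2 * u → Run H (M + p) ls e → All (_≤ 1) ls →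
                        (a ≡ 0 → ls ≡ []) →
                    Even e → e < low → Run H e gs top → sum gs + a ≡ 2 * K + 2 →
                    span gs + 4 * a ≡ K * (8 + 6 * u) + 8 → Periodic p low

    rows-periodic f {p} K a len op hp p≤low row all s≡2 l≡ r s≡ D≡ = cases (low ≤? M + p)
      where
      cases : Dec (low ≤ M + p) → Periodic p low
      cases (yes low≤) = last-stretch K a hp p≤low low≤ row all s≡2 r s≡ D≡
      cases (no low≰) = link-periodic f K a len op hp row all s≡2 l≡ stop All.[] (λ _ → refl)
        (odd+odd odd-M op) (≰⇒> low≰) r s≡ D≡

    link-periodic f K a len op hp row all s≡2 l≡ link all′ a≡0 ev e<low stop s≡ D≡ =
        ⊥-elim (<⇒≱ e<low low≤top)
    link-periodic (suc f) {p} {rs} {ls} {e} K a (s≤s len) op hp row all s≡2 l≡ link all′ a≡0 ev e<low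
      r@(step {g = g} {gs} n h r′) s≡ D≡ =
          cases g n h r′ (parity (3 + g + e)) s≡ D≡ (next-hit-≤ r hit-low e<low)
      where
      cases : ∀ g → (∀ i → i < 2 + g → ¬ H (suc i + e)) → H (3 + g + e) → Run H (3 + g + e) gs top →
              Even (3 + g + e) ⊎ Odd (3 + g + e) → g + sum gs + a ≡ 2 * K + 2 →
              span (g ∷ gs) + 4 * a ≡ K * (8 + 6 * u) + 8 → 3 + g + e ≤ low → Periodic p low
      cases zero n h r (inj₁ (suc (suc (suc o)))) = ⊥-elim (even-odd-⊥ ev o)
      cases 1 n h r (inj₂ (suc (suc (suc (suc o))))) = ⊥-elim (even-odd-⊥ ev o)
      cases 2 n h r (inj₁ (suc (suc (suc (suc (suc o)))))) = ⊥-elim (even-odd-⊥ ev o)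
      cases 1 n h r (inj₁ e4) s≡ D≡ le = link-periodic f K (suc a) len op hp row all s≡2 l≡
        (run-++ link (step n h stop)) (++⁺ all′ (≤-refl All.∷ All.[])) (λ ()) e4
        (≤∧≢⇒< le (λ { eq → even-odd-⊥ e4 (subst Odd (sym eq) odd-low) })) r
        (next-4-sum K a (sum gs) s≡) (next-4-span K a (span (1 ∷ gs)) (span gs) D≡ (span-∷ 1 gs))
      cases zero n h r (inj₂ o) s≡ D≡ le =
          go (new-row K a o h r (M+≤top le) s≡ (next-3-span K a (span (0 ∷ gs)) (span gs) D≡ (span-∷ 0 gs)))
        where
        go : Row (3 + e) a gs → Periodic p low
        go ro = periodic-trans (proj₂ shifted)
          (rows-periodic f (Row.K ro) a shorter o h le (Row.row-run ro) all-row (Row.row-sum-2 ro)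
              (Row.row-length ro) (Row.rest-run ro)
            (Row.rest-sum≡ ro) (Row.rest-span≡ ro))
          where
          link₀ : List ℕ
          link₀ = ls ++ 0 ∷ []
          shifted : rs ++ link₀ ≡ link₀ ++ Row.row ro × Periodic p (3 + e)
          shifted = shift-periodic (++⁺ all (++⁺ all′ (z≤n All.∷ All.[])))
            (trans (length-++ rs) (trans (+-comm (length rs) _)
                (trans (cong (length link₀ +_) (trans l≡ (sym (Row.row-length ro))))
                (sym (length-++ link₀)))))
            hp (run-target hp row) (run-++ row (run-++ link (step n h stop)))
            (run-++ (run-++ link (step n h stop)) (Row.row-run ro)) (M+≤top le)
          all-row : All (_≤ 1) (Row.row ro)
          all-row = ++⁻ʳ link₀ (subst (All (_≤ 1)) (proj₁ shifted) (++⁺ all (++⁺ all′ (z≤n All.∷ All.[]))))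
          shorter : length (Row.rest ro) ≤ f
          shorter = ≤-trans (m≤n+m _ (length (Row.row ro)))
              (≤-trans (≤-reflexive (trans (sym (length-++ (Row.row ro)))
              (cong length (sym (Row.appended ro))))) len)
      cases 2 n h r (inj₂ o) s≡ D≡ le = five a a≡0 s≡ D≡
        where
        direct : ∀ {ls e} → ls ≡ [] → Run H (M + p) ls e → e ≡ M + p
        direct refl stop = refl
        five : ∀ a → (a ≡ 0 → ls ≡ []) → 2 + sum gs + a ≡ 2 * K + 2 → span (2 ∷ gs) + 4 * a ≡ K *
            (8 + 6 * u) + 8 → Periodic p low
        -- After a gap of 4 between rows, too little excess remains for the rest once a gap of 5 is
        -- taken.
        five (suc a) _ s≡ D≡ = ⊥-elim (gap-2 K a (sum gs) s≡
          (bound-odd _ ≤-refl o h r K (4 * a) (room-2 K a (span (2 ∷ gs)) (span gs) D≡ (span-∷ 2 gs))))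
        five zero a≡0 s≡ D≡ = ⊥-elim (no-5-link K op hp row all s≡2
          (subst (λ e → ∀ i → i < 4 → ¬ H (suc i + e)) e≡ n) (subst (λ e → H (5 + e)) e≡ h)
          (subst (λ e → Run H (5 + e) gs top) e≡ r) (next-5-sum K (sum gs) s≡)
          (next-5-span K (span (2 ∷ gs)) (span gs) D≡ (span-∷ 2 gs))
          (subst (λ e → M + (5 + e) ≤ top) e≡ (M+≤top le)))
          where
          e≡ : e ≡ M + p
          e≡ = direct (a≡0 refl) link
      cases g@(suc (suc (suc _))) n h r (inj₂ o) s≡ D≡ le = ⊥-elim (gap≤2 K a g (sum gs) s≡
        (bound-odd _ ≤-refl o h r K (4 * a + g) (odd-gap-room K a g (span (g ∷ gs)) (span gs) D≡
            (span-∷ g gs))) (s≤s (s≤s (s≤s z≤n))))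
      cases g@(suc (suc (suc _))) n h r (inj₁ e′) s≡ D≡ le = ⊥-elim (gap≤2 K a g (sum gs) s≡
        (bound-even _ ≤-refl e′ h r K (4 * a + g) (even-gap-room K a g (span (g ∷ gs)) (span gs) D≡
            (span-∷ g gs))) (s≤s (s≤s (s≤s z≤n))))

    -- `wrap` expresses how the cyclic strip closes up: the element at an even position reappears at
    -- the odd position `low` further on. The sum exceeds by 2 the total 2 (1 + 3 u) of the
    -- independent case.
    module Tight (top≡ : top ≡ 2 * (9 * u * u + 15 * u + 7)) (hit₁ : H 1)
      (wrap : ∀ {z} → Even z → H z → z ≤ M → H (z + low))
      {gs : List ℕ} (run₁ : Run H 1 gs top) (sum≡ : sum gs ≡ 6 * u + 4) where

      private
        first-span : ∀ D → top ≡ D + 1 → top ≡ 2 * (9 * u * u + 15 * u + 7) → 3 + D + 4 * 0 ≡ (1 + 3 * u) *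
            (8 + 6 * u) + 8
        first-span D p₁ p₂ = ≤-antisym (from 0 ((≤-reflexive (sym p₁)) ⊕ (≤-reflexive p₂))
            (solve (top ∷ D ∷ u ∷ [])))
          (from 0 ((≤-reflexive p₁) ⊕ (≤-reflexive (sym p₂))) (solve (top ∷ D ∷ u ∷ [])))
        first-sum : ∀ s → s ≡ 6 * u + 4 → s + 0 ≡ 2 * (1 + 3 * u) + 2
        first-sum s p₁ = ≤-antisym (from 0 (≤-reflexive p₁) (solve (s ∷ u ∷ [])))
          (from 0 (≤-reflexive (sym p₁)) (solve (s ∷ u ∷ [])))
        low-size : 5 + 6 * u + low ≡ top → top ≡ 2 * (9 * u * u + 15 * u + 7) →
            low ≡ (1 + 3 * u) * (5 + 6 * u) + (4 + 3 * u)
        low-size p₁ p₂ = ≤-antisym (from 0 ((≤-reflexive p₁) ⊕ (≤-reflexive p₂))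
            (solve (u ∷ low ∷ top ∷ [])))
          (from 0 ((≤-reflexive (sym p₁)) ⊕ (≤-reflexive (sym p₂))) (solve (u ∷ low ∷ top ∷ [])))
        low-pos : low ≡ (1 + 3 * u) * (5 + 6 * u) + (4 + 3 * u) → 1 ≤ low
        low-pos p₁ = from (8 + 24 * u + 18 * u * u) (≤-reflexive (sym p₁)) (solve (low ∷ u ∷ []))
        middle-span : ∀ l s → 4 + 3 * u ≡ 3 * l + s + 1 → l * 3 + s ≡ (1 + u) * 3 + 0
        middle-span l s p₁ = ≤-antisym (from 0 (≤-reflexive (sym p₁)) (solve (u ∷ l ∷ s ∷ [])))
          (from 0 (≤-reflexive p₁) (solve (u ∷ l ∷ s ∷ [])))
        4+3u≤ : 4 + 3 * u ≤ 5 + 6 * u + 1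
        4+3u≤ = from (2 + 3 * u) (z≤n {0}) (solve (u ∷ []))
        1≤4+3u : 1 ≤ 4 + 3 * u
        1≤4+3u = from (3 + 3 * u) (z≤n {0}) (solve (u ∷ []))
        1+3u≤M : u * 3 + 1 ≤ 5 + 6 * u
        1+3u≤M = from (4 + 3 * u) (z≤n {0}) (solve (u ∷ []))
        4+3u≤M : (1 + u) * 3 + 1 ≤ 5 + 6 * u
        4+3u≤M = from (1 + 3 * u) (z≤n {0}) (solve (u ∷ []))
        wrap₁ : low ≡ (1 + 3 * u) * (5 + 6 * u) + (4 + 3 * u) → u * 3 + 1 + low ≡ (1 + 3 * u) *
            (5 + 6 * u) + (5 + 6 * u)
        wrap₁ p₁ = ≤-antisym (from 0 (≤-reflexive p₁) (solve (low ∷ u ∷ [])))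
          (from 0 (≤-reflexive (sym p₁)) (solve (low ∷ u ∷ [])))
        wrap₂ : low ≡ (1 + 3 * u) * (5 + 6 * u) + (4 + 3 * u) →
            (1 + u) * 3 + 1 + low ≡ (1 + 3 * u) * (5 + 6 * u) + (2 + (1 + (5 + 6 * u)))
        wrap₂ p₁ = ≤-antisym (from 0 (≤-reflexive p₁) (solve (low ∷ u ∷ [])))
          (from 0 (≤-reflexive (sym p₁)) (solve (low ∷ u ∷ [])))
        below-low : ∀ M y → M + y ≤ top → M + low ≡ top → y ≤ low
        below-low M y p₁ p₂ = from 0 (p₁ ⊕ (≤-reflexive (sym p₂))) (solve (M ∷ y ∷ top ∷ low ∷ []))
        z+low≤ : ∀ z → z ≤ 5 + 6 * u → 5 + 6 * u + low ≡ top → z + low ≤ top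
        z+low≤ z p₁ p₂ = from 0 (p₁ ⊕ (≤-reflexive p₂)) (solve (z ∷ u ∷ low ∷ top ∷ []))

      low≡ : low ≡ (1 + 3 * u) * M + (4 + 3 * u)
      low≡ = low-size low-top top≡

      1≤low : 1 ≤ low
      1≤low = low-pos low≡

      row₀ : Row 1 0 gs
      row₀ = new-row (1 + 3 * u) 0 (suc zero) hit₁ run₁ (M+≤top 1≤low)
        (first-sum (sum gs) sum≡) (first-span (span gs) (run-end run₁) top≡)

      hit-M+1 : H (1 + M)
      hit-M+1 = subst H (+-comm M 1) (run-target hit₁ (Row.row-run row₀))

      iterate : Periodic 1 low → ∀ i z → 1 ≤ z → i * M + z ≤ top → H (i * M + z) → H z
      iterate per zero    z _   _  h = h
      iterate per (suc i) z 1≤z le h = iterate per i z 1≤z (≤-trans y≤low low≤top)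
        (per (i * M + z) (≤-trans 1≤z (m≤n+m z (i * M))) y≤low (subst H (+-assoc M (i * M) z) h))
        where
        y≤low : i * M + z ≤ low
        y≤low = below-low M (i * M + z) (subst (_≤ top) (+-assoc M (i * M) z) le) low-top

      -- If the hits were M-periodic, the position of the end of the strip modulo M and the
      -- way the strip closes up would put a hit next to 1 + M.
      not-periodic : Periodic 1 low → ⊥
      not-periodic per = close (parity (u * 3 + 1))
        where
        -- `low` is 4 + 3 u modulo `M`, so descending by periods carries this hit into the first
        -- row.
        hit-mid : H (4 + 3 * u)
        hit-mid = iterate per (1 + 3 * u) (4 + 3 * u) 1≤4+3u (subst (_≤ top) low≡ low≤top)
            (subst H low≡ hit-low)
        thirds : ∀ i → i ≤ 1 + u → H (i * 3 + 1)
        thirds = go (run-split-at (Row.row-run row₀) hit-mid 1≤4+3u 4+3u≤)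
          where
          go : Split 1 (Row.row row₀) (4 + 3 * u) (M + 1) → ∀ i → i ≤ 1 + u → H (i * 3 + 1)
          go (split {bs} {as} app rb _) i i≤ =
              zeros hit₁ rb (proj₂ l≡s≡) i (subst (i ≤_) (sym (proj₁ l≡s≡)) i≤)
            where
            l≡s≡ : length bs ≡ 1 + u × sum bs ≡ 0
            -- The span from 1 to 4 + 3 u is a multiple of 3, so an excess of at most 2 must be 0.
            l≡s≡ = mod-unique 3 (length bs) (1 + u) (s≤s (≤-trans (m≤m+n _ (sum as))
              (≤-reflexive (trans (sym (sum-++ bs as)) (trans (cong sum (sym app)) (Row.row-sum-2 row₀))))))
                  0<3
              (middle-span (length bs) (sum bs) (run-end rb))
        wrapped : ∀ z y → Even z → H z → z ≤ M → z + low ≡ (1 + 3 * u) * M + y → 1 ≤ y → H y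
        wrapped z y ev h z≤M eq 1≤y =
            iterate per (1 + 3 * u) y 1≤y (subst (_≤ top) eq (z+low≤ z z≤M low-top))
            (subst H eq (wrap ev h z≤M))
        -- One of 3 u + 1 and 3 u + 4 is even. Wrapped around and brought down by periods, it lands
        -- on `M` or on `M + 3`, too close to the hit 1 + `M`.
        close : Even (u * 3 + 1) ⊎ Odd (u * 3 + 1) → ⊥
        close (inj₁ ev) = sep₁ (wrapped (u * 3 + 1) M ev (thirds u (n≤1+n u)) 1+3u≤M (wrap₁ low≡) (s≤s z≤n))
            hit-M+1
        close (inj₂ o) = sep₂ hit-M+1
          (wrapped ((1 + u) * 3 + 1) (2 + (1 + M)) (suc (suc (suc o))) (thirds (1 + u) ≤-refl) 4+3u≤M
              (wrap₂ low≡) (s≤s z≤n))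

      first-row-big-gap : ¬ All (_≤ 1) (Row.row row₀)
      first-row-big-gap all = not-periodic (rows-periodic _ (Row.K row₀) 0 ≤-refl (suc zero) hit₁ 1≤low
          (Row.row-run row₀) all
        (Row.row-sum-2 row₀) (Row.row-length row₀) (Row.rest-run row₀) (Row.rest-sum≡ row₀)
            (Row.rest-span≡ row₀))

      private
        4-gap : ∀ g → 3 + g + (2 + 6 * u) ≤ 5 + 6 * u + 1 → g ≤ 1
        4-gap g p₁ = from 0 p₁ (solve (g ∷ u ∷ []))
        left-sum : ∀ s s1 s2 → s ≡ s1 + (1 + s2) → s ≡ 2 → s1 ≤ 1
        left-sum s s1 s2 p₁ p₂ = from (s2) ((≤-reflexive (sym p₁)) ⊕ (≤-reflexive p₂))
            (solve (s ∷ s1 ∷ s2 ∷ []))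
        right-sum : ∀ s s1 s2 → s ≡ s1 + (1 + s2) → s ≡ 2 → s2 ≤ 1
        right-sum s s1 s2 p₁ p₂ =
            from (s1) ((≤-reflexive (sym p₁)) ⊕ (≤-reflexive p₂)) (solve (s ∷ s1 ∷ s2 ∷ []))
        1≤2+6u : 1 ≤ 2 + 6 * u
        1≤2+6u = from (1 + 6 * u) (z≤n {0}) (solve (u ∷ []))
        2+6u≤ : 2 + 6 * u ≤ 5 + 6 * u + 1
        2+6u≤ = from 4 (z≤n {0}) (solve (u ∷ []))
        2+6u≢ : 2 + 6 * u ≡ 5 + 6 * u + 1 → ⊥
        2+6u≢ p₁ = n≮0 {0} (from 3 (≤-reflexive (sym p₁)) (solve (u ∷ [])))

      -- This position is 4 before the end of the first row. A gap of 4 there would leave excess 1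
      -- for the other gaps, hence no gap of 5 anywhere in the row. In the mirror image this says
      -- that the element 2 is absent.
      no-hit-before-end : ¬ H (2 + 6 * u)
      no-hit-before-end h = go (run-split-at (Row.row-run row₀) h 1≤2+6u 2+6u≤)
        where
        go : Split 1 (Row.row row₀) (2 + 6 * u) (M + 1) → ⊥
        go (split {bs} app rb ra) = last ra app refl
          where
          last : ∀ {as b} → Run H (2 + 6 * u) as b → Row.row row₀ ≡ bs ++ as → b ≡ M + 1 → ⊥
          last stop _ b≡ = 2+6u≢ b≡
          last r@(step {g = zero} _ h r′) _ refl = sep₁ h hit-M+1
          last (step {g = 1} {gs = as} _ h r′) app refl = first-row-big-gap (subst (All (_≤ 1)) (sym app)
            (++⁺ (small-sum (left-sum _ (sum bs) (sum as) s≡ refl))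
                (≤-refl All.∷ small-sum (right-sum _ (sum bs) (sum as) s≡ refl))))
            where
            s≡ : 2 ≡ sum bs + (1 + sum as)
            s≡ = trans (sym (Row.row-sum-2 row₀)) (trans (cong sum app) (sum-++ bs (1 ∷ as)))
          last r@(step {g = suc (suc g)} _ h r′) _ refl = <⇒≱ (s≤s (s≤s z≤n)) (4-gap (2 + g) (run-≤ r′))

      -- Positions 6 and 9 hold the elements 3 and m + 4. Seen from the other end of the edge these
      -- are m - 3 and n - 4, the elements needed to control the end of the strip.
      record First-Gap-5 : Set where
        field
          none : ∀ i → i < 4 → ¬ H (suc i + 1)
          hit₆ : H 6
          hit₉ : H 9

      private
        1≤rest : ∀ l → 1 + l ≡ 1 + 2 * u → 1 ≤ u → 1 ≤ l
        1≤rest l p₁ p₂ = from (u) ((≤-reflexive (sym p₁)) ⊕ p₂) (solve (l ∷ u ∷ []))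

        3+≢2 : ∀ {x} → 3 + x ≡ 2 → ⊥
        3+≢2 ()

      first-gap : ¬ H 4 → First-Gap-5
      first-gap ¬h₄ = go (Row.row-run row₀) refl
        where
        go : ∀ {rs b} → Run H 1 rs b → rs ≡ Row.row row₀ → First-Gap-5
        go stop eq = ⊥-elim (0≢1+n (trans (cong length eq) (Row.row-length row₀)))
        go (step {g = zero} _ h _) eq = ⊥-elim (¬h₄ h)
        go (step {g = 1} _ _ _) eq = ⊥-elim (first-row-big-gap (subst (All (_≤ 1)) eq
          (≤-refl All.∷ small-sum (≤-reflexive
              (suc-injective (trans (cong sum eq) (Row.row-sum-2 row₀)))))))
        go (step {g = 2} n h r) eq = record
          { none = n
          ; hit₆ = h
          ; hit₉ = zeros h r (suc-injective (suc-injective (trans (cong sum eq) (Row.row-sum-2 row₀)))) 1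
                     (1≤rest _ (trans (cong length eq) (Row.row-length row₀)) 1≤u)
          }
        go (step {g = suc (suc (suc _))} _ _ _) eq =
            ⊥-elim (3+≢2 (trans (cong sum eq) (Row.row-sum-2 row₀)))

      -- The last 8 positions have length 2 modulo 3 and so use excess at least 2. That is the whole
      -- surplus, and the run from 1 to `end` is left with no slack.
      module Chain {end : ℕ} (end-top : 8 + end ≡ top) (hit-end : H end) where

        private
          even-end : Even end
          even-end = even-end′ (subst Even (sym end-top) even-top)
            where
            even-end′ : Even (8 + end) → Even end
            even-end′ (suc (suc (suc (suc (suc (suc (suc (suc e)))))))) = e

          end≤top : end ≤ top
          end≤top = subst (end ≤_) end-top (m≤n+m end 8)

          blocked-end : ∀ {q} → Odd q → M + q ≡ 2 + end → ¬ H q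
          blocked-end oq eq h = sep₂ hit-end (subst H eq (up oq h
            (subst (_≤ top) (sym eq) (subst (2 + end ≤_) end-top (+-monoˡ-≤ end {2} {8} (s≤s (s≤s z≤n)))))))

          module B = Bound even-end end≤top blocked-end

          fits : ∀ K D → 3 + D ≡ (1 + K) * (8 + 6 * u) → 5 + 6 * u ≤ D
          fits K D p₁ = from (8 * K + 6 * K * u) (≤-reflexive (sym p₁)) (solve (D ∷ K ∷ u ∷ []))
          rest-span : ∀ K D C → 3 + D ≡ (1 + K) * (8 + 6 * u) → D ≡ 5 + 6 * u + C → C ≡ K * (8 + 6 * u)
          rest-span K D C p₁ p₂ = ≤-antisym (from 0 ((≤-reflexive p₁) ⊕ (≤-reflexive (sym p₂)))
              (solve (D ∷ K ∷ u ∷ C ∷ [])))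
            (from 0 ((≤-reflexive (sym p₁)) ⊕ (≤-reflexive p₂)) (solve (D ∷ K ∷ u ∷ C ∷ [])))
          rest-room : ∀ K C → C ≡ K * (8 + 6 * u) → K * (8 + 6 * u) ≤ C + 0
          rest-room K C p₁ = from 0 (≤-reflexive (sym p₁)) (solve (C ∷ K ∷ u ∷ []))
          rest≤2 : ∀ K s s1 s2 → s ≡ 2 * (1 + K) → s ≡ s1 + s2 → 8 * K ≤ 4 * s2 + 0 → 4 * s1 ≤ 4 * 4
          rest≤2 K s s1 s2 p₁ p₂ p₃ =
              from 8 (4 ⊛ (≤-reflexive p₁) ⊕ 4 ⊛ (≤-reflexive (sym p₂)) ⊕ p₃) (solve (s ∷ K ∷ s1 ∷ s2 ∷ []))
          rest-sum′ : ∀ K s s1 s2 → s ≡ 2 * (1 + K) → s ≡ s1 + s2 → s1 ≡ 2 → s2 ≡ 2 * K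
          rest-sum′ K s s1 s2 p₁ p₂ p₃ =
              ≤-antisym (from 0 ((≤-reflexive p₁) ⊕ (≤-reflexive (sym p₂)) ⊕ (≤-reflexive (sym p₃)))
              (solve (s ∷ K ∷ s1 ∷ s2 ∷ [])))
            (from 0 ((≤-reflexive (sym p₁)) ⊕ (≤-reflexive p₂) ⊕ (≤-reflexive p₃))
                (solve (s ∷ K ∷ s1 ∷ s2 ∷ [])))
          first-5 : ∀ g p → 5 + p ≤ 3 + g + p → 3 + g + p ≤ 5 + p → g ≡ 2
          first-5 g p p₁ p₂ = ≤-antisym (from 0 p₂ (solve (p ∷ g ∷ [])))
            (from 0 p₁ (solve (p ∷ g ∷ [])))
          eq-room : ∀ K C → C ≡ K * (8 + 6 * u) → K * (8 + 6 * u) ≤ C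
          eq-room K C p₁ = from 0 (≤-reflexive (sym p₁)) (solve (C ∷ K ∷ u ∷ []))
          even-room′ : ∀ K C D g → C ≡ K * (8 + 6 * u) → C ≡ 3 + g + D → K * (8 + 6 * u) ≤ D + (3 + g)
          even-room′ K C D g p₁ p₂ =
              from 0 ((≤-reflexive (sym p₁)) ⊕ (≤-reflexive p₂)) (solve (C ∷ K ∷ u ∷ g ∷ D ∷ []))
          gap≤1 : ∀ K g s → g + s ≡ 2 * K → 8 * K ≤ 4 * s + (3 + g) → 2 ≤ g → ⊥
          gap≤1 K g s p₁ p₂ p₃ = n≮0 {0} (from (g) (4 ⊛ (≤-reflexive p₁) ⊕ p₂ ⊕ 2 ⊛ p₃)
              (solve (g ∷ s ∷ K ∷ [])))
          next-span : ∀ K C D → C ≡ (1 + K) * (8 + 6 * u) → C ≡ 3 + 0 + D → 3 + D ≡ (1 + K) * (8 + 6 * u)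
          next-span K C D p₁ p₂ = ≤-antisym (from 0 ((≤-reflexive p₁) ⊕ (≤-reflexive (sym p₂)))
              (solve (C ∷ K ∷ u ∷ D ∷ [])))
            (from 0 ((≤-reflexive (sym p₁)) ⊕ (≤-reflexive p₂)) (solve (C ∷ K ∷ u ∷ D ∷ [])))
          8-below : ∀ D p K → end ≡ D + (3 + (5 + 6 * u + p)) → 3 + D ≡ (1 + K) * (8 + 6 * u) →
              8 + end ≡ top → 5 + 6 * u + (8 + p) ≤ top
          8-below D p K p₁ p₂ p₃ = from (3 + D) ((≤-reflexive (sym p₁)) ⊕ (≤-reflexive p₃))
              (solve (end ∷ D ∷ u ∷ p ∷ K ∷ top ∷ []))

        -- A tight row with initial gap 5 passes it on: the step to the next row must be 3, and the
        -- odd hit 8 + p translates to the hit 5 after the start of that row.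
        chain : ∀ K {p gs} → Odd p → H p → (∀ i → i < 4 → ¬ H (suc i + p)) → H (5 + p) → Run H p gs end →
                sum gs ≡ 2 * (1 + K) → 3 + span gs ≡ (1 + K) * (8 + 6 * u) → gs ≡ blocks u K
        chain K {p} {gs} op hp none h₅ r s≡ D≡ = go (run-split M r (up op hp (≤-trans M+p≤ end≤top)) M+p≤)
          where
          M+p≤ : M + p ≤ end
          M+p≤ = subst (M + p ≤_) (sym (run-end r)) (+-monoˡ-≤ p (fits K (span gs) D≡))
          go : Split p gs (M + p) end → gs ≡ blocks u K
          go (split {bs} {as} app rb ra) =
              trans app (trans (cong (_++ as) bs≡)
              (finish K A≡ (rest-sum′ K (sum gs) (sum bs) (sum as) s≡ S≡ (proj₁ sums)) ra))
            where
            S≡ : sum gs ≡ sum bs + sum as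
            S≡ = trans (cong sum app) (sum-++ bs as)
            A≡ : span as ≡ K * (8 + 6 * u)
            A≡ = rest-span K (span gs) (span as) D≡ (trans (cong span app)
              (trans (span-++ bs as) (cong (_+ span as) (+-cancelʳ-≡ p _ _ (sym (run-end rb))))))
            hM : H (M + p)
            hM = run-target hp rb
            sums : sum bs ≡ 2 × length bs ≡ 1 + 2 * u
            sums = row-sum rb (*-cancelˡ-≤ 4 (rest≤2 K (sum gs) (sum bs) (sum as) s≡ S≡
              (B.bound-even _ ≤-refl (odd+odd odd-M op) hM ra K 0 (rest-room K (span as) A≡))))

            first : ∀ {bs b} → Run H p bs b → sum bs ≡ 2 → length bs ≡ 1 + 2 * u → bs ≡ block u × H (8 + p)
            first stop () _
            first r@(step {g = g} {gs = xs} {e = b} n h r′) s l = starts g g≡2 h r′ s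
              where
              g≡2 : g ≡ 2
              g≡2 = first-5 g p (+-monoˡ-≤ p (≰⇒> λ le → none (2 + g) le h))
                  (next-hit-≤ r h₅ (m<n+m p {5} (s≤s z≤n)))
              starts : ∀ g → g ≡ 2 → H (3 + g + p) → Run H (3 + g + p) xs b → g + sum xs ≡ 2 →
                  (g ∷ xs) ≡ block u × H (8 + p)
              starts .2 refl h r s = cong (2 ∷_)
                  (trans (all-zero xs xs≡0) (cong (λ k → replicate k 0) (suc-injective l)))
                                   , zeros h r xs≡0 1 (1≤rest _ l 1≤u)
                where
                xs≡0 : sum xs ≡ 0
                xs≡0 = suc-injective (suc-injective s)

            bs≡ : bs ≡ block u
            bs≡ = proj₁ (first rb (proj₁ sums) (proj₂ sums))
            h₈ : H (8 + p)
            h₈ = proj₂ (first rb (proj₁ sums) (proj₂ sums))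

            finish : ∀ K {as} → span as ≡ K * (8 + 6 * u) → sum as ≡ 2 * K → Run H (M + p) as end →
                block u ++ as ≡ blocks u K
            finish zero {[]} _ _ _ = ++-identityʳ (block u)
            finish zero {g ∷ as} A≡ _ _ = ⊥-elim (1+n≢0 (trans (sym (span-∷ g as)) A≡))
            finish (suc K) {[]} () _ _
            finish (suc K) {g ∷ as} A≡ S≡ (step n h r) = next g n h r (parity (3 + g + (M + p))) A≡ S≡
              where
              next : ∀ g → (∀ i → i < 2 + g → ¬ H (suc i + (M + p))) → H (3 + g + (M + p)) →
                  Run H (3 + g + (M + p)) as end →
                     Even (3 + g + (M + p)) ⊎ Odd (3 + g + (M + p)) → span (g ∷ as) ≡ (1 + K) *
                         (8 + 6 * u) →
                     g + sum as ≡ 2 * (1 + K) → block u ++ g ∷ as ≡ blocks u (suc K)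
              next zero n h r (inj₁ (suc (suc (suc o)))) = ⊥-elim (even-odd-⊥ (odd+odd odd-M op) o)
              -- Translated down, a gap of 4 after the row would put a hit inside its initial gap of
              -- 5.
              next 1 n h r (inj₁ _) A≡ S≡ =
                  ⊥-elim (none 3 ≤-refl (down (suc (suc (suc (suc op)))) (subst H (+-swap 4 M p) h)))
              next g@(suc (suc _)) n h r (inj₁ e) A≡ S≡ = ⊥-elim (gap≤1 (1 + K) g (sum as) S≡
                (B.bound-even _ ≤-refl e h r (1 + K) (3 + g) (even-room′ (1 + K) (span (g ∷ as))
                    (span as) g A≡ (span-∷ g as))) (s≤s (s≤s z≤n)))
              next (suc g) n h r (inj₂ o) A≡ S≡ =
                ⊥-elim (1+n≢0 (B.tight-next-odd (1 + K) o (step n h r) S≡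
                    (eq-room (1 + K) (span (suc g ∷ as)) A≡)))
              next zero n h r (inj₂ o) A≡ S≡ =
                  cong (λ xs → block u ++ 0 ∷ xs) (chain K o h none′ h₅′ r S≡ D′≡)
                where
                D′≡ : 3 + span as ≡ (1 + K) * (8 + 6 * u)
                D′≡ = next-span K (span (0 ∷ as)) (span as) A≡ (span-∷ 0 as)
                h₅′ : H (5 + (3 + (M + p)))
                h₅′ = subst H (+-swap M 8 p) (up (suc (suc (suc (suc (suc (suc (suc (suc op)))))))) h₈
                  (8-below (span as) p K (run-end r) D′≡ end-top))
                none′ : ∀ i → i < 4 → ¬ H (suc i + (3 + (M + p)))
                none′ 0 _ h′ = sep₁ h h′
                none′ 1 _ h′ = sep₂ h h′
                none′ 2 _ h′ = sep₁ h₅ (down (suc (suc (suc (suc (suc (suc op))))))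
                    (subst H (+-swap 6 M p) h′))
                none′ 3 _ h′ = sep₁ h′ h₅′
                none′ (suc (suc (suc (suc _)))) (s≤s (s≤s (s≤s (s≤s ()))))

        private
          all-span : ∀ D → end ≡ D + 1 → 8 + end ≡ top → top ≡ 2 * (9 * u * u + 15 * u + 7) →
              3 + D ≡ (1 + 3 * u) * (8 + 6 * u)
          all-span D p₁ p₂ p₃ = ≤-antisym
              (from 0 ((≤-reflexive (sym p₁)) ⊕ (≤-reflexive p₂) ⊕ (≤-reflexive p₃))
              (solve (end ∷ D ∷ top ∷ u ∷ [])))
            (from 0 ((≤-reflexive p₁) ⊕ (≤-reflexive (sym p₂)) ⊕ (≤-reflexive (sym p₃)))
                (solve (end ∷ D ∷ top ∷ u ∷ [])))
          all-room : ∀ D → 3 + D ≡ (1 + 3 * u) * (8 + 6 * u) → (1 + 3 * u) * (8 + 6 * u) ≤ 3 + D + 0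
          all-room D p₁ = from 0 (≤-reflexive (sym p₁)) (solve (D ∷ u ∷ []))
          all-sum : ∀ s s1 s2 → s ≡ 6 * u + 4 → s ≡ s1 + s2 → 2 ≤ s2 → 8 * (1 + 3 * u) ≤ 4 * s1 + 0 →
              4 * s1 ≡ 4 * (2 * (1 + 3 * u))
          all-sum s s1 s2 p₁ p₂ p₃ p₄ =
              ≤-antisym (from 0 (4 ⊛ (≤-reflexive p₁) ⊕ 4 ⊛ (≤-reflexive (sym p₂)) ⊕ 4 ⊛ p₃)
              (solve (s ∷ u ∷ s1 ∷ s2 ∷ [])))
            (from 0 p₄ (solve (s ∷ u ∷ s1 ∷ s2 ∷ [])))
          1≤end : 8 + end ≡ top → top ≡ 2 * (9 * u * u + 15 * u + 7) → 1 ≤ end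
          1≤end p₁ p₂ = from (5 + 30 * u + 18 * u * u) ((≤-reflexive (sym p₁)) ⊕ (≤-reflexive (sym p₂)))
              (solve (end ∷ top ∷ u ∷ []))

          2≤sum-8 : ∀ l s → 3 * l + s ≡ 8 → 2 ≤ s
          2≤sum-8 l zero eq = ⊥-elim (≢-mod-3 l 2 0<3 2<3 (λ ()) eq)
          2≤sum-8 l (suc zero) eq = ⊥-elim (≢-mod-3 l 2 1<3 2<3 (λ ()) eq)
          2≤sum-8 l (suc (suc s)) eq = s≤s (s≤s z≤n)

        forced : ¬ H 4 → Run H 1 (blocks u (3 * u)) end
        forced ¬h₄ = go (run-split-at run₁ hit-end (1≤end end-top top≡) end≤top)
          where
          fg : First-Gap-5
          fg = first-gap ¬h₄
          go : Split 1 gs end top → Run H 1 (blocks u (3 * u)) end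
          go (split {bs} {as} app rb ra) = subst (λ xs → Run H 1 xs end)
            (chain (3 * u) (suc zero) hit₁ (First-Gap-5.none fg) (First-Gap-5.hit₆ fg) rb s≡ D≡) rb
            where
            D≡ : 3 + span bs ≡ (1 + 3 * u) * (8 + 6 * u)
            D≡ = all-span (span bs) (run-end rb) end-top top≡
            s≡ : sum bs ≡ 2 * (1 + 3 * u)
            s≡ = *-cancelˡ-≡ (sum bs) _ 4 (all-sum (sum gs) (sum bs) (sum as) sum≡
                (trans (cong sum app) (sum-++ bs as))
              (2≤sum-8 (length as) (sum as) (+-cancelʳ-≡ end _ _ (trans (sym (run-end ra)) (sym end-top))))
              (B.bound-odd _ ≤-refl (suc zero) hit₁ rb (1 + 3 * u) 0 (all-room (span bs) D≡)))

-- Counting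

⟦_⟧ : Bool → ℕ
⟦ true ⟧  = 1
⟦ false ⟧ = 0

count : (ℕ → Bool) → ℕ → ℕ
count f zero    = 0
count f (suc k) = count f k + ⟦ f k ⟧

count-front : ∀ f k → count f (suc k) ≡ ⟦ f 0 ⟧ + count (f ∘ suc) k
count-front f zero    = sym (+-identityʳ _)
count-front f (suc k) = trans (cong (_+ ⟦ f (suc k) ⟧) (count-front f k)) (+-assoc ⟦ f 0 ⟧ _ _)

count≡∑ : ∀ f k → count f k ≡ ∑ {k} (λ i → ⟦ f (toℕ i) ⟧)
count≡∑ f zero    = refl
count≡∑ f (suc k) = trans (count-front f k) (cong (⟦ f 0 ⟧ +_) (count≡∑ (f ∘ suc) k))

count-skip : ∀ f s k → (∀ i → i < k → f (i + s) ≡ false) → count f (k + s) ≡ count f s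
count-skip f s zero    _    = refl
count-skip f s (suc k) none = begin
  count f (k + s) + ⟦ f (k + s) ⟧  ≡⟨ cong₂ (λ c b → c + ⟦ b ⟧) (count-skip f s k λ i i<k →
      none i (m<n⇒m<1+n i<k)) (none k (n<1+n k)) ⟩
  count f s + 0                    ≡⟨ +-identityʳ _ ⟩
  count f s                        ∎
  where open ≡-Reasoning

-- Congruence modulo n

module Modular (N : ℕ) where

  n : ℕ
  n = suc N

  infix 4 _≈_

  -- Multiples of `n` are added on both sides, which keeps subtraction out and makes symmetry
  -- immediate.
  record _≈_ (a b : ℕ) : Set where
    constructor multiples
    field
      i j   : ℕ
      equal : a + i * n ≡ b + j * n

  ≡⇒≈ : ∀ {a b} → a ≡ b → a ≈ b
  ≡⇒≈ refl = multiples 0 0 refl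

  ≈-sym : ∀ {a b} → a ≈ b → b ≈ a
  ≈-sym (multiples i j eq) = multiples j i (sym eq)

  private
    trans-eq : ∀ a b c i j k l m → a + i * m ≡ b + j * m → b + k * m ≡ c + l * m →
        a + (i + k) * m ≡ c + (j + l) * m
    trans-eq a b c i j k l m p₁ p₂ =
        ≤-antisym (from 0 ((≤-reflexive p₁) ⊕ (≤-reflexive p₂))
        (solve (a ∷ i ∷ m ∷ b ∷ j ∷ k ∷ c ∷ l ∷ [])))
      (from 0 ((≤-reflexive (sym p₁)) ⊕ (≤-reflexive (sym p₂)))
          (solve (a ∷ i ∷ m ∷ b ∷ j ∷ k ∷ c ∷ l ∷ [])))
    scale-l : ∀ c a i m → c * a + c * i * m ≡ c * (a + i * m)
    scale-l c a i m = solve (c ∷ a ∷ i ∷ m ∷ [])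
    add-l : ∀ c a i m → c + a + i * m ≡ c + (a + i * m)
    add-l c a i m = solve (c ∷ a ∷ i ∷ m ∷ [])

  ≈-trans : ∀ {a b c} → a ≈ b → b ≈ c → a ≈ c
  ≈-trans {a} {b} {c} (multiples i j p) (multiples k l q) =
      multiples (i + k) (j + l) (trans-eq a b c i j k l n p q)

  *-cong-≈ : ∀ c {a b} → a ≈ b → c * a ≈ c * b
  *-cong-≈ c {a} {b} (multiples i j p) = multiples (c * i) (c * j)
    (trans (scale-l c a i n) (trans (cong (c *_) p) (sym (scale-l c b j n))))

  +-cong-≈ : ∀ c {a b} → a ≈ b → c + a ≈ c + b
  +-cong-≈ c {a} {b} (multiples i j p) = multiples i j
    (trans (add-l c a i n) (trans (cong (c +_) p) (sym (add-l c b j n))))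

  ≈⇒%≡ : ∀ {a b} → a ≈ b → a % n ≡ b % n
  ≈⇒%≡ {a} {b} (multiples i j eq) =
      trans (sym ([m+kn]%n≡m%n a i n)) (trans (cong (_% n) eq) ([m+kn]%n≡m%n b j n))

  %-≈ : ∀ a → a % n ≈ a
  %-≈ a = multiples (a / n) 0 (trans (sym (m≡m%n+[m/n]*n a n)) (sym (+-identityʳ a)))

  ≈⇒≡ : ∀ {a b} → a < n → b < n → a ≈ b → a ≡ b
  ≈⇒≡ a<n b<n eq = trans (sym (m<n⇒m%n≡m a<n)) (trans (≈⇒%≡ eq) (m<n⇒m%n≡m b<n))

  add-once : ∀ {s a b} → s < n → a < n → b < n → s + a ≈ b → s + a ≡ b ⊎ s + a ≡ b + n
  add-once {s} {a} {b} s<n a<n b<n eq with n ≤? s + a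
  ... | no ¬le = inj₁ (≈⇒≡ (≰⇒> ¬le) b<n eq)
  ... | yes le with m≤n⇒∃[o]m+o≡n le
  ...   | o , n+o≡ = inj₂ (trans (sym n+o≡) (trans (+-comm n o) (cong (_+ n) (≈⇒≡ o<n b<n o≈b))))
    where
    o<n : o < n
    o<n = +-cancelˡ-< n o n (subst (_< n + n) (sym n+o≡) (+-mono-< s<n a<n))
    o≈b : o ≈ b
    o≈b = ≈-trans (multiples 1 0 (trans (cong (o +_) (+-identityʳ n))
        (trans (+-comm o n) (trans n+o≡ (sym (+-identityʳ _)))))) eq

  toℕ-mod : ∀ a → toℕ (a mod n) ≈ a
  toℕ-mod a = ≈-trans (≡⇒≈ (toℕ-fromℕ< (m%n<n a n))) (%-≈ a)

  mod-toℕ : ∀ {a} (i : Fin n) → a ≈ toℕ i → a mod n ≡ i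
  mod-toℕ {a} i eq = toℕ-injective (≈⇒≡ (toℕ<n (a mod n)) (toℕ<n i) (≈-trans (toℕ-mod a) eq))

  Respects : (ℕ → Bool) → Set
  Respects Y = ∀ {a b} → a ≈ b → Y a ≡ Y b

  private
    cancel-c : ∀ c j → c + (j + N * c) + 0 * (1 + N) ≡ j + c * (1 + N)
    cancel-c c j = solve (c ∷ j ∷ N ∷ [])
    cancel-c′ : ∀ c j → c + j + N * c + 0 * (1 + N) ≡ j + c * (1 + N)
    cancel-c′ c j = solve (c ∷ j ∷ N ∷ [])

  inverse-≈ : ∀ g g′ x → g * g′ ≈ 1 → g * (g′ * x) ≈ x
  inverse-≈ g g′ x p = ≈-trans (≡⇒≈ (trans (sym (*-assoc g g′ x)) (*-comm (g * g′) x)))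
    (≈-trans (*-cong-≈ x p) (≡⇒≈ (*-identityʳ x)))

  -- Since `N` is n - 1, adding `N * c` subtracts c modulo `n`.
  affine-inverse : ∀ c g g′ y → g * g′ ≈ 1 → c + g * (g′ * (y + N * c)) ≈ y
  affine-inverse c g g′ y p =
      ≈-trans (+-cong-≈ c (inverse-≈ g g′ (y + N * c) p)) (multiples 0 c (cancel-c c y))

  affine-inverse′ : ∀ c g g′ x → g * g′ ≈ 1 → g′ * (c + g * x + N * c) ≈ x
  affine-inverse′ c g g′ x p = ≈-trans (*-cong-≈ g′ (multiples 0 c (cancel-c′ c (g * x))))
    (inverse-≈ g′ g x (≈-trans (≡⇒≈ (*-comm g′ g)) p))

  -- An affine map with invertible factor permutes the residues, so the count is a rearranged sum
  -- over `Fin n`.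
  count-affine : ∀ {Y} → Respects Y → ∀ c g g′ → g * g′ ≈ 1 → count (λ x → Y (c + g * x)) n ≡ count Y n
  count-affine {Y} resp c g g′ gg′≈1 = begin
    count (λ x → Y (c + g * x)) n           ≡⟨ count≡∑ (λ x → Y (c + g * x)) n ⟩
    ∑ {n} (λ i → ⟦ Y (c + g * toℕ i) ⟧)
        ≡⟨ sum-cong-≗ {n} (λ i → cong ⟦_⟧ (resp (≈-sym (toℕ-mod (c + g * toℕ i))))) ⟩
    ∑ {n} (λ i → ⟦ Y (toℕ (to i)) ⟧)        ≡⟨ sym (sum-permute (λ i → ⟦ Y (toℕ i) ⟧) π) ⟩
    ∑ {n} (λ i → ⟦ Y (toℕ i) ⟧)             ≡⟨ sym (count≡∑ Y n) ⟩
    count Y n                               ∎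
    where
    open ≡-Reasoning
    to from′ : Fin n → Fin n
    to i = (c + g * toℕ i) mod n
    from′ j = (g′ * (toℕ j + N * c)) mod n
    to-from : ∀ j → to (from′ j) ≡ j
    to-from j = mod-toℕ j (≈-trans (+-cong-≈ c (*-cong-≈ g (toℕ-mod (g′ * (toℕ j + N * c)))))
        (affine-inverse c g g′ (toℕ j) gg′≈1))
    from-to : ∀ i → from′ (to i) ≡ i
    from-to i = mod-toℕ i (≈-trans
        (*-cong-≈ g′ (≈-trans (≡⇒≈ (+-comm _ (N * c))) (≈-trans (+-cong-≈ (N * c) (toℕ-mod (c + g * toℕ i)))
        (≡⇒≈ (+-comm (N * c) _)))))
      (affine-inverse′ c g g′ (toℕ i) gg′≈1))
    π : Permutation′ n
    π = permutation to from′ to-from from-to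

  count-shift : ∀ {Y} → Respects Y → ∀ c → count (λ x → Y (c + x)) n ≡ count Y n
  count-shift {Y} resp c = trans (unit n) (count-affine resp c 1 1 (≡⇒≈ refl))
    where
    unit : ∀ k → count (λ x → Y (c + x)) k ≡ count (λ x → Y (c + 1 * x)) k
    unit zero    = refl
    unit (suc k) = cong₂ (λ s x → s + ⟦ Y (c + x) ⟧) (unit k) (sym (*-identityˡ k))

-- Doubling and interleaving two rows

double : ℕ → ℕ
double zero    = zero
double (suc k) = suc (suc (double k))

double≡2* : ∀ k → double k ≡ 2 * k
double≡2* zero    = refl
double≡2* (suc k) = cong suc (trans (cong suc (double≡2* k)) (sym (+-suc k (k + 0))))

even-double : ∀ k → Even (double k)
even-double zero    = zero
even-double (suc k) = suc (suc (even-double k))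

half-even : ∀ {z} → Even z → ∃ λ k → z ≡ double k
half-odd  : ∀ {z} → Odd z → ∃ λ k → z ≡ suc (double k)
half-even zero = 0 , refl
half-even (suc o) with half-odd o
... | k , refl = suc k , refl
half-odd (suc e) with half-even e
... | k , refl = k , refl

double-cancel-≤ : ∀ {a b} → double a ≤ double b → a ≤ b
double-cancel-≤ {a} {b} le =
    *-cancelˡ-≤ 2 (subst (_≤ 2 * b) (double≡2* a) (subst (double a ≤_) (double≡2* b) le))

double-mono-≤ : ∀ {a b} → a ≤ b → double a ≤ double b
double-mono-≤ z≤n       = z≤n
double-mono-≤ (s≤s a≤b) = s≤s (s≤s (double-mono-≤ a≤b))

double-injective : ∀ {a b} → double a ≡ double b → a ≡ b
double-injective eq = ≤-antisym (double-cancel-≤ (≤-reflexive eq)) (double-cancel-≤ (≤-reflexive (sym eq)))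

interleave : (ℕ → Bool) → (ℕ → Bool) → ℕ → Bool
interleave f g zero          = f 0
interleave f g (suc zero)    = g 0
interleave f g (suc (suc z)) = interleave (f ∘ suc) (g ∘ suc) z

interleave-even : ∀ f g k → interleave f g (double k) ≡ f k
interleave-even f g zero    = refl
interleave-even f g (suc k) = interleave-even (f ∘ suc) (g ∘ suc) k

interleave-odd : ∀ f g k → interleave f g (suc (double k)) ≡ g k
interleave-odd f g zero    = refl
interleave-odd f g (suc k) = interleave-odd (f ∘ suc) (g ∘ suc) k

-- Here t = 1 + u, so that 3 t − 1 = 2 + 3 u and 3 t = 3 + 3 u.
module Torus (u : ℕ) where

  open Modular (6 + (15 * u + 9 * u * u)) public

  -- This is n - 1 = m (m - 1), so m (m - 1) is -1 modulo n.
  N : ℕ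
  N = 6 + (15 * u + 9 * u * u)

  r : ℕ
  r = 2 + (4 * u + 3 * u * u)

  -- The difference m is left out on purpose: it is there that independent sets and sets with one
  -- edge differ.
  record Sparse (Y : ℕ → Bool) : Set where
    field
      respects : Respects Y
      apart₁   : ∀ x → Y x ≡ true → Y (1 + x) ≡ true → ⊥
      apart₂   : ∀ x → Y x ≡ true → Y (2 + 3 * u + x) ≡ true → ⊥
      size     : count Y n ≡ r

  private
    window-2* : ∀ k → 5 + 6 * u + (1 + 2 * k) ≡ 2 * (3 + 3 * u + k)
    window-2* k = solve (u ∷ k ∷ [])

  double-window : ∀ k → 5 + 6 * u + suc (double k) ≡ double (3 + 3 * u + k)
  double-window k = trans (cong (λ x → 5 + 6 * u + suc x) (double≡2* k))
    (trans (window-2* k) (sym (double≡2* (3 + 3 * u + k))))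

  -- The positions of the strip alternate between a row (x at 2 x) and the
  -- next one (x + 3 t at 2 x + 1); three consecutive positions form a triangle.
  module StripOf {Y : ℕ → Bool} (S : Sparse Y) (lo : ℕ) (lo≤1 : lo ≤ 1)
    -- `lo` is 0 for an independent set and 1 when the strip is cut after position 0; the edge {0,
    -- m} then escapes this hypothesis.
    (apart₃ : ∀ k → lo ≤ double k → k < n → Y k ≡ true → Y (3 + 3 * u + k) ≡ true → ⊥) where

    open Sparse S

    strip : ℕ → Bool
    strip = interleave Y (λ x → Y (3 + 3 * u + x))

    top : ℕ
    top = double n

    H : ℕ → Set
    H z = lo ≤ z × z ≤ top × strip z ≡ true

    hit? : ∀ z → Dec (H z)
    hit? z = lo ≤? z ×-dec z ≤? top ×-dec (strip z Bool.≟ true)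

    even-hit : ∀ {k} → H (double k) → Y k ≡ true
    even-hit {k} (_ , _ , h) = trans (sym (interleave-even _ _ k)) h

    odd-hit : ∀ {k} → H (suc (double k)) → Y (3 + 3 * u + k) ≡ true
    odd-hit {k} (_ , _ , h) = trans (sym (interleave-odd _ _ k)) h

    hit-even : ∀ k → lo ≤ double k → double k ≤ top → Y k ≡ true → H (double k)
    hit-even k lo≤ ≤top h = lo≤ , ≤top , trans (interleave-even _ _ k) h

    hit-odd : ∀ k → suc (double k) ≤ top → Y (3 + 3 * u + k) ≡ true → H (suc (double k))
    hit-odd k ≤top h = ≤-trans lo≤1 (s≤s z≤n) , ≤top , trans (interleave-odd _ _ k) h

    private
      next-row : ∀ k → 3 + 3 * u + k ≡ 2 + 3 * u + (1 + k)
      next-row k = solve (u ∷ k ∷ [])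

    sep₁ : ∀ {z} → H z → H (1 + z) → ⊥
    sep₁ {z} h h′ with parity z
    ... | inj₁ e with half-even e
    ...   | k , refl = apart₃ k (proj₁ h) (double-cancel-≤ (pad (proj₁ (proj₂ h′)))) (even-hit h)
        (odd-hit h′)
      where
      pad : suc (double k) ≤ top → double (suc k) ≤ top
      pad le = ≤∧≢⇒< le (λ eq → even-odd-⊥ (even-double n) (subst Odd eq (suc (even-double k))))
    sep₁ {z} h h′ | inj₂ o with half-odd o
    ...   | k , refl = apart₂ (1 + k) (even-hit {suc k} h′) (subst (λ x → Y x ≡ true) (next-row k)
        (odd-hit h))

    sep₂ : ∀ {z} → H z → H (2 + z) → ⊥
    sep₂ {z} h h′ with parity z
    ... | inj₁ e with half-even e
    ...   | k , refl = apart₁ k (even-hit h) (even-hit {suc k} h′)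
    sep₂ {z} h h′ | inj₂ o with half-odd o
    ...   | k , refl = apart₁ (3 + 3 * u + k) (odd-hit h) (subst (λ x → Y x ≡ true) (+-suc (3 + 3 * u) k)
        (odd-hit {suc k} h′))

    up : ∀ {q} → Odd q → H q → 5 + 6 * u + q ≤ top → H (5 + 6 * u + q)
    up o h le with half-odd o
    ... | k , refl = subst H (sym (double-window k)) (hit-even (3 + 3 * u + k)
      (≤-trans lo≤1 (subst (1 ≤_) (double-window k) (s≤s z≤n))) (subst (_≤ top) (double-window k) le)
          (odd-hit h))

    down : ∀ {q} → Odd q → H (5 + 6 * u + q) → H q
    down o h with half-odd o
    ... | k , refl = hit-odd k (≤-trans (m≤n+m _ (5 + 6 * u)) (proj₁ (proj₂ h)))
        (even-hit (subst H (double-window k) h))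

    n≈0+ : ∀ x → x + n ≈ x
    n≈0+ x = multiples 0 1 (trans (+-identityʳ _) (cong (x +_) (sym (+-identityʳ n))))

    -- Position 2 + `top` holds n + 1, congruent to 1 and hence adjacent to 0.
    blocked : Y 0 ≡ true → ∀ {q} → Odd q → 5 + 6 * u + q ≡ 2 + top → ¬ H q
    blocked h₀ o eq h with half-odd o
    ... | k , refl = apart₁ 0 h₀ (trans (sym (respects (n≈0+ 1))) (subst (λ x → Y x ≡ true)
      (double-injective {b = 1 + n} (trans (sym (double-window k)) eq)) (odd-hit h)))

    count-strip : ∀ k → count strip (double k) ≡ count Y k + count (λ x → Y (3 + 3 * u + x)) k
    count-strip zero    = refl
    count-strip (suc k) = begin
      count strip (double k) + ⟦ strip (double k) ⟧ + ⟦ strip (suc (double k)) ⟧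
        ≡⟨ cong₂ (λ a b → count strip (double k) + ⟦ a ⟧ + ⟦ b ⟧) (interleave-even _ _ k)
            (interleave-odd _ _ k) ⟩
      count strip (double k) + y + y′  ≡⟨ cong (λ c → c + y + y′) (count-strip k) ⟩
      c + c′ + y + y′                  ≡⟨ regroup c c′ y y′ ⟩
      (c + y) + (c′ + y′)              ∎
      where
      open ≡-Reasoning
      c c′ y y′ : ℕ
      c  = count Y k
      c′ = count (λ x → Y (3 + 3 * u + x)) k
      y  = ⟦ Y k ⟧
      y′ = ⟦ Y (3 + 3 * u + k) ⟧
      regroup : ∀ a b c d → a + b + c + d ≡ (a + c) + (b + d)
      regroup a b c d = solve (a ∷ b ∷ c ∷ d ∷ [])

    count-top : count strip top ≡ r + r
    count-top = trans (count-strip n) (cong₂ _+_ size (trans (count-shift respects (3 + 3 * u)) size))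

    run-count : ∀ {a gs b} → Run H a gs b → lo ≤ a → b ≤ top → count strip (suc b) ≡ length gs + count strip
        (suc a)
    run-count stop _ _ = refl
    run-count {a} {g ∷ gs} {b} (step none h r) lo≤a b≤ = begin
      count strip (suc b)
          ≡⟨ run-count r (≤-trans lo≤a (m≤n+m a (3 + g))) b≤ ⟩
      length gs + (count strip (3 + g + a) + ⟦ strip (3 + g + a) ⟧)
        ≡⟨ cong₂ (λ c x → length gs + (c + ⟦ x ⟧)) skip (proj₂ (proj₂ h)) ⟩
      length gs + (count strip (suc a) + 1)                   ≡⟨ regroup (length gs) (count strip (suc a)) ⟩
      suc (length gs) + count strip (suc a)                   ∎
      where
      open ≡-Reasoning
      regroup : ∀ l c → l + (c + 1) ≡ suc l + c
      regroup l c = solve (l ∷ c ∷ [])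
      not-hit : ∀ i → i < 2 + g → strip (suc i + a) ≡ false
      not-hit i i< = Bool.¬-not λ eq → none i i< (≤-trans lo≤a (m≤n+m a (suc i)) ,
        ≤-trans (+-monoˡ-≤ a (≤-trans i< (n≤1+n (2 + g)))) (≤-trans (run-≤ r) b≤) , eq)
      skip : count strip (3 + g + a) ≡ count strip (suc a)
      skip = trans (cong (count strip) (sym (+-suc (2 + g) a)))
        (count-skip strip (suc a) (2 + g) (λ i i< → trans (cong strip (+-suc i a)) (not-hit i i<)))

    run-total : ∀ {a gs b} → Run H a gs b → lo ≤ a → H b → count strip b + 1 ≡ length gs + count strip
        (suc a)
    run-total {b = b} run lo≤a (_ , b≤ , hb) =
        trans (cong (λ x → count strip b + ⟦ x ⟧) (sym hb)) (run-count run lo≤a b≤)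

    module Strips = Strip u H top sep₁ sep₂ up down

  -- Independent sets

  record Independent (Y : ℕ → Bool) : Set where
    field
      sparse : Sparse Y
      apart₃ : ∀ x → Y x ≡ true → Y (3 + 3 * u + x) ≡ true → ⊥
    open Sparse sparse public

  private
    total : ∀ l s → 3 * l + s ≡ 2 * (7 + (15 * u + 9 * u * u)) → l ≡ (2 + (4 * u + 3 * u * u)) +
        (2 + (4 * u + 3 * u * u)) → s ≡ 2 * (1 + 3 * u)
    total l s p₁ p₂ = ≤-antisym (from 0 ((≤-reflexive p₁) ⊕ 3 ⊛ (≤-reflexive (sym p₂)))
        (solve (l ∷ s ∷ u ∷ [])))
      (from 0 ((≤-reflexive (sym p₁)) ⊕ 3 ⊛ (≤-reflexive p₂)) (solve (l ∷ s ∷ u ∷ [])))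
    total-room : ∀ D → D ≡ 2 * (7 + (15 * u + 9 * u * u)) → (1 + 3 * u) * (8 + 6 * u) + 3 ≤ D
    total-room D p₁ = from 3 (≤-reflexive (sym p₁)) (solve (D ∷ u ∷ []))
    strip-length : ∀ l c → c + 1 ≡ l + 1 → l ≡ c
    strip-length l c p₁ = ≤-antisym (from 0 (≤-reflexive (sym p₁)) (solve (c ∷ l ∷ [])))
      (from 0 (≤-reflexive p₁) (solve (c ∷ l ∷ [])))

  -- With exactly r elements there is no excess to spare after an even hit.
  diagonal : ∀ {Y} → Independent Y → Y 0 ≡ true → Y (4 + 3 * u) ≡ true
  diagonal {Y} I h₀ = go (run-between hit? sep₁ sep₂ 0 top hit-0 (subst H (sym (+-identityʳ top)) hit-top))
    where
    open Independent I hiding (apart₃)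
    open StripOf sparse 0 z≤n (λ k _ _ → Independent.apart₃ I k)
    hit-0 : H 0
    hit-0 = hit-even 0 z≤n z≤n h₀
    hit-top : H top
    hit-top = hit-even n z≤n ≤-refl (trans (respects (n≈0+ 0)) h₀)
    go : (∃ λ gs → Run H 0 gs (top + 0)) → Y (4 + 3 * u) ≡ true
    go (gs , run) = first run′ refl refl
      where
      run′ : Run H 0 gs top
      run′ = subst (Run H 0 gs) (+-identityʳ top) run
      gs-length : length gs ≡ r + r
      gs-length = trans (strip-length (length gs) (count strip top)
        (trans (run-total run′ z≤n hit-top) (cong (λ b → length gs + ⟦ b ⟧) (proj₂ (proj₂ hit-0)))))
            count-top
      D≡ : span gs ≡ 2 * n
      D≡ = trans (sym (+-identityʳ _)) (trans (sym (run-end run′)) (double≡2* n))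
      s≡ : sum gs ≡ 2 * (1 + 3 * u)
      s≡ = total (length gs) (sum gs) D≡ gs-length
      open Strips.Bound {top} (even-double n) ≤-refl (blocked h₀)
      first : ∀ {hs e} → Run H 0 hs e → hs ≡ gs → e ≡ top → Y (4 + 3 * u) ≡ true
      first stop refl _ = ⊥-elim (0≢1+n gs-length)
      first run@(step {g = g} _ h _) refl refl = subst (λ x → Y x ≡ true) (+-comm (3 + 3 * u) 1)
        (odd-hit {1} (subst (λ g → H (3 + g + 0)) g≡0 h))
        where
        g≡0 : g ≡ 0
        g≡0 = tight-next (1 + 3 * u) run s≡ (total-room (span gs) D≡)

  translate-sparse : ∀ {Y} → Sparse Y → ∀ c → Sparse (λ x → Y (c + x))
  translate-sparse {Y} S c = record
    { respects = λ eq → respects (+-cong-≈ c eq)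
    ; apart₁   = λ x h h′ → apart₁ (c + x) h (subst (λ z → Y z ≡ true) (+-swap c 1 x) h′)
    ; apart₂   = λ x h h′ → apart₂ (c + x) h (subst (λ z → Y z ≡ true) (+-swap c (2 + 3 * u) x) h′)
    ; size     = trans (count-shift respects c) size
    }
    where open Sparse S

  translate : ∀ {Y} → Independent Y → ∀ c → Independent (λ x → Y (c + x))
  translate {Y} I c = record
    { sparse = translate-sparse sparse c
    ; apart₃ = λ x h h′ → apart₃ (c + x) h (subst (λ z → Y z ≡ true) (+-swap c (3 + 3 * u) x) h′)
    }
    where open Independent I

  private
    next-diagonal : ∀ x j → x + j * (4 + 3 * u) + (4 + 3 * u) ≡ x + (1 + j) * (4 + 3 * u)
    next-diagonal x j = solve (x ∷ j ∷ u ∷ [])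
    -- With t = 1 + u the product is t (m - 2)(m + 1) = t (n - 3) = t n - m, so that many diagonal
    -- steps lead from x to x - m.
    around : ∀ x → 3 + 3 * u + (x + (1 + u) * (1 + 3 * u) * (4 + 3 * u)) + 0 * (7 + (15 * u + 9 * u * u)) ≡
        x + (1 + u) * (7 + (15 * u + 9 * u * u))
    around x = solve (u ∷ x ∷ [])

  no-independent : ∀ {Y} → Independent Y → ∀ x → Y x ≡ true → ⊥
  no-independent {Y} I x h =
      apart₃ _ (diagonals ((1 + u) * (1 + 3 * u))) (trans (respects (multiples 0 (1 + u) (around x))) h)
    where
    open Independent I
    diagonals : ∀ j → Y (x + j * (4 + 3 * u)) ≡ true
    diagonals zero    = subst (λ z → Y z ≡ true) (sym (+-identityʳ x)) h
    diagonals (suc j) = subst (λ z → Y z ≡ true) (next-diagonal x j)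
      (diagonal (translate I (x + j * (4 + 3 * u))) (subst (λ z → Y z ≡ true) (sym (+-identityʳ _))
          (diagonals j)))

  -- Sets with a single edge

  record OneEdge (Y : ℕ → Bool) : Set where
    field
      sparse : Sparse Y
      end₁   : Y 0 ≡ true
      end₂   : Y (3 + 3 * u) ≡ true
      only   : ∀ x → Y x ≡ true → Y (3 + 3 * u + x) ≡ true → x ≈ 0
    open Sparse sparse public

  private
    k₀+m : 3 + 3 * u + (4 + (12 * u + 9 * u * u)) ≡ 7 + (15 * u + 9 * u * u)
    k₀+m = solve (u ∷ [])
    wrap-row : ∀ k → 3 + 3 * u + (k + (4 + (12 * u + 9 * u * u))) ≡ k + (7 + (15 * u + 9 * u * u))
    wrap-row k = solve (u ∷ k ∷ [])
    wrap-2* : ∀ k l → 2 * k + (1 + 2 * l) ≡ 1 + 2 * (k + l)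
    wrap-2* k l = solve (k ∷ l ∷ [])
    edge-sum : ∀ l s D → 2 * (7 + (15 * u + 9 * u * u)) ≡ D + 1 → D ≡ 3 * l + s →
        (2 + (4 * u + 3 * u * u)) + (2 + (4 * u + 3 * u * u)) + 1 ≡ l + 2 → s ≡ 6 * u + 4
    edge-sum l s D p₁ p₂ p₃ =
        ≤-antisym (from 0 ((≤-reflexive (sym p₁)) ⊕ (≤-reflexive (sym p₂)) ⊕ 3 ⊛ (≤-reflexive p₃))
        (solve (u ∷ D ∷ l ∷ s ∷ [])))
      (from 0 ((≤-reflexive p₁) ⊕ (≤-reflexive p₂) ⊕ 3 ⊛ (≤-reflexive (sym p₃)))
          (solve (u ∷ D ∷ l ∷ s ∷ [])))
    top-2* : 2 * (7 + (15 * u + 9 * u * u)) ≡ 2 * (9 * u * u + 15 * u + 7)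
    top-2* = solve (u ∷ [])

  double-+ : ∀ a b → double a + suc (double b) ≡ suc (double (a + b))
  double-+ a b = trans (cong₂ (λ x y → x + suc y) (double≡2* a) (double≡2* b))
    (trans (wrap-2* a b) (cong suc (sym (double≡2* (a + b)))))

  module EdgeStrip (1≤u : 1 ≤ u) {Y : ℕ → Bool} (E : OneEdge Y) where

    open OneEdge E

    private
      apart₃ : ∀ k → 1 ≤ double k → k < n → Y k ≡ true → Y (3 + 3 * u + k) ≡ true → ⊥
      apart₃ k 1≤ k<n h h′ = positive (≈⇒≡ k<n (s≤s z≤n) (only k h h′)) 1≤
        where
        positive : ∀ {k} → k ≡ 0 → ¬ 1 ≤ double k
        positive refl ()

    open StripOf sparse 1 ≤-refl apart₃ public

    -- `k₀` is n - m; position `low` holds m + k₀, which is 0 once more.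
    k₀ low : ℕ
    k₀  = 4 + (12 * u + 9 * u * u)
    low = suc (double k₀)

    low-top : 5 + 6 * u + low ≡ top
    low-top = trans (double-window k₀) (cong double k₀+m)

    hit-top : H top
    hit-top = hit-even n (s≤s z≤n) ≤-refl (trans (respects (n≈0+ 0)) end₁)

    hit-low : H low
    hit-low = hit-odd k₀ (subst (low ≤_) low-top (m≤n+m low (5 + 6 * u)))
      (trans (cong Y k₀+m) (trans (respects (n≈0+ 0)) end₁))

    hit-1 : H 1
    hit-1 = hit-odd 0 (s≤s z≤n) (trans (cong Y (+-identityʳ (3 + 3 * u))) end₂)

    wrap : ∀ {z} → Even z → H z → z ≤ 5 + 6 * u → H (z + low)
    wrap {z} ev h z≤ with half-even ev
    ... | k , refl = subst H (sym (double-+ k k₀)) (hit-odd (k + k₀)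
      (subst (_≤ top) (double-+ k k₀) (subst (double k + low ≤_) low-top (+-monoˡ-≤ low z≤)))
      (trans (cong Y (wrap-row k)) (trans (respects (n≈0+ k)) (even-hit h))))

    abstract
      run-exists : ∃ λ gs → Run H 1 gs top
      run-exists = subst (λ b → ∃ λ gs → Run H 1 gs b) top≡+1
        (run-between hit? sep₁ sep₂ 1 (suc (double N)) hit-1 (subst H (sym top≡+1) hit-top))
        where
        top≡+1 : suc (double N) + 1 ≡ top
        top≡+1 = +-comm (suc (double N)) 1

    run₁ : Run H 1 (proj₁ run-exists) top
    run₁ = proj₂ run-exists

    -- The step from 0 to 1, of length 1, is cut away. It is 2 short of 3, so the rest carries 2
    -- more than the 2 (1 + 3 u) of an independent set.
    run₁-sum : sum (proj₁ run-exists) ≡ 6 * u + 4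
    run₁-sum = edge-sum (length gs) (sum gs) (span gs) (trans (sym (double≡2* n)) (run-end run₁)) refl
      (trans (cong (_+ 1) (sym count-top)) (trans (run-total run₁ ≤-refl hit-top)
          (cong (length gs +_) count-2)))
      where
      gs : List ℕ
      gs = proj₁ run-exists
      count-2 : count strip 2 ≡ 2
      count-2 = cong₂ (λ b c → ⟦ b ⟧ + ⟦ c ⟧) end₁ (proj₂ (proj₂ hit-1))

    open Strips.Edge 1≤u (even-double n) (blocked end₁) {low} (suc (even-double k₀)) hit-low low-top
    open Tight (trans (double≡2* n) top-2*) hit-1 wrap run₁ run₁-sum public

    private
      1+3u≤n : 1 + 3 * u ≤ 7 + (15 * u + 9 * u * u)
      1+3u≤n = from (6 + 12 * u + 9 * u * u) (z≤n {0}) (solve (u ∷ []))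
      2+6u≡ : 2 * (1 + 3 * u) ≡ 2 + 6 * u
      2+6u≡ = solve (u ∷ [])

    not-second-last : ¬ Y (1 + 3 * u) ≡ true
    not-second-last h = no-hit-before-end (subst H (trans (double≡2* (1 + 3 * u)) 2+6u≡)
      (hit-even (1 + 3 * u) (s≤s z≤n) (double-mono-≤ 1+3u≤n) h))

    module Gaps (not-2 : ¬ Y 2 ≡ true) where

      ¬hit-4 : ¬ H 4
      ¬hit-4 h = not-2 (even-hit {2} h)

      open First-Gap-5 (first-gap ¬hit-4) public

      third : Y 3 ≡ true
      third = even-hit {3} hit₆

      fifth : Y (3 + 3 * u + 4) ≡ true
      fifth = odd-hit {4} hit₉

      end : ℕ
      end = double (3 + (15 * u + 9 * u * u))

      end-top : 8 + end ≡ top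
      end-top = refl

      forced-run : Y (3 + (15 * u + 9 * u * u)) ≡ true → Run H 1 (blocks u (3 * u)) end
      forced-run h = Chain.forced end-top (hit-even (3 + (15 * u + 9 * u * u)) (s≤s z≤n) (m≤n+m end 8) h)
          ¬hit-4

  private
    square : ∀ m → m * m + 2 * (1 + m) ≡ 1 + (1 + m) * (1 + m)
    square m = solve (m ∷ [])
    reflect : ∀ s x m k → s + (k + m * (s + x)) + 0 * (1 + m) ≡ k + m * x + s * (1 + m)
    reflect s x m k = solve (s ∷ k ∷ m ∷ x ∷ [])
    reflect-end : ∀ a b m → a + b + m * b + 0 * (1 + m) ≡ a + b * (1 + m)
    reflect-end a b m = solve (a ∷ b ∷ m ∷ [])
    reflect-0 : ∀ x m k → k + m * (k + x) + 0 * (1 + m) ≡ m * x + k * (1 + m)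
    reflect-0 x m k = solve (k ∷ m ∷ x ∷ [])
    reflect-5 : 3 + 3 * u + (6 + (15 * u + 9 * u * u)) * (3 + 3 * u + 4) + 1 * (7 + (15 * u + 9 * u * u)) ≡
        3 + (15 * u + 9 * u * u) + (3 + 3 * u + 4) * (7 + (15 * u + 9 * u * u))
    reflect-5 = solve (u ∷ [])

  N*N≈1 : N * N ≈ 1
  N*N≈1 = multiples 2 (1 + N) (square N)

  -- The half-turn x ↦ 3 t − x exchanges the two ends of the edge.
  mirror : (ℕ → Bool) → ℕ → Bool
  mirror Y x = Y (3 + 3 * u + N * x)

  module Mirror {Y : ℕ → Bool} (E : OneEdge Y) where

    open OneEdge E

    reflected : ∀ s x → Y (3 + 3 * u + N * x) ≡ true → Y (s + (3 + 3 * u + N * (s + x))) ≡ true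
    reflected s x h = trans (respects (multiples 0 s (reflect s x N (3 + 3 * u)))) h

    mirror-at : ∀ a b → 3 + 3 * u ≡ a + b → mirror Y b ≡ Y a
    mirror-at a b eq = trans (cong (λ k → Y (k + N * b)) eq) (respects (multiples 0 b (reflect-end a b N)))

    mirror-edge : OneEdge (mirror Y)
    mirror-edge = record
      { sparse = record
        { respects = λ eq → respects (+-cong-≈ (3 + 3 * u) (*-cong-≈ N eq))
        ; apart₁   = λ x h h′ → apart₁ _ h′ (reflected 1 x h)
        ; apart₂   = λ x h h′ → apart₂ _ h′ (reflected (2 + 3 * u) x h)
        ; size     = trans (count-affine respects (3 + 3 * u) N N N*N≈1) size
        }
      ; end₁ = trans (mirror-at (3 + 3 * u) 0 (sym (+-identityʳ _))) end₂
      ; end₂ = trans (mirror-at 0 (3 + 3 * u) refl) end₁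
      ; only = λ x h h′ → ≈-trans (≈-sym (inverse-≈ N N x N*N≈1)) (≈-trans (*-cong-≈ N
          (≈-trans (≈-sym (multiples 0 (3 + 3 * u) (reflect-0 x N (3 + 3 * u))))
              (only _ h′ (reflected (3 + 3 * u) x h))))
          (≡⇒≈ (*-zeroʳ N)))
      }

    -- m - (m + 4) is -4, that is n - 4.
    mirror-fifth : mirror Y (3 + 3 * u + 4) ≡ Y (3 + (15 * u + 9 * u * u))
    mirror-fifth = respects (multiples 1 (3 + 3 * u + 4) reflect-5)

  module Unique (1≤u : 1 ≤ u) {Y : ℕ → Bool} (E : OneEdge Y) where

    open OneEdge E
    open Mirror E
    module S  = EdgeStrip 1≤u E
    module S′ = EdgeStrip 1≤u mirror-edge

    private
      split-2 : 3 + 3 * u ≡ 2 + (1 + 3 * u)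
      split-2 = solve (u ∷ [])
      split-2′ : 3 + 3 * u ≡ (1 + 3 * u) + 2
      split-2′ = solve (u ∷ [])
      split-3 : 3 + 3 * u ≡ 3 * u + 3
      split-3 = solve (u ∷ [])
      second-last : 2 + 3 * u + (5 + (15 * u + 9 * u * u)) + 0 * (7 + (15 * u + 9 * u * u)) ≡ 3 * u + 1 *
          (7 + (15 * u + 9 * u * u))
      second-last = solve (u ∷ [])

    not-2 : ¬ Y 2 ≡ true
    not-2 h = S′.not-second-last (trans (mirror-at 2 (1 + 3 * u) split-2) h)

    not-2′ : ¬ mirror Y 2 ≡ true
    not-2′ h = S.not-second-last (trans (sym (mirror-at (1 + 3 * u) 2 split-2′)) h)

    module G  = S.Gaps not-2
    module G′ = S′.Gaps not-2′

    fourth-last : Y (3 + (15 * u + 9 * u * u)) ≡ true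
    fourth-last = trans (sym mirror-fifth) G′.fifth

    run : Run S.H 1 (blocks u (3 * u)) G.end
    run = G.forced-run fourth-last

    -- n - 3 is adjacent to n - 4 and n - 1 to 0. The sum of n - 2 and m - 1 is m - 3 modulo n, the
    -- mirror image of 3, which is present.
    no-last : ∀ o → o < 3 → ¬ Y (o + (4 + (15 * u + 9 * u * u))) ≡ true
    no-last 0 _ h = apart₁ _ fourth-last h
    no-last 1 _ h = apart₂ _ h (trans (respects (multiples 0 1 second-last))
      (trans (sym (mirror-at (3 * u) 3 split-3)) G′.third))
    no-last 2 _ h = apart₁ _ h (trans (respects (S.n≈0+ 0)) end₁)
    no-last (suc (suc (suc _))) (s≤s (s≤s (s≤s ())))

  -- Both sets give the same run of blocks, which fixes them up to n - 4; the last three residues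
  -- are empty.
  agree : 1 ≤ u → ∀ {Y Z} → OneEdge Y → OneEdge Z → ∀ x → x < n → Y x ≡ true → Z x ≡ true
  agree 1≤u E F zero _ _ = OneEdge.end₁ F
  agree 1≤u {Y} {Z} E F (suc x) x<n h = cases (suc x ≤? 3 + (15 * u + 9 * u * u))
    where
    module UE = Unique 1≤u E
    module UF = Unique 1≤u F
    cases : Dec (suc x ≤ 3 + (15 * u + 9 * u * u)) → Z (suc x) ≡ true
    cases (yes le) = UF.S.even-hit {suc x}
        (subst UF.S.H pos (run-transport UE.run UF.run UF.S.hit-1 (suc (double x))
      (subst (_≤ UE.G.end) (sym pos) (double-mono-≤ le))
      (subst UE.S.H (sym pos) (UE.S.hit-even (suc x) (s≤s z≤n) (double-mono-≤ (<⇒≤ x<n)) h))))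
      where
      pos : suc (double x) + 1 ≡ double (suc x)
      pos = +-comm (suc (double x)) 1
    cases (no ¬le) = last (m≤n⇒∃[o]m+o≡n (≰⇒> ¬le))
      where
      last : (∃ λ o → 4 + (15 * u + 9 * u * u) + o ≡ suc x) → Z (suc x) ≡ true
      last (o , eq) = ⊥-elim (UE.no-last o (+-cancelˡ-< (4 + (15 * u + 9 * u * u)) o 3
        (subst (_< 4 + (15 * u + 9 * u * u) + 3) (sym eq)
            (subst (suc x <_) (+-comm 3 (4 + (15 * u + 9 * u * u))) x<n)))
        (subst (λ z → Y z ≡ true) (trans (sym eq) (+-comm _ o)) h))

-- The extremal set and its verification

count-+ : ∀ f a b → count f (a + b) ≡ count f a + count (λ x → f (a + x)) b
count-+ f a zero    = trans (cong (count f) (+-identityʳ a)) (sym (+-identityʳ _))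
count-+ f a (suc b) = trans (cong (count f) (+-suc a b))
  (trans (cong (_+ ⟦ f (a + b) ⟧) (count-+ f a b)) (+-assoc (count f a) _ _))

count-cong : ∀ {f g} → (∀ x → f x ≡ g x) → ∀ k → count f k ≡ count g k
count-cong p zero    = refl
count-cong p (suc k) = cong₂ (λ c b → c + ⟦ b ⟧) (count-cong p k) (p k)

count-witness : ∀ f k {c} → count f k ≡ suc c → ∃ λ x → f x ≡ true
count-witness f (suc k) eq with f k in fk
... | true  = k , fk
... | false = count-witness f k (trans (sym (+-identityʳ _)) eq)

multiple-of-3? : ℕ → Bool
multiple-of-3? 0 = true
multiple-of-3? 1 = false
multiple-of-3? 2 = false
multiple-of-3? (suc (suc (suc k))) = multiple-of-3? k

multiple-of-3-sound : ∀ k → multiple-of-3? k ≡ true → ∃ λ j → k ≡ j * 3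
multiple-of-3-sound 0 _ = 0 , refl
multiple-of-3-sound (suc (suc (suc k))) h with multiple-of-3-sound k h
... | j , refl = suc j , refl

multiple-of-3-complete : ∀ j → multiple-of-3? (j * 3) ≡ true
multiple-of-3-complete zero    = refl
multiple-of-3-complete (suc j) = multiple-of-3-complete j

count-multiples-of-3 : ∀ j → count multiple-of-3? (j * 3 + 1) ≡ j + 1
count-multiples-of-3 zero    = refl
count-multiples-of-3 (suc j) = begin
  count f (3 + k)                            ≡⟨ count-front f (2 + k) ⟩
  1 + count (f ∘ (1 +_)) (2 + k)             ≡⟨ cong (1 +_) (count-front (f ∘ (1 +_)) (1 + k)) ⟩
  1 + count (f ∘ (2 +_)) (1 + k)             ≡⟨ cong (1 +_) (count-front (f ∘ (2 +_)) k) ⟩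
  1 + count f k                              ≡⟨ cong (1 +_) (count-multiples-of-3 j) ⟩
  suc j + 1                                  ∎
  where
  open ≡-Reasoning
  f : ℕ → Bool
  f = multiple-of-3?
  k : ℕ
  k = j * 3 + 1

residue? : ℕ → Bool
residue? 0 = false
residue? 1 = false
residue? 2 = false
residue? (suc (suc (suc k))) = multiple-of-3? k

residue-sound : ∀ k → residue? k ≡ true → ∃ λ j → k ≡ 3 + j * 3
residue-sound (suc (suc (suc k))) h with multiple-of-3-sound k h
... | j , refl = j , refl

module Pattern (u : ℕ) where

  open Torus u

  w : ℕ
  w = 4 + 3 * u

  member? : ℕ → Bool
  member? zero    = true
  member? (suc y) = residue? (suc y % w)

  pattern₀ : ℕ → Bool
  pattern₀ x = member? (x % n)

  data Member : ℕ → Set where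
    origin : Member 0
    other  : ∀ j k → j ≤ u → Member (k * w + (3 + j * 3))

  private
    residue≤ : ∀ j → 3 + j * 3 < 4 + 3 * u → 3 * j ≤ 3 * u
    residue≤ j p₁ = from 0 p₁ (solve (j ∷ u ∷ []))
    residue< : ∀ j → j ≤ u → 3 + j * 3 < 4 + 3 * u
    residue< j p₁ = from 0 (3 ⊛ p₁) (solve (j ∷ u ∷ []))

  member-sound : ∀ y → member? y ≡ true → Member y
  member-sound zero    _ = origin
  member-sound (suc y) h with residue-sound (suc y % w) h
  ... | j , eq = subst Member
      (sym (trans (m≡m%n+[m/n]*n (suc y) w) (trans (cong (_+ suc y / w * w) eq) (+-comm (3 + j * 3) _))))
    (other j (suc y / w) (*-cancelˡ-≤ 3 (residue≤ j (subst (_< w) eq (m%n<n (suc y) w)))))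

  respects₀ : Respects pattern₀
  respects₀ eq = cong member? (≈⇒%≡ eq)

  private
    1≢0 : ∀ i j → 1 + i * 3 ≡ j * 3 → ⊥
    1≢0 i j eq with mod-unique 3 i j {1} {0} (s≤s (s≤s z≤n)) (s≤s z≤n)
        (trans (+-comm (i * 3) 1) (trans eq (sym (+-identityʳ _))))
    ... | _ , ()

    2≢0 : ∀ i j → 2 + i * 3 ≡ j * 3 → ⊥
    2≢0 i j eq with mod-unique 3 i j {2} {0} (s≤s (s≤s (s≤s z≤n))) (s≤s z≤n)
        (trans (+-comm (i * 3) 2) (trans eq (sym (+-identityʳ _))))
    ... | _ , ()

  -- Sums s + a, for a generator s and a member a ≠ 0, by their remainder modulo w.
  data Off : ℕ → ℕ → Set where
    zero-rest : ∀ k → Off (suc k) 0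
    one-rest  : ∀ k j → j < u → Off k (1 + (1 + j) * 3)
    one-rest′ : ∀ k j → j ≤ u → Off (suc k) (1 + j * 3)
    two-rest  : ∀ k j → j ≤ u → Off (suc k) (2 + j * 3)

  -- The members b and b + n by their remainder modulo w.
  data On : ℕ → ℕ → Set where
    inside : ∀ k i → i ≤ u → On k (3 + i * 3)
    carry  : ∀ k → On (2 + 3 * u + k) 2

  private
    off-bound₁ : ∀ j → 1 + j ≤ u → 1 + (1 + (1 + j) * 3) ≤ 4 + 3 * u
    off-bound₁ j p₁ = from 2 (3 ⊛ p₁) (solve (j ∷ u ∷ []))
    off-bound₂ : ∀ j → j ≤ u → 1 + (1 + j * 3) ≤ 4 + 3 * u
    off-bound₂ j p₁ = from 2 (3 ⊛ p₁) (solve (j ∷ u ∷ []))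
    off-bound₃ : ∀ j → j ≤ u → 1 + (2 + j * 3) ≤ 4 + 3 * u
    off-bound₃ j p₁ = from 1 (3 ⊛ p₁) (solve (j ∷ u ∷ []))

    off-< : ∀ {k ρ} → Off k ρ → ρ < w
    off-< (zero-rest _)      = s≤s z≤n
    off-< (one-rest _ j j<)  = off-bound₁ j j<
    off-< (one-rest′ _ j j≤) = off-bound₂ j j≤
    off-< (two-rest _ j j≤)  = off-bound₃ j j≤

    on-< : ∀ {k ρ} → On k ρ → ρ < w
    on-< (inside _ i i≤) = residue< i i≤
    on-< (carry _)       = s≤s (s≤s (s≤s z≤n))

  -- Remainders modulo 3 separate the two kinds, except for the remainder 2 of a carry. There the
  -- quotient is at least 2 + 3 u, beyond the bound on `k`.
  off≢on : ∀ {k ρ k′ ρ′} → Off k ρ → On k′ ρ′ → k ≤ 1 + 3 * u → k * w + ρ ≡ k′ * w + ρ′ → ⊥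
  off≢on {k} {ρ} {k′} off on k≤ eq with mod-unique w k k′ (off-< off) (on-< on) eq
  ... | k≡ , ρ≡ = cases off on k≡ ρ≡ k≤
    where
    cases : ∀ {k ρ k′ ρ′} → Off k ρ → On k′ ρ′ → k ≡ k′ → ρ ≡ ρ′ → k ≤ 1 + 3 * u → ⊥
    cases _                 (carry k)      refl _  k≤ = <⇒≱ (m≤m+n (2 + 3 * u) k) k≤
    cases (one-rest _ j _)  (inside _ i _) _    eq _  = 1≢0 (1 + j) (1 + i) eq
    cases (one-rest′ _ j _) (inside _ i _) _    eq _  = 1≢0 j (1 + i) eq
    cases (two-rest _ j _)  (inside _ i _) _    eq _  = 2≢0 j (1 + i) eq

  data Generator : ℕ → Set where
    g₁ : Generator 1
    g₂ : Generator (2 + 3 * u)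
    g₃ : Generator (3 + 3 * u)

  private
    sum₁ : ∀ j k → 1 + (k * (4 + 3 * u) + (3 + j * 3)) ≡ k * (4 + 3 * u) + (1 + (1 + j) * 3)
    sum₁ j k = solve (k ∷ u ∷ j ∷ [])
    sum₁′ : ∀ k → 1 + (k * (4 + 3 * u) + (3 + u * 3)) ≡ (1 + k) * (4 + 3 * u) + 0
    sum₁′ k = solve (k ∷ u ∷ [])
    sum₂ : ∀ j k → 2 + 3 * u + (k * (4 + 3 * u) + (3 + j * 3)) ≡ (1 + k) * (4 + 3 * u) + (1 + j * 3)
    sum₂ j k = solve (u ∷ k ∷ j ∷ [])
    sum₃ : ∀ j k → 3 + 3 * u + (k * (4 + 3 * u) + (3 + j * 3)) ≡ (1 + k) * (4 + 3 * u) + (2 + j * 3)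
    sum₃ j k = solve (u ∷ k ∷ j ∷ [])
    -- n is (1 + 3 u) w + 3: adding n moves 1 + 3 u rows on and 3 places along, which keeps the
    -- remainder a nonzero multiple of 3 except at the end of a row.
    n-on : 0 + (7 + (15 * u + 9 * u * u)) ≡ (1 + 3 * u) * (4 + 3 * u) + (3 + 0 * 3)
    n-on = solve (u ∷ [])
    n-on-other : ∀ j k → k * (4 + 3 * u) + (3 + j * 3) + (7 + (15 * u + 9 * u * u)) ≡ (1 + 3 * u + k) *
        (4 + 3 * u) + (3 + (1 + j) * 3)
    n-on-other j k = solve (k ∷ u ∷ j ∷ [])
    n-on-carry : ∀ k → k * (4 + 3 * u) + (3 + u * 3) + (7 + (15 * u + 9 * u * u)) ≡ (2 + 3 * u + k) *
        (4 + 3 * u) + 2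
    n-on-carry k = solve (k ∷ u ∷ [])
    few-rows : ∀ j l → (1 + 3 * u + l) * (4 + 3 * u) + (3 + j * 3) < 7 + (15 * u + 9 * u * u) → ⊥
    few-rows j l p₁ = n≮0 {0} (from (3 * j + 4 * l + 3 * l * u) p₁ (solve (u ∷ l ∷ j ∷ [])))
    gen<n : 3 + 3 * u < 7 + (15 * u + 9 * u * u)
    gen<n = from (3 + 12 * u + 9 * u * u) (z≤n {0}) (solve (u ∷ []))
    gen₂≡ : ∀ j → 2 + 3 * u ≡ 3 + j * 3 → 2 + u * 3 ≡ (1 + j) * 3
    gen₂≡ j p₁ = ≤-antisym (from 0 (≤-reflexive p₁) (solve (u ∷ j ∷ [])))
      (from 0 (≤-reflexive (sym p₁)) (solve (u ∷ j ∷ [])))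
    gen₂< : 2 + 3 * u < 4 + 3 * u
    gen₂< = from 1 (z≤n {0}) (solve (u ∷ []))

  gen-≤ : ∀ {s} → Generator s → s ≤ 3 + 3 * u
  gen-≤ g₁ = s≤s z≤n
  gen-≤ g₂ = n≤1+n _
  gen-≤ g₃ = ≤-refl

  gen-< : ∀ {s} → Generator s → s < n
  gen-< g = ≤-<-trans (gen-≤ g) gen<n

  private
    rows-≤ : ∀ j k → k * w + (3 + j * 3) < n → k ≤ 3 * u
    rows-≤ j k lt with k ≤? 3 * u
    ... | yes p = p
    ... | no ¬p with m≤n⇒∃[o]m+o≡n (≰⇒> ¬p)
    ...   | l , refl = ⊥-elim (few-rows j l lt)

    position : ℕ → (ℕ → ℕ → Set) → Set
    position y P = ∃ λ k → ∃ λ ρ → P k ρ × y ≡ k * w + ρ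

    sum-off : ∀ {s} → Generator s → ∀ j k → j ≤ u → k ≤ 3 * u →
              ∃ λ l → ∃ λ ρ → Off l ρ × l ≤ 1 + 3 * u × s + (k * w + (3 + j * 3)) ≡ l * w + ρ
    sum-off g₁ j k j≤u k≤ with m≤n⇒m<n∨m≡n j≤u
    ... | inj₁ j<u  = k , _ , one-rest k j j<u , m≤n⇒m≤1+n k≤ , sum₁ j k
    ... | inj₂ refl = suc k , _ , zero-rest k , s≤s k≤ , sum₁′ k
    sum-off g₂ j k j≤u k≤ = suc k , _ , one-rest′ k j j≤u , s≤s k≤ , sum₂ j k
    sum-off g₃ j k j≤u k≤ = suc k , _ , two-rest k j j≤u , s≤s k≤ , sum₃ j k

    wrapped-on : ∀ {b} → Member b → position (b + n) On
    wrapped-on origin = 1 + 3 * u , _ , inside _ 0 z≤n , n-on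
    wrapped-on (other j k j≤u) with m≤n⇒m<n∨m≡n j≤u
    ... | inj₁ j<u  = 1 + 3 * u + k , _ , inside _ (1 + j) j<u , n-on-other j k
    ... | inj₂ refl = 2 + 3 * u + k , _ , carry k , n-on-carry k

  members-apart : ∀ {s a b} → Generator s → Member a → Member b → a < n → s + a ≡ b ⊎ s + a ≡ b + n →
      a ≡ 0 × s ≡ 3 + 3 * u
  members-apart {s} {b = b} g origin mb _ (inj₂ eq) =
    ⊥-elim (<⇒≱ (gen-< g) (subst (n ≤_) (sym (trans (sym (+-identityʳ s)) eq)) (m≤n+m n b)))
  members-apart {s} g (other j k j≤u) mb lt (inj₂ eq) with sum-off g j k j≤u (rows-≤ j k lt) | wrapped-on mb
  ... | _ , _ , off , l≤ , p | _ , _ , on , q = ⊥-elim (off≢on off on l≤ (trans (sym p) (trans eq q)))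
  members-apart {s} g (other j k j≤u) (other j′ k′ j′≤u) lt (inj₁ eq) with sum-off g j k j≤u (rows-≤ j k lt)
  ... | _ , _ , off , l≤ , p = ⊥-elim (off≢on off (inside k′ j′ j′≤u) l≤ (trans (sym p) eq))
  members-apart {s} g (other j k j≤u) origin lt (inj₁ eq) =
    ⊥-elim (m+1+n≢0 (s + k * w) (trans (+-assoc s (k * w) _) eq))
  members-apart g₁ origin origin _ (inj₁ ())
  members-apart g₂ origin origin _ (inj₁ ())
  members-apart g₃ origin mb _ (inj₁ eq) = refl , refl
  members-apart g₁ origin (other j k _) _ (inj₁ eq) =
    ⊥-elim (<⇒≱ {1} {3} (s≤s (s≤s z≤n))
        (subst (3 ≤_) (sym eq) (≤-trans (m≤m+n 3 (j * 3)) (m≤n+m _ (k * w)))))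
  members-apart g₂ origin (other j k j≤u) _ (inj₁ eq) with mod-unique w 0 k gen₂< (residue< j j≤u)
      (trans (sym (+-identityʳ _)) eq)
  ... | _ , ρ≡ = ⊥-elim (2≢0 u (1 + j) (gen₂≡ j ρ≡))

  pattern-apart : ∀ {s} → Generator s → ∀ x → pattern₀ x ≡ true → pattern₀ (s + x) ≡ true →
      x ≈ 0 × s ≡ 3 + 3 * u
  pattern-apart {s} g x h h′ = ≈-trans (≈-sym (%-≈ x)) (≡⇒≈ (proj₁ both)) , proj₂ both
    where
    both : x % n ≡ 0 × s ≡ 3 + 3 * u
    both = members-apart g (member-sound (x % n) h) (member-sound ((s + x) % n) h′) (m%n<n x n)
      (add-once (gen-< g) (m%n<n x n) (m%n<n (s + x) n)
          (≈-trans (+-cong-≈ s (%-≈ x)) (≈-sym (%-≈ (s + x)))))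

  count-cong-< : ∀ {f g} k → (∀ x → x < k → f x ≡ g x) → count f k ≡ count g k
  count-cong-< zero    p = refl
  count-cong-< (suc k) p = cong₂ (λ c b → c + ⟦ b ⟧) (count-cong-< k (λ x x<k → p x (m<n⇒m<1+n x<k)))
      (p k (n<1+n k))

  private
    row? : ℕ → Bool
    row? y = residue? (y % w)

    1+3u≡ : 1 + 3 * u ≡ u * 3 + 1
    1+3u≡ = solve (u ∷ [])
    n≡rows : 7 + (15 * u + 9 * u * u) ≡ (1 + 3 * u) * (4 + 3 * u) + 3
    n≡rows = solve (u ∷ [])
    size≡ : 1 + ((1 + 3 * u) * (u + 1) + 0) ≡ 2 + (4 * u + 3 * u * u)
    size≡ = solve (u ∷ [])

    count-row : count row? w ≡ u + 1
    count-row = begin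
      count row? w                         ≡⟨ count-cong-< w (λ x x<w → cong residue? (m<n⇒m%n≡m x<w)) ⟩
      count residue? (4 + 3 * u)           ≡⟨ count-front residue? (3 + 3 * u) ⟩
      count (residue? ∘ (1 +_)) (3 + 3 * u) ≡⟨ count-front (residue? ∘ (1 +_)) (2 + 3 * u) ⟩
      count (residue? ∘ (2 +_)) (2 + 3 * u) ≡⟨ count-front (residue? ∘ (2 +_)) (1 + 3 * u) ⟩
      count multiple-of-3? (1 + 3 * u)     ≡⟨ cong (count multiple-of-3?) 1+3u≡ ⟩
      count multiple-of-3? (u * 3 + 1)     ≡⟨ count-multiples-of-3 u ⟩
      u + 1                                ∎
      where open ≡-Reasoning

    count-rows : ∀ k → count row? (k * w + 3) ≡ k * (u + 1) + 0
    count-rows zero = trans (count-cong-< 3 λ x x<3 →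
        cong residue? (m<n⇒m%n≡m (≤-trans x<3 (m≤m+n 3 (1 + 3 * u))))) refl
    count-rows (suc k) = begin
      count row? (w + k * w + 3)                      ≡⟨ cong (count row?) (+-assoc w (k * w) 3) ⟩
      count row? (w + (k * w + 3))                    ≡⟨ count-+ row? w (k * w + 3) ⟩
      count row? w + count (λ x → row? (w + x)) (k * w + 3)
        ≡⟨ cong₂ _+_ count-row (trans
            (count-cong (λ x → cong residue? (trans (cong (_% w) (+-comm w x)) ([m+n]%n≡m%n x w)))
            (k * w + 3)) (count-rows k)) ⟩
      u + 1 + (k * (u + 1) + 0)                       ≡⟨ sym (+-assoc (u + 1) _ 0) ⟩
      suc k * (u + 1) + 0                             ∎
      where open ≡-Reasoning

  -- The origin counts 1, each of the 1 + 3 u full rows of width `w` counts u + 1, and the three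
  -- places left over count nothing.
  pattern-size : count pattern₀ n ≡ r
  pattern-size = begin
    count pattern₀ n                  ≡⟨ count-cong-< n (λ x x<n → cong member? (m<n⇒m%n≡m x<n)) ⟩
    count member? (suc N)             ≡⟨ count-front member? N ⟩
    1 + count (row? ∘ (1 +_)) N       ≡⟨ cong (1 +_) (sym (count-front row? N)) ⟩
    1 + count row? n                  ≡⟨ cong (λ k → 1 + count row? k) n≡rows ⟩
    1 + count row? ((1 + 3 * u) * w + 3) ≡⟨ cong (1 +_) (count-rows (1 + 3 * u)) ⟩
    1 + ((1 + 3 * u) * (u + 1) + 0)   ≡⟨ size≡ ⟩
    r                                 ∎
    where open ≡-Reasoning

  private
    1≢m : 1 ≡ 3 + 3 * u → ⊥
    1≢m p₁ = n≮0 {0} (from (1 + 3 * u) (≤-reflexive (sym p₁)) (solve (u ∷ [])))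
    m-1≢m : 2 + 3 * u ≡ 3 + 3 * u → ⊥
    m-1≢m p₁ = n≮0 {0} (from 0 (≤-reflexive (sym p₁)) (solve (u ∷ [])))
    m<w : 3 + 3 * u < 4 + 3 * u
    m<w = from 0 (z≤n {0}) (solve (u ∷ []))

  pattern-edge : OneEdge pattern₀
  pattern-edge = record
    { sparse = record
      { respects = respects₀
      ; apart₁   = λ x h h′ → 1≢m (proj₂ (pattern-apart g₁ x h h′))
      ; apart₂   = λ x h h′ → m-1≢m (proj₂ (pattern-apart g₂ x h h′))
      ; size     = pattern-size
      }
    ; end₁ = refl
    ; end₂ = trans (cong member? (m<n⇒m%n≡m gen<n)) (trans (cong residue? (m<n⇒m%n≡m m<w))
        (trans (cong multiple-of-3? (*-comm 3 u)) (multiple-of-3-complete u)))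
    ; only = λ x h h′ → proj₁ (pattern-apart g₃ x h h′)
    }

∣∣≡∑ : ∀ {k} (K : Subset k) → ∣ K ∣ ≡ ∑ (λ i → ⟦ lookup K i ⟧)
∣∣≡∑ Vec.[]            = refl
∣∣≡∑ (true  Vec.∷ K) = cong (1 +_) (∣∣≡∑ K)
∣∣≡∑ (false Vec.∷ K) = ∣∣≡∑ K

-- Cliques of the Cayley complement

module Graphs (u : ℕ) where

  open Torus u
  open Pattern u

  S : List ℕ
  S = 1 ∷ (2 + 3 * u) ∷ (3 + 3 * u) ∷ []

  C G : Graph n
  C = Cayley n S
  G = Complement C

  generator-∈ : ∀ {s} → Generator s → s ∈ₗ S
  generator-∈ g₁ = here refl
  generator-∈ g₂ = there (here refl)
  generator-∈ g₃ = there (there (here refl))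

  ∈-generator : ∀ {s} → s ∈ₗ S → Generator s
  ∈-generator (here refl)                 = g₁
  ∈-generator (there (here refl))         = g₂
  ∈-generator (there (there (here refl))) = g₃

  -- Adjacency read on arbitrary representatives, so that affine maps apply without reduction modulo
  -- n.
  Near : ℕ → ℕ → Set
  Near x y = ∃ λ s → Generator s × (s + x ≈ y ⊎ s + y ≈ x)

  near-sym : ∀ {x y} → Near x y → Near y x
  near-sym (s , g , inj₁ p) = s , g , inj₂ p
  near-sym (s , g , inj₂ p) = s , g , inj₁ p

  near-resp : ∀ {x x′ y y′} → x ≈ x′ → y ≈ y′ → Near x y → Near x′ y′
  near-resp x≈ y≈ (s , g , inj₁ p) = s , g , inj₁ (≈-trans (+-cong-≈ s (≈-sym x≈)) (≈-trans p y≈))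
  near-resp x≈ y≈ (s , g , inj₂ p) = s , g , inj₂ (≈-trans (+-cong-≈ s (≈-sym y≈)) (≈-trans p x≈))

  private
    %≈ : ∀ {x y} s → (x + s) % n ≡ y → s + x ≈ y
    %≈ {x} s eq = ≈-trans (≡⇒≈ (+-comm s x)) (≈-trans (≈-sym (%-≈ _)) (≡⇒≈ eq))

    ≈% : ∀ {x} s (y : Fin n) → s + x ≈ toℕ y → (x + s) % n ≡ toℕ y
    ≈% {x} s y eq = ≈⇒≡ (m%n<n (x + s) n) (toℕ<n y) (≈-trans (%-≈ _) (≈-trans (≡⇒≈ (+-comm x s)) eq))

  cayley⇒near : ∀ x y → C x y → Near (toℕ x) (toℕ y)
  cayley⇒near x y (_ , s , s∈ , inj₁ eq) = s , ∈-generator s∈ , inj₂ (%≈ s eq)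
  cayley⇒near x y (_ , s , s∈ , inj₂ eq) = s , ∈-generator s∈ , inj₁ (%≈ s eq)

  near⇒cayley : ∀ x y → x ≢ y → Near (toℕ x) (toℕ y) → C x y
  near⇒cayley x y x≢y (s , g , inj₁ p) = x≢y , s , generator-∈ g , inj₂ (≈% s y p)
  near⇒cayley x y x≢y (s , g , inj₂ p) = x≢y , s , generator-∈ g , inj₁ (≈% s x p)

  cayley? : ∀ x y → x ≢ y → Dec (C x y)
  cayley? x y x≢y = map′ (λ a → x≢y , _ , proj₁ (proj₂ (find a)) , proj₂ (proj₂ (find a)))
      (λ (_ , s , s∈ , p) → lose s∈ p)
    (any? (λ s → ((toℕ y + s) % n ≟ toℕ x) ⊎-dec ((toℕ x + s) % n ≟ toℕ y)) S)

  -- Automorphisms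

  private
    translate-eq : ∀ c s x → s + (c + x) ≡ c + (s + x)
    translate-eq c s x = solve (s ∷ c ∷ x ∷ [])
    m*m : (3 + 3 * u) * (3 + 3 * u) + 0 * (7 + (15 * u + 9 * u * u)) ≡ 2 + 3 * u + 1 *
        (7 + (15 * u + 9 * u * u))
    m*m = solve (u ∷ [])
    m*[m-1] : (3 + 3 * u) * (2 + 3 * u) ≡ 6 + (15 * u + 9 * u * u)
    m*[m-1] = solve (u ∷ [])
    m*1 : ∀ x → 3 + 3 * u + (3 + 3 * u) * x ≡ (3 + 3 * u) * (1 + x)
    m*1 x = solve (u ∷ x ∷ [])
    m*2 : ∀ x → 1 + (3 + 3 * u) * (2 + 3 * u + x) + 0 * (7 + (15 * u + 9 * u * u)) ≡ (3 + 3 * u) * x + 1 *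
        (7 + (15 * u + 9 * u * u))
    m*2 x = solve (u ∷ x ∷ [])
    m*3 : ∀ x → 2 + 3 * u + (3 + 3 * u) * x + 1 * (7 + (15 * u + 9 * u * u)) ≡ (3 + 3 * u) *
        (3 + 3 * u + x) + 0 * (7 + (15 * u + 9 * u * u))
    m*3 x = solve (u ∷ x ∷ [])
    N*s : ∀ s m x → s + m * (s + x) + 0 * (1 + m) ≡ m * x + s * (1 + m)
    N*s s m x = solve (s ∷ m ∷ x ∷ [])

  near-translate : ∀ c {x y} → Near x y → Near (c + x) (c + y)
  near-translate c {x} {y} (s , g , inj₁ p) =
      s , g , inj₁ (≈-trans (≡⇒≈ (translate-eq c s x)) (+-cong-≈ c p))
  near-translate c {x} {y} (s , g , inj₂ p) =
      s , g , inj₂ (≈-trans (≡⇒≈ (translate-eq c s y)) (+-cong-≈ c p))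

  -- Multiplication by 3 t permutes ± 1, ± (3 t − 1), ± 3 t cyclically, as (3 t)² ≡ 3 t − 1.
  near-m : ∀ {x y} → Near x y → Near ((3 + 3 * u) * x) ((3 + 3 * u) * y)
  near-m {x} {y} (s , g , inj₁ p) = forward g p
    where
    forward : ∀ {s x y} → Generator s → s + x ≈ y → Near ((3 + 3 * u) * x) ((3 + 3 * u) * y)
    forward {x = x} g₁ p = _ , g₃ , inj₁ (≈-trans (≡⇒≈ (m*1 x)) (*-cong-≈ (3 + 3 * u) p))
    forward {x = x} g₂ p = _ , g₁ , inj₂ (≈-trans (+-cong-≈ 1 (*-cong-≈ (3 + 3 * u) (≈-sym p)))
        (multiples 0 1 (m*2 x)))
    forward {x = x} g₃ p = _ , g₂ , inj₁ (≈-trans (multiples 1 0 (m*3 x)) (*-cong-≈ (3 + 3 * u) p))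
  near-m (s , g , inj₂ p) = near-sym (near-m (s , g , inj₁ p))

  near-N : ∀ {x y} → Near x y → Near (N * x) (N * y)
  near-N {x} {y} (s , g , inj₁ p) =
      s , g , inj₂ (≈-trans (+-cong-≈ s (*-cong-≈ N (≈-sym p))) (multiples 0 s (N*s s N x)))
  near-N (s , g , inj₂ p) = near-sym (near-N (s , g , inj₁ p))

  record Automorphism : Set where
    field
      g g′     : ℕ
      inverse  : g * g′ ≈ 1
      near     : ∀ {x y} → Near x y → Near (g * x) (g * y)
      near′    : ∀ {x y} → Near x y → Near (g′ * x) (g′ * y)

  inverted : Automorphism → Automorphism
  inverted α = record { g = g′ ; g′ = g ; inverse = ≈-trans (≡⇒≈ (*-comm g′ g)) inverse ; near =
      near′ ; near′ = near }
    where open Automorphism α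

  identity : Automorphism
  identity = record { g = 1 ; g′ = 1 ; inverse = ≡⇒≈ refl ; near = same ; near′ = same }
    where
    same : ∀ {x y} → Near x y → Near (1 * x) (1 * y)
    same {x} {y} = near-resp (≡⇒≈ (sym (*-identityˡ x))) (≡⇒≈ (sym (*-identityˡ y)))

  -- As m (m - 1) is -1, the inverse of m is -(m - 1), which equals -m²: two further rotations and a
  -- negation, so it keeps adjacency too.
  rotation : Automorphism
  rotation = record
    { g = 3 + 3 * u ; g′ = N * (2 + 3 * u)
    ; inverse = ≈-trans (≡⇒≈ rearrange) (≈-trans (*-cong-≈ N (≡⇒≈ m*[m-1])) N*N≈1)
    ; near = near-m ; near′ = λ {x} {y} p → near-resp (square x) (square y) (near-N (near-m (near-m p)))
    }
    where
    rearrange : (3 + 3 * u) * (N * (2 + 3 * u)) ≡ N * ((3 + 3 * u) * (2 + 3 * u))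
    rearrange = trans (sym (*-assoc (3 + 3 * u) N (2 + 3 * u)))
        (trans (cong (_* (2 + 3 * u)) (*-comm (3 + 3 * u) N)) (*-assoc N (3 + 3 * u) (2 + 3 * u)))
    square : ∀ x → N * ((3 + 3 * u) * ((3 + 3 * u) * x)) ≈ N * (2 + 3 * u) * x
    square x = ≈-trans (*-cong-≈ N
        (≈-trans (≡⇒≈ (trans (sym (*-assoc (3 + 3 * u) (3 + 3 * u) x)) (*-comm _ x)))
      (≈-trans (*-cong-≈ x (multiples 0 1 m*m)) (≡⇒≈ (*-comm x (2 + 3 * u))))))
          (≡⇒≈ (sym (*-assoc N (2 + 3 * u) x)))

  -- Subsets

  χ : Subset n → ℕ → Bool
  χ K x = lookup K (x mod n)

  χ-respects : ∀ K → Respects (χ K)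
  χ-respects K {a} {b} a≈b = cong (lookup K) (mod-toℕ (b mod n) (≈-trans a≈b (≈-sym (toℕ-mod b))))

  χ-toℕ : ∀ K i → χ K (toℕ i) ≡ lookup K i
  χ-toℕ K i = cong (lookup K) (mod-toℕ i (≡⇒≈ refl))

  χ-∈ : ∀ K x → χ K x ≡ true → x mod n ∈ K
  χ-∈ K x h = lookup⇒[]= (x mod n) K h

  χ-size : ∀ K → count (χ K) n ≡ ∣ K ∣
  χ-size K = trans (count≡∑ (χ K) n) (trans (sum-cong-≗ (λ i → cong ⟦_⟧ (χ-toℕ K i))) (sym (∣∣≡∑ K)))

  private
    cancel-≈ : ∀ {s} x → x ≈ s + x → s ≈ 0
    cancel-≈ {s} x (multiples i j eq) =
        multiples j i (+-cancelˡ-≡ x _ _ (trans (regroup x s (j * n)) (sym eq)))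
      where
      regroup : ∀ x s k → x + (s + k) ≡ s + x + k
      regroup x s k = solve (x ∷ s ∷ k ∷ [])

    generator-≉0 : ∀ {s} → Generator s → ¬ s ≈ 0
    generator-≉0 g p = positive g (≈⇒≡ (gen-< g) (s≤s z≤n) p)
      where
      positive : ∀ {s} → Generator s → s ≢ 0
      positive g₁ ()
      positive g₂ ()
      positive g₃ ()

  module Affine (α : Automorphism) (c : ℕ) where

    open Automorphism α

    φ ψ : ℕ → ℕ
    φ x = c + g * x
    ψ y = g′ * (y + N * c)

    φ-cong : ∀ {x y} → x ≈ y → φ x ≈ φ y
    φ-cong p = +-cong-≈ c (*-cong-≈ g p)

    ψ-cong : ∀ {x y} → x ≈ y → ψ x ≈ ψ y
    ψ-cong {x} {y} p = *-cong-≈ g′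
        (≈-trans (≡⇒≈ (+-comm x (N * c))) (≈-trans (+-cong-≈ (N * c) p) (≡⇒≈ (+-comm (N * c) y))))

    φψ : ∀ y → φ (ψ y) ≈ y
    φψ y = affine-inverse c g g′ y inverse

    ψφ : ∀ x → ψ (φ x) ≈ x
    ψφ x = affine-inverse′ c g g′ x inverse

    φ-injective : ∀ {x y} → φ x ≈ φ y → x ≈ y
    φ-injective {x} {y} p = ≈-trans (≈-sym (ψφ x)) (≈-trans (ψ-cong p) (ψφ y))

    φ-near : ∀ {x y} → Near x y → Near (φ x) (φ y)
    φ-near p = near-translate c (near p)

    ψ-near : ∀ {x y} → Near x y → Near (ψ x) (ψ y)
    ψ-near {x} {y} p = near′ (near-resp (≡⇒≈ (+-comm (N * c) x)) (≡⇒≈ (+-comm (N * c) y))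
        (near-translate (N * c) p))

    φ-0 : φ 0 ≈ c
    φ-0 = ≡⇒≈ (trans (cong (c +_) (*-zeroʳ g)) (+-identityʳ c))

    module _ {G′ : Graph n} {k K} (clique : IsClique G′ k K) where

      adjacent-in : ∀ {s} → Generator s → ∀ x → χ K (φ x) ≡ true → χ K (φ (s + x)) ≡ true →
                    G′ (φ x mod n) (φ (s + x) mod n) × C (φ x mod n) (φ (s + x) mod n)
      adjacent-in {s} gen x h h′ =
          proj₂ clique p q (χ-∈ K (φ x) h) (χ-∈ K (φ (s + x)) h′) p≢q , near⇒cayley p q p≢q
        (near-resp (≈-sym (toℕ-mod (φ x))) (≈-sym (toℕ-mod (φ (s + x))))
            (φ-near (s , gen , inj₁ (≡⇒≈ refl))))
        where
        p q : Fin n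
        p = φ x mod n
        q = φ (s + x) mod n
        p≢q : p ≢ q
        p≢q eq = generator-≉0 gen (cancel-≈ x (φ-injective
          (≈-trans (≈-sym (toℕ-mod (φ x))) (≈-trans (≡⇒≈ (cong toℕ eq)) (toℕ-mod (φ (s + x)))))))

      χφ-respects : Respects (χ K ∘ φ)
      χφ-respects p = χ-respects K (φ-cong p)

      χφ-size : count (χ K ∘ φ) n ≡ k
      χφ-size = trans (count-affine (χ-respects K) c g g′ inverse) (trans (χ-size K) (proj₁ clique))

  no-clique : ∀ K → ¬ IsClique G r K
  no-clique K clique = no-independent independent (proj₁ some) (proj₂ some)
    where
    open Affine identity 0
    apart : ∀ {s} → Generator s → ∀ x → χ K (φ x) ≡ true → χ K (φ (s + x)) ≡ true → ⊥
    apart {s} g x h h′ = proj₂ (proj₁ adj) (proj₂ adj)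
      where
      adj : G (φ x mod n) (φ (s + x) mod n) × C (φ x mod n) (φ (s + x) mod n)
      adj = adjacent-in clique g x h h′
    independent : Independent (χ K ∘ φ)
    independent = record
      { sparse = record
        { respects = χφ-respects clique
        ; apart₁   = apart g₁
        ; apart₂   = apart g₂
        ; size     = χφ-size clique
        }
      ; apart₃ = apart g₃
      }
    some : ∃ λ x → χ K (φ x) ≡ true
    some = count-witness (χ K ∘ φ) n (χφ-size clique)

  private
    2m<n : 3 + 3 * u + (3 + 3 * u) < 7 + (15 * u + 9 * u * u)
    2m<n = from (9 * u + 9 * u * u) (z≤n {0}) (solve (u ∷ []))
    1≢m : 1 ≡ 3 + 3 * u → ⊥
    1≢m p₁ = n≮0 {0} (from (1 + 3 * u) (≤-reflexive (sym p₁)) (solve (u ∷ [])))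
    m-1≢m : 2 + 3 * u ≡ 3 + 3 * u → ⊥
    m-1≢m p₁ = n≮0 {0} (from 0 (≤-reflexive (sym p₁)) (solve (u ∷ [])))

  -- `φ` carries the model edge {0, m} to the given pair; `target` is the condition at m.
  module Around (1≤u : 1 ≤ u) (α : Automorphism) (v v′ : Fin n)
    (target : toℕ v + Automorphism.g α * (3 + 3 * u) ≈ toℕ v′) where

    open Affine α (toℕ v)

    at-v : ∀ {x} → φ x mod n ≡ v → x ≈ 0
    at-v {x} eq = φ-injective (≈-trans (≈-sym (toℕ-mod (φ x))) (≈-trans (≡⇒≈ (cong toℕ eq)) (≈-sym φ-0)))

    at-v′ : ∀ {x} → φ x mod n ≡ v′ → x ≈ 3 + 3 * u
    at-v′ {x} eq = φ-injective
        (≈-trans (≈-sym (toℕ-mod (φ x))) (≈-trans (≡⇒≈ (cong toℕ eq)) (≈-sym target)))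

    module _ {K} (clique : IsClique (AddEdge G v v′) r K) where

      private
        Y : ℕ → Bool
        Y = χ K ∘ φ

      only-edge : ∀ {s} → Generator s → ∀ x → Y x ≡ true → Y (s + x) ≡ true → x ≈ 0 × s ≡ 3 + 3 * u
      only-edge {s} g x h h′ = cases (adjacent-in clique g x h h′)
        where
        cases : AddEdge G v v′ (φ x mod n) (φ (s + x) mod n) × C (φ x mod n) (φ (s + x) mod n) →
            x ≈ 0 × s ≡ 3 + 3 * u
        cases (inj₁ (_ , ¬c) , c) = ⊥-elim (¬c c)
        cases (inj₂ (inj₁ (p , q)) , _) = at-v p , ≈⇒≡ (gen-< g) (gen-< g₃)
          (≈-trans (≡⇒≈ (sym (+-identityʳ s))) (≈-trans (+-cong-≈ s (≈-sym (at-v p))) (at-v′ q)))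
        -- In the reversed orientation s + m would be 0 modulo n, yet s + m is at most 2 m, which is
        -- below n.
        cases (inj₂ (inj₂ (p , q)) , _) =
            ⊥-elim (m+1+n≢0 s (≈⇒≡ (≤-<-trans (+-monoˡ-≤ (3 + 3 * u) (gen-≤ g)) 2m<n) (s≤s z≤n)
          (≈-trans (+-cong-≈ s (≈-sym (at-v′ p))) (at-v q))))

      sparse : Sparse Y
      sparse = record
        { respects = χφ-respects clique
        ; apart₁   = λ x h h′ → 1≢m (proj₂ (only-edge g₁ x h h′))
        ; apart₂   = λ x h h′ → m-1≢m (proj₂ (only-edge g₂ x h h′))
        ; size     = χφ-size clique
        }

      private
        -- If one end of the new edge were missing, the set would be independent with r elements.
        both-ends : ¬ (Y 0 ≡ true → Y (3 + 3 * u) ≡ true → ⊥)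
        both-ends missing = no-independent independent (proj₁ some) (proj₂ some)
          where
          independent : Independent Y
          independent = record { sparse = sparse ; apart₃ = apart }
            where
            apart : ∀ x → Y x ≡ true → Y (3 + 3 * u + x) ≡ true → ⊥
            apart x h h′ = missing (trans (sym (Sparse.respects sparse x≈0)) h)
              (trans (sym (Sparse.respects sparse (≈-trans (+-cong-≈ (3 + 3 * u) x≈0)
                  (≡⇒≈ (+-identityʳ _))))) h′)
              where
              x≈0 : x ≈ 0
              x≈0 = proj₁ (only-edge g₃ x h h′)
          some : ∃ λ x → Y x ≡ true
          some = count-witness Y n (χφ-size clique)

      clique-edge : OneEdge Y
      clique-edge = record
        { sparse = sparse
        ; end₁   = Bool.¬-not λ eq → both-ends λ h _ → true≢false h eq
        ; end₂   = Bool.¬-not λ eq → both-ends λ _ h → true≢false h eq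
        ; only   = λ x h h′ → proj₁ (only-edge g₃ x h h′)
        }
        where
        true≢false : ∀ {b} → b ≡ true → b ≡ false → ⊥
        true≢false refl ()

      clique-pattern : ∀ x → Y x ≡ pattern₀ x
      clique-pattern x = trans (χφ-respects clique (≈-sym (%-≈ x))) (trans below (respects₀ (%-≈ x)))
        where
        y : ℕ
        y = x % n
        below : Y y ≡ pattern₀ y
        below = equal (agree 1≤u clique-edge pattern-edge y (m%n<n x n))
            (agree 1≤u pattern-edge clique-edge y (m%n<n x n))
          where
          equal : ∀ {a b} → (a ≡ true → b ≡ true) → (b ≡ true → a ≡ true) → a ≡ b
          equal {true}  {b}     f _ = sym (f refl)
          equal {false} {false} _ _ = refl
          equal {false} {true}  _ g = g refl

    f₀ : Fin n → Bool
    f₀ i = pattern₀ (ψ (toℕ i))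

    K₀ : Subset n
    K₀ = tabulate f₀

    unique : ∀ K → IsClique (AddEdge G v v′) r K → K ≡ K₀
    unique K clique = trans (sym (tabulate∘lookup K)) (tabulate-cong λ i → begin
      lookup K i            ≡⟨ sym (χ-toℕ K i) ⟩
      χ K (toℕ i)           ≡⟨ χ-respects K (≈-sym (φψ (toℕ i))) ⟩
      χ K (φ (ψ (toℕ i)))   ≡⟨ clique-pattern clique (ψ (toℕ i)) ⟩
      pattern₀ (ψ (toℕ i))  ∎)
      where open ≡-Reasoning

    K₀-size : ∣ K₀ ∣ ≡ r
    K₀-size = begin
      ∣ K₀ ∣                                      ≡⟨ ∣∣≡∑ K₀ ⟩
      ∑ (λ i → ⟦ lookup K₀ i ⟧)                   ≡⟨ sum-cong-≗ (λ i → cong ⟦_⟧ (lookup∘tabulate f₀ i)) ⟩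
      ∑ {n} (λ i → ⟦ pattern₀ (ψ (toℕ i)) ⟧)      ≡⟨ sym (count≡∑ (pattern₀ ∘ ψ) n) ⟩
      count (pattern₀ ∘ ψ) n
          ≡⟨ count-cong (λ y → cong pattern₀ (trans (*-distribˡ-+ g′ y _) (+-comm (g′ * y) _))) n ⟩
      count (λ y → pattern₀ (g′ * (N * toℕ v) + g′ * y)) n
        ≡⟨ count-affine respects₀ (g′ * (N * toℕ v)) g′ g (≈-trans (≡⇒≈ (*-comm g′ g)) inverse) ⟩
      count pattern₀ n                            ≡⟨ pattern-size ⟩
      r                                           ∎
      where
      open ≡-Reasoning
      open Automorphism α

    K₀-clique : IsClique (AddEdge G v v′) r K₀
    K₀-clique = K₀-size , adjacent
      where
      member : ∀ x → x ∈ K₀ → pattern₀ (ψ (toℕ x)) ≡ true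
      member x x∈ = trans (sym (lookup∘tabulate f₀ x)) ([]=⇒lookup x∈)
      ends : ∀ x y → pattern₀ (ψ (toℕ x)) ≡ true → pattern₀ (ψ (toℕ y)) ≡ true →
             ∀ {s} → Generator s → s + ψ (toℕ x) ≈ ψ (toℕ y) → x ≡ v × y ≡ v′
      ends x y hx hy {s} g p = toℕ-injective (≈⇒≡ (toℕ<n x) (toℕ<n v)
          (≈-trans (≈-sym (φψ (toℕ x))) (≈-trans (φ-cong x≈0) φ-0)))
        , toℕ-injective (≈⇒≡ (toℕ<n y) (toℕ<n v′)
            (≈-trans (≈-sym (φψ (toℕ y))) (≈-trans (φ-cong y≈m) target)))
        where
        both : ψ (toℕ x) ≈ 0 × s ≡ 3 + 3 * u
        both = pattern-apart g (ψ (toℕ x)) hx (trans (respects₀ p) hy)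
        x≈0 : ψ (toℕ x) ≈ 0
        x≈0 = proj₁ both
        y≈m : ψ (toℕ y) ≈ 3 + 3 * u
        y≈m = ≈-trans (≈-sym p) (≈-trans (+-cong-≈ s x≈0) (≡⇒≈ (trans (+-identityʳ s) (proj₂ both))))
      adjacent : ∀ x y → x ∈ K₀ → y ∈ K₀ → x ≢ y → AddEdge G v v′ x y
      adjacent x y x∈ y∈ x≢y = cases (cayley? x y x≢y)
        where
        near-cases : Near (ψ (toℕ x)) (ψ (toℕ y)) → AddEdge G v v′ x y
        near-cases (s , g , inj₁ p) = inj₂ (inj₁ (ends x y (member x x∈) (member y y∈) g p))
        near-cases (s , g , inj₂ p) = inj₂ (inj₂ (proj₂ y≡v×x≡v′ , proj₁ y≡v×x≡v′))
          where
          y≡v×x≡v′ : y ≡ v × x ≡ v′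
          y≡v×x≡v′ = ends y x (member y y∈) (member x x∈) g p
        cases : Dec (C x y) → AddEdge G v v′ x y
        cases (yes c) = near-cases (ψ-near (cayley⇒near x y c))
        cases (no ¬c) = inj₁ (x≢y , ¬c)

  UniqueClique : Fin n → Fin n → Set
  UniqueClique v v′ = Σ (Subset n) λ K → IsClique (AddEdge G v v′) r K ×
      (∀ K′ → IsClique (AddEdge G v v′) r K′ → K′ ≡ K)

  private
    half-turn : ∀ m → (m * (2 + 3 * u)) * (3 + 3 * u) ≡ m * ((3 + 3 * u) * (2 + 3 * u))
    half-turn m = solve (m ∷ u ∷ [])

  unique-clique : 1 ≤ u → ∀ v v′ {s} → Generator s → s + toℕ v ≈ toℕ v′ → UniqueClique v v′
  unique-clique 1≤u v v′ g p = K₀ , K₀-clique , unique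
    where
    automorphism : ∀ {s} → Generator s → Σ Automorphism λ α → Automorphism.g α * (3 + 3 * u) ≈ s
    -- The multiplier has to take m to the generator: -(m - 1) m is 1, and m² is m - 1.
    automorphism g₁ = inverted rotation , ≈-trans (≡⇒≈ (trans (half-turn N) (cong (N *_) m*[m-1]))) N*N≈1
    automorphism g₂ = rotation , multiples 0 1 m*m
    automorphism g₃ = identity , ≡⇒≈ (*-identityˡ (3 + 3 * u))
    open Around 1≤u (proj₁ (automorphism g)) v v′
      (≈-trans (+-cong-≈ (toℕ v) (proj₂ (automorphism g))) (≈-trans (≡⇒≈ (+-comm (toℕ v) _)) p))

  swap-edge : ∀ {v v′ k K} → IsClique (AddEdge G v v′) k K → IsClique (AddEdge G v′ v) k K
  swap-edge (size , adj) = size , λ x y x∈ y∈ x≢y → swap (adj x y x∈ y∈ x≢y)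
    where
    swap : ∀ {v v′ x y} → AddEdge G v v′ x y → AddEdge G v′ v x y
    swap (inj₁ e)        = inj₁ e
    swap (inj₂ (inj₁ p)) = inj₂ (inj₂ p)
    swap (inj₂ (inj₂ p)) = inj₂ (inj₁ p)

  saturated : 1 ≤ u → ∀ v v′ → v ≢ v′ → ¬ G v v′ → UniqueClique v v′
  saturated 1≤u v v′ v≢v′ ¬e = cases (cayley? v v′ v≢v′)
    where
    near-cases : Near (toℕ v) (toℕ v′) → UniqueClique v v′
    near-cases (s , g , inj₁ p) = unique-clique 1≤u v v′ g p
    near-cases (s , g , inj₂ p) = swapped (unique-clique 1≤u v′ v g p)
      where
      swapped : UniqueClique v′ v → UniqueClique v v′
      swapped (K , clique , unique) = K , swap-edge clique , λ K′ clique′ → unique K′ (swap-edge clique′)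
    cases : Dec (C v v′) → UniqueClique v v′
    cases (yes c) = near-cases (cayley⇒near v v′ c)
    cases (no ¬c) = ⊥-elim (¬e (v≢v′ , ¬c))

  no-dominating : ∀ x → ¬ Dominating G x
  no-dominating x dominating = proj₂ (dominating y x≢y) (near⇒cayley x y x≢y near)
    where
    y : Fin n
    y = (1 + toℕ x) mod n
    near : Near (toℕ x) (toℕ y)
    near = 1 , g₁ , inj₁ (≈-sym (toℕ-mod (1 + toℕ x)))
    x≢y : x ≢ y
    x≢y eq = generator-≉0 g₁ (cancel-≈ (toℕ x) (≈-trans (≡⇒≈ (cong toℕ eq)) (toℕ-mod (1 + toℕ x))))

  private
    r≤n : 2 + (4 * u + 3 * u * u) ≤ 7 + (15 * u + 9 * u * u)
    r≤n = from (5 + 11 * u + 6 * u * u) (z≤n {0}) (solve (u ∷ []))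

  is-primitive : 1 ≤ u → Primitive G r
  is-primitive 1≤u = (r≤n , no-clique , saturated 1≤u) , no-dominating

private
  -- The truncated differences of the theorem enter as variables, so that equations can turn them
  -- into polynomials in u.
  is-primitive-with : ∀ u → 1 ≤ u → ∀ {N a b R} → N ≡ 6 + (15 * u + 9 * u * u) → a ≡ 2 + 3 * u →
      b ≡ 3 + 3 * u →
                   R ≡ 1 + (4 * u + 3 * u * u) → Primitive (Complement (Cayley (suc N) (1 ∷ a ∷ b ∷ [])))
                       (suc R)
  is-primitive-with u 1≤u refl refl refl refl = Graphs.is-primitive u 1≤u

  n-size : ∀ u → 9 * suc u * suc u ≡ 6 + (15 * u + 9 * u * u) + 3 * suc u
  n-size u = solve (u ∷ [])

  r-size : ∀ u → 3 * suc u * suc u ≡ 1 + (4 * u + 3 * u * u) + 2 * suc u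
  r-size u = solve (u ∷ [])

  m-size : ∀ u → 3 * suc u ≡ 3 + 3 * u
  m-size u = solve (u ∷ [])

theorem3 : (t : ℕ) → 2 ≤ t →
    Primitive (Complement (Cayley (suc (9 * t * t ∸ 3 * t)) (1 ∷ (3 * t ∸ 1) ∷ (3 * t) ∷ [])))
    (suc (3 * t * t ∸ 2 * t))
theorem3 (suc u) (s≤s 1≤u) = is-primitive-with u 1≤u
  (trans (cong (_∸ 3 * suc u) (n-size u)) (m+n∸n≡m _ (3 * suc u)))
  (cong (_∸ 1) (m-size u)) (m-size u)
  (trans (cong (_∸ 2 * suc u) (r-size u)) (m+n∸n≡m _ (2 * suc u)))
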